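{- Let $m\le 163$ be a positive integer, let $C$ be an extremal binary doubly even self-dual $[24m+16,12m+8,4m+4]$ code, and for $w\equiv0\pmod 4$ with $4m+4\le w\le 24m+16-(4m+4)$ let $D_w$ be the support design of $C$ of weight $w$. (1)(i) Let $w\neq 12m+8$. If $D_w$ is a $4$-design, then $m\in\{10,23,79,93,118,120,123,125,142\}$. If $D_w$ is a $5$-design, then $m\in\{23,79,93,118,120,123,125,142\}$. (1)(ii) If $D_{12m+8}$ is a $4$-design, then $D_{12m+8}$ is a $5$-design and $m\in\{10,23,79,93,118,120,123,125,142\}$. (2) For no such $w$ is $D_w$ a $6$-design.
   Context: A binary doubly even self-dual code of length $n$ is a binary linear code $C\subseteq\mathbb{F}_2^n$ with $C=C^\perp$ such that every codeword has Hamming weight divisible by $4$; it is extremal if its minimum nonzero weight equals $4\lfloor n/24\rfloor+4$. A $t$-design on a point set $X$ is a collection of $k$-subsets (blocks) of $X$ such that every $t$-subset of $X$ lies in the same number of blocks. The support design $D_w$ has point set $\{1,\dots,n\}$ and as blocks the supports $\{i:c_i\ne0\}$ of all codewords $c\in C$ of weight $w$. -}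

module Defs where

open import Data.Bool using (Bool; true; false; _∧_; _xor_)
open import Data.Nat using (ℕ; zero; suc; _+_; _*_; _≤_; _/_)
open import Data.Vec using (Vec; []; _∷_; foldr; zipWith; replicate)
open import Data.List using (List; []; _∷_; _++_; map; filter; length)
open import Data.Product using (_×_; ∃)
open import Data.Fin.Subset using (Subset; ∣_∣; _⊆_)
open import Data.Fin.Subset.Properties using (_⊆?_)
open import Relation.Binary.PropositionalEquality using (_≡_; _≢_)
open import Relation.Nullary using (Dec)

-- Vectors of F₂ⁿ, with Bool playing the role of F₂ (true = 1, false = 0).
Word : ℕ → Set
Word n = Vec Bool n

Code : ℕ → Set
Code n = Word n → Bool

_∈C_ : {n : ℕ} → Word n → Code n → Set
c ∈C C = C c ≡ true

dot : {n : ℕ} → Word n → Word n → Bool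
dot c d = foldr _ _xor_ false (zipWith _∧_ c d)

-- Support {i : c_i ≠ 0} as a subset of Fin n (Subset n = Vec Bool n,
-- inside = true), so the support of c is c itself viewed as a subset.
support : {n : ℕ} → Word n → Subset n
support c = c

weight : {n : ℕ} → Word n → ℕ
weight c = ∣ support c ∣

allWords : (n : ℕ) → List (Word n)
allWords zero = [] ∷ []
allWords (suc n) = map (false ∷_) (allWords n) ++ map (true ∷_) (allWords n)

-- Self-dual: C = C^⊥, i.e. c ∈ C ⇔ c is orthogonal to every codeword.
-- (C^⊥ is always linear, so this also forces C to be linear.)
SelfDual : {n : ℕ} → Code n → Set
SelfDual {n} C = (c : Word n) → (c ∈C C → ((d : Word n) → d ∈C C → dot c d ≡ false))
                              × (((d : Word n) → d ∈C C → dot c d ≡ false) → c ∈C C)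

data Div4 : ℕ → Set where
  div4 : (k : ℕ) → Div4 (4 * k)

DoublyEven : {n : ℕ} → Code n → Set
DoublyEven {n} C = (c : Word n) → c ∈C C → Div4 (weight c)

MinWeight : {n : ℕ} → Code n → ℕ → Set
MinWeight {n} C d = (∃ λ (c : Word n) → c ∈C C × weight c ≢ 0 × weight c ≡ d)
                  × ((c : Word n) → c ∈C C → weight c ≢ 0 → d ≤ weight c)

ExtremalDoublyEvenSelfDual : {n : ℕ} → Code n → Set
ExtremalDoublyEvenSelfDual {n} C =
  SelfDual C × DoublyEven C × MinWeight C (4 * (n / 24) + 4)

blocksContaining : {n : ℕ} → Subset n → List (Subset n) → ℕ
blocksContaining T B = length (filter (λ b → T ⊆? b) B)

IsTDesign : {n : ℕ} → ℕ → List (Subset n) → Set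
IsTDesign {n} t B = (T T′ : Subset n) → ∣ T ∣ ≡ t → ∣ T′ ∣ ≡ t →
                    blocksContaining T B ≡ blocksContaining T′ B

isWeight : {n : ℕ} → Code n → ℕ → Word n → Bool
isWeight C w c = C c ∧ Data.Nat._≡ᵇ_ (weight c) w

supportDesign : {n : ℕ} → Code n → ℕ → List (Subset n)
supportDesign {n} C w = map support (Data.List.filterᵇ (isWeight C w) (allWords n))

{-# OPTIONS --safe #-}

-- Poisson summation over a self-dual code C of length n, applied to c ↦ [T ⊆ c] (zeros c choose j), shows that the
-- differences δ_w of the numbers of weight-w codewords containing two t-sets T, T′ satisfy ∑ δ_w (n - w choose j) = 0
-- for j < d - t, the moment j = d - t being a multiple of δ_d. Only 4m + 3 weights occur between d and n - d, so
-- evaluating on polynomials with prescribed roots leaves relations between few δ_w; for t ≤ 6 they show that a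
-- t-design of any weight (of a weight ≠ n / 2 when t = 5, 6) makes the minimum weight codewords a t-design. The same
-- summation without T computes the number of codewords of each weight, and integrality of the covering numbers
-- excludes every m outside the lists except m = 20: there ∣ B ∩ c ∣ is even for all codewords B and c, and for a
-- minimum weight codeword B the sum of (∣ B ∩ c ∣ / 2 choose 4) over the minimum weight c would not be an integer.
module Submission where

-- With 4m + 3 = d - 1 weights, a polynomial of degree d - t - 1, whose sum vanishes, leaves t
-- weights free, and one of degree d - t, whose sum is a multiple of δ_d of sign (-1)^t, leaves t -
-- 1. Complementation adds δ_(n-w) = (-1)^t δ_w once weight w is balanced below t. Hence d and n - d
-- contribute a single unknown, and a t-design of weight w brings one of weight n - w. For t = 3 and
-- t = 5 the number of roots is odd and all coefficients of δ_d agree in sign: t = 3 comes for free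
-- after t = 2, and t = 5 has room for w and n - w as further free weights. At w = n / 2 these two
-- coincide, so another unknown δ would remain free; this is why that weight is set apart. For t = 4
-- and t = 6 no sign argument exists and the coefficient of δ_d has to be shown nonzero, by parity
-- for t = 4 and by evaluation for t = 6. For t = 6 degree d - 6 would leave five weights; degree d
-- - 4 leaves three, and the two additional moments that it involves are known because no codeword
-- has a weight strictly between d and d + 4.

open import Defs

-- Sums over binary words, characters, and Poisson summation over a self-dual code.

module WordSums where
  open import Data.Bool using (Bool; true; false; _∧_; _xor_)
  open import Data.Bool.Properties using (not-involutive)
  open import Data.Nat as ℕ using (zero; suc)
  open import Data.Integer using (ℤ; +_; 0ℤ; 1ℤ; -1ℤ; -[1+_]; _+_; _*_; _-_; -_)
  open import Data.Integer.Properties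
  open import Data.Integer.Tactic.RingSolver using (solve-∀)
  open import Data.Vec using ([]; _∷_; zipWith)
  open import Data.Product using (∃; _,_; _×_; proj₁; proj₂)
  open import Data.Sum using (_⊎_; inj₁; inj₂)
  open import Data.Empty using (⊥-elim)
  open import Function using (_∘_)
  open import Relation.Binary.PropositionalEquality
  open ≡-Reasoning

  -- Recursion on coordinates, instead of a fold over `allWords`, makes a sum split definitionally
  -- at the first coordinate, which is how the transforms below are computed.
  Σw : ∀ {n} → (Word n → ℤ) → ℤ
  Σw {zero}  f = f []
  Σw {suc n} f = Σw (f ∘ (false ∷_)) + Σw (f ∘ (true ∷_))

  Σw-cong : ∀ {n} {f g : Word n → ℤ} → (∀ c → f c ≡ g c) → Σw f ≡ Σw g
  Σw-cong {zero}  e = e []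
  Σw-cong {suc n} e = cong₂ _+_ (Σw-cong (λ c → e (false ∷ c))) (Σw-cong (λ c → e (true ∷ c)))

  Σw-0 : ∀ {n} {f : Word n → ℤ} → (∀ c → f c ≡ 0ℤ) → Σw f ≡ 0ℤ
  Σw-0 {zero}  e = e []
  Σw-0 {suc n} e = cong₂ _+_ (Σw-0 (λ c → e (false ∷ c))) (Σw-0 (λ c → e (true ∷ c)))

  interchange : ∀ a b c d → (a + b) + (c + d) ≡ (a + c) + (b + d)
  interchange = solve-∀

  Σw-+ : ∀ {n} (f g : Word n → ℤ) → Σw (λ c → f c + g c) ≡ Σw f + Σw g
  Σw-+ {zero}  f g = refl
  Σw-+ {suc n} f g =
    trans (cong₂ _+_ (Σw-+ (f ∘ (false ∷_)) (g ∘ (false ∷_))) (Σw-+ (f ∘ (true ∷_)) (g ∘ (true ∷_))))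
          (interchange (Σw (f ∘ (false ∷_))) _ _ _)

  Σw-* : ∀ {n} a (f : Word n → ℤ) → Σw (λ c → a * f c) ≡ a * Σw f
  Σw-* {zero}  a f = refl
  Σw-* {suc n} a f =
    trans (cong₂ _+_ (Σw-* a (f ∘ (false ∷_))) (Σw-* a (f ∘ (true ∷_)))) (sym (*-distribˡ-+ a _ _))

  Σw-- : ∀ {n} (f g : Word n → ℤ) → Σw (λ c → f c - g c) ≡ Σw f - Σw g
  Σw-- f g = begin
    Σw (λ c → f c - g c)              ≡⟨ Σw-+ f (λ c → - g c) ⟩
    Σw f + Σw (λ c → - g c)           ≡⟨ cong (λ x → Σw f + x) (Σw-cong (λ c → sym (-1*i≡-i (g c)))) ⟩
    Σw f + Σw (λ c → -1ℤ * g c)       ≡⟨ cong (λ x → Σw f + x) (trans (Σw-* -1ℤ g) (-1*i≡-i (Σw g))) ⟩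
    Σw f - Σw g ∎

  Σw-swap : ∀ {n k} (f : Word n → Word k → ℤ) →
            Σw (λ c → Σw (λ d → f c d)) ≡ Σw (λ d → Σw (λ c → f c d))
  Σw-swap {zero}  f = refl
  Σw-swap {suc n} f = trans (cong₂ _+_ (Σw-swap (f ∘ (false ∷_))) (Σw-swap (f ∘ (true ∷_))))
                            (sym (Σw-+ (λ d → Σw (λ c → f (false ∷ c) d)) (λ d → Σw (λ c → f (true ∷ c) d))))

  infixl 6 _⊕_
  _⊕_ : ∀ {n} → Word n → Word n → Word n
  _⊕_ = zipWith _xor_

  Σw-⊕ : ∀ {n} (f : Word n → ℤ) d → Σw (λ c → f (c ⊕ d)) ≡ Σw f
  Σw-⊕ {zero}  f []          = refl
  Σw-⊕ {suc n} f (false ∷ d) = cong₂ _+_ (Σw-⊕ (f ∘ (false ∷_)) d) (Σw-⊕ (f ∘ (true ∷_)) d)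
  Σw-⊕ {suc n} f (true ∷ d)  =
    trans (cong₂ _+_ (Σw-⊕ (f ∘ (true ∷_)) d) (Σw-⊕ (f ∘ (false ∷_)) d)) (+-comm (Σw (f ∘ (true ∷_))) _)

  ⟦_⟧ : Bool → ℤ
  ⟦ true ⟧  = 1ℤ
  ⟦ false ⟧ = 0ℤ

  sgn : Bool → ℤ
  sgn false = 1ℤ
  sgn true  = -1ℤ

  sgn-xor : ∀ a b → sgn (a xor b) ≡ sgn a * sgn b
  sgn-xor false false = refl
  sgn-xor false true  = refl
  sgn-xor true  false = refl
  sgn-xor true  true  = refl

  χ : ∀ {n} → Word n → Word n → ℤ
  χ c d = sgn (dot c d)

  dot-∷ : ∀ {n} a (c : Word n) b d → χ (a ∷ c) (b ∷ d) ≡ sgn (a ∧ b) * χ c d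
  dot-∷ a c b d = sgn-xor (a ∧ b) (dot c d)

  ∧-xor-exchange : ∀ a b e x y → (a ∧ (b xor e)) xor (x xor y) ≡ ((a ∧ b) xor x) xor ((a ∧ e) xor y)
  ∧-xor-exchange false b e x y = refl
  ∧-xor-exchange true false e false y = refl
  ∧-xor-exchange true false false true y = refl
  ∧-xor-exchange true false true true y = refl
  ∧-xor-exchange true true false false y = refl
  ∧-xor-exchange true true true false y = sym (not-involutive y)
  ∧-xor-exchange true true false true y = not-involutive y
  ∧-xor-exchange true true true true y = refl

  dot-⊕ʳ : ∀ {n} (c d e : Word n) → dot c (d ⊕ e) ≡ dot c d xor dot c e
  dot-⊕ʳ [] [] [] = refl
  dot-⊕ʳ (a ∷ c) (b ∷ d) (b′ ∷ e) =
    trans (cong ((a ∧ (b xor b′)) xor_) (dot-⊕ʳ c d e)) (∧-xor-exchange a b b′ (dot c d) (dot c e))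

  dot-comm : ∀ {n} (c d : Word n) → dot c d ≡ dot d c
  dot-comm [] [] = refl
  dot-comm (a ∷ c) (b ∷ d) = cong₂ _xor_ (∧-comm a b) (dot-comm c d)
    where open import Data.Bool.Properties using (∧-comm)

  ⊕-involutive : ∀ {n} (c d : Word n) → (c ⊕ d) ⊕ d ≡ c
  ⊕-involutive [] [] = refl
  ⊕-involutive (a ∷ c) (b ∷ d) = cong₂ _∷_ (xor-twice a b) (⊕-involutive c d)
    where
    xor-twice : ∀ a b → (a xor b) xor b ≡ a
    xor-twice false false = refl
    xor-twice false true  = refl
    xor-twice true  false = refl
    xor-twice true  true  = refl

  -- Exhaustive search supplies, constructively, a codeword that is not orthogonal to a given word
  -- outside the code.
  find : ∀ {n} (p : Word n → Bool) → (∃ λ c → p c ≡ true) ⊎ (∀ c → p c ≡ false)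
  find {zero} p with p [] in e
  ... | true  = inj₁ ([] , e)
  ... | false = inj₂ λ { [] → e }
  find {suc n} p with find (p ∘ (false ∷_)) | find (p ∘ (true ∷_))
  ... | inj₁ (c , e) | _            = inj₁ (false ∷ c , e)
  ... | inj₂ _       | inj₁ (c , e) = inj₁ (true ∷ c , e)
  ... | inj₂ h       | inj₂ k       = inj₂ λ { (false ∷ c) → h c ; (true ∷ c) → k c }

  ∈C-⊕ : ∀ {n} {C : Code n} → SelfDual C → ∀ {c d} → c ∈C C → d ∈C C → (c ⊕ d) ∈C C
  ∈C-⊕ sd {c} {d} c∈ d∈ = proj₂ (sd (c ⊕ d)) λ e e∈ → begin
    dot (c ⊕ d) e       ≡⟨ dot-comm (c ⊕ d) e ⟩
    dot e (c ⊕ d)       ≡⟨ dot-⊕ʳ e c d ⟩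
    dot e c xor dot e d ≡⟨ cong₂ _xor_ (proj₁ (sd e) e∈ c c∈) (proj₁ (sd e) e∈ d d∈) ⟩
    false ∎

  ∈C-translate : ∀ {n} {C : Code n} → SelfDual C → ∀ {d} → d ∈C C → ∀ c → C (c ⊕ d) ≡ C c
  ∈C-translate {C = C} sd {d} d∈ c with C c in e | C (c ⊕ d) in e′
  ... | true  | true  = refl
  ... | false | false = refl
  ... | true  | false = trans (sym e′) (∈C-⊕ sd e d∈)
  ... | false | true  = trans (sym (∈C-⊕ sd e′ d∈)) (trans (cong C (⊕-involutive c d)) e)

  fourier : ∀ {n} → (Word n → ℤ) → Word n → ℤ
  fourier f d = Σw (λ c → f c * χ c d)

  size : ∀ {n} → Code n → ℤ
  size C = Σw (λ c → ⟦ C c ⟧)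

  i≡-i⇒i≡0 : ∀ i → i ≡ - i → i ≡ 0ℤ
  i≡-i⇒i≡0 (+ zero)     _  = refl
  i≡-i⇒i≡0 (+ suc n)    ()
  i≡-i⇒i≡0 -[1+ n ]   ()

  -- Orthogonality of characters: for `c` outside the code some codeword `d₀` has `χ c d₀` equal to
  -- -1, and translating the sum by `d₀` negates it.
  character-sum : ∀ {n} {C : Code n} → SelfDual C → ∀ c →
                  Σw (λ d → ⟦ C d ⟧ * χ c d) ≡ size C * ⟦ C c ⟧
  character-sum {C = C} sd c with C c in c∈
  ... | true = trans (Σw-cong pointwise) (sym (*-identityʳ _))
    where
    pointwise : ∀ d → ⟦ C d ⟧ * χ c d ≡ ⟦ C d ⟧
    pointwise d with C d in e
    ... | false = refl
    ... | true  rewrite proj₁ (sd c) c∈ d e = refl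
  ... | false with find (λ d → C d ∧ dot c d)
  ...   | inj₂ none = ⊥-elim (true≢false (trans (sym (proj₂ (sd c) orth)) c∈))
    where
    true≢false : true ≢ false
    true≢false ()
    orth : ∀ d → d ∈C C → dot c d ≡ false
    orth d d∈ = trans (sym (cong (_∧ dot c d) d∈)) (none d)
  ...   | inj₁ (d₀ , e) = trans (i≡-i⇒i≡0 X flip) (sym (*-zeroʳ (size C)))
    where
    X = Σw (λ d → ⟦ C d ⟧ * χ c d)
    ∧-true : ∀ a b → a ∧ b ≡ true → a ≡ true × b ≡ true
    ∧-true true true _ = refl , refl
    neg : ∀ a b → a * (b * -1ℤ) ≡ -1ℤ * (a * b)
    neg = solve-∀
    pointwise : ∀ d → ⟦ C (d ⊕ d₀) ⟧ * χ c (d ⊕ d₀) ≡ -1ℤ * (⟦ C d ⟧ * χ c d)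
    pointwise d = begin
      ⟦ C (d ⊕ d₀) ⟧ * χ c (d ⊕ d₀)
        ≡⟨ cong₂ (λ a b → ⟦ a ⟧ * sgn b) (∈C-translate sd (proj₁ (∧-true _ _ e)) d) (dot-⊕ʳ c d d₀) ⟩
      ⟦ C d ⟧ * sgn (dot c d xor dot c d₀)
        ≡⟨ cong (⟦ C d ⟧ *_) (trans (sgn-xor (dot c d) _) (cong (λ b → χ c d * sgn b) (proj₂ (∧-true (C d₀) _ e)))) ⟩
      ⟦ C d ⟧ * (χ c d * -1ℤ)
        ≡⟨ neg ⟦ C d ⟧ (χ c d) ⟩
      -1ℤ * (⟦ C d ⟧ * χ c d) ∎
    flip : X ≡ - X
    flip = begin
      X                                          ≡⟨ Σw-⊕ (λ d → ⟦ C d ⟧ * χ c d) d₀ ⟨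
      Σw (λ d → ⟦ C (d ⊕ d₀) ⟧ * χ c (d ⊕ d₀))   ≡⟨ Σw-cong pointwise ⟩
      Σw (λ d → -1ℤ * (⟦ C d ⟧ * χ c d))         ≡⟨ Σw-* -1ℤ (λ d → ⟦ C d ⟧ * χ c d) ⟩
      -1ℤ * X                                    ≡⟨ -1*i≡-i X ⟩
      - X ∎

  -- Exchanging the two sums leaves for each `c` a character sum over the code, which detects
  -- membership of `c` because the code is its own dual.
  poisson : ∀ {n} {C : Code n} → SelfDual C → ∀ f →
            Σw (λ d → ⟦ C d ⟧ * fourier f d) ≡ size C * Σw (λ c → ⟦ C c ⟧ * f c)
  poisson {C = C} sd f = begin
    Σw (λ d → ⟦ C d ⟧ * fourier f d)
      ≡⟨ Σw-cong (λ d → sym (Σw-* ⟦ C d ⟧ (λ c → f c * χ c d))) ⟩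
    Σw (λ d → Σw (λ c → ⟦ C d ⟧ * (f c * χ c d)))
      ≡⟨ Σw-swap (λ d c → ⟦ C d ⟧ * (f c * χ c d)) ⟩
    Σw (λ c → Σw (λ d → ⟦ C d ⟧ * (f c * χ c d)))
      ≡⟨ Σw-cong (λ c → trans (Σw-cong (λ d → left-comm ⟦ C d ⟧ (f c) (χ c d))) (Σw-* (f c) (λ d → ⟦ C d ⟧ * χ c d))) ⟩
    Σw (λ c → f c * Σw (λ d → ⟦ C d ⟧ * χ c d))
      ≡⟨ Σw-cong (λ c → trans (cong (f c *_) (character-sum sd c)) (rotate (f c) (size C) ⟦ C c ⟧)) ⟩
    Σw (λ c → size C * (⟦ C c ⟧ * f c))
      ≡⟨ Σw-* (size C) (λ c → ⟦ C c ⟧ * f c) ⟩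
    size C * Σw (λ c → ⟦ C c ⟧ * f c) ∎
    where
    left-comm : ∀ a b c → a * (b * c) ≡ b * (a * c)
    left-comm = solve-∀
    rotate : ∀ a b c → a * (b * c) ≡ b * (c * a)
    rotate = solve-∀

-- Fourier transforms of containment times a binomial in the number of zeros.

module Incidence where
  open WordSums
  open import Data.Bool using (Bool; true; false; _∧_; T)
  open import Data.Nat as ℕ using (ℕ; zero; suc; s≤s)
  import Data.Nat.Properties as ℕₚ
  open import Data.Nat.Combinatorics using (nCk+nC[k+1]≡[n+1]C[k+1]) renaming (_C_ to _choose_)
  open import Data.Integer using (ℤ; +_; 0ℤ; 1ℤ; -1ℤ; _+_; _*_)
  open import Data.Integer.Properties
  open import Data.Integer.Tactic.RingSolver using (solve-∀)
  open import Data.Vec using ([]; _∷_)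
  open import Relation.Binary.PropositionalEquality
  open ≡-Reasoning

  zeros : ∀ {n} → Word n → ℕ
  zeros []          = 0
  zeros (false ∷ c) = suc (zeros c)
  zeros (true ∷ c)  = zeros c

  infix 5 _⊑_
  _⊑_ : ∀ {n} → Word n → Word n → Bool
  []          ⊑ []      = true
  (false ∷ T) ⊑ (_ ∷ c) = T ⊑ c
  (true ∷ T)  ⊑ (b ∷ c) = b ∧ (T ⊑ c)

  inside outside neither : ∀ {n} → Word n → Word n → ℕ
  inside []          []          = 0
  inside (true ∷ T)  (true ∷ y)  = suc (inside T y)
  inside (true ∷ T)  (false ∷ y) = inside T y
  inside (false ∷ T) (_ ∷ y)     = inside T y
  outside []          []          = 0
  outside (false ∷ T) (true ∷ y)  = suc (outside T y)
  outside (false ∷ T) (false ∷ y) = outside T y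
  outside (true ∷ T)  (_ ∷ y)     = outside T y
  neither []          []          = 0
  neither (false ∷ T) (false ∷ y) = suc (neither T y)
  neither (false ∷ T) (true ∷ y)  = neither T y
  neither (true ∷ T)  (_ ∷ y)     = neither T y

  pascal : ∀ n k → + (suc n choose suc k) ≡ + (n choose k) + + (n choose suc k)
  pascal n k = cong +_ (sym (nCk+nC[k+1]≡[n+1]C[k+1] n k))

  -- H b r is the Fourier transform of c ↦ zeros c choose r at the zero word of length b.
  H : ℕ → ℕ → ℤ
  H zero    zero    = 1ℤ
  H zero    (suc r) = 0ℤ
  H (suc b) zero    = + 2 * H b 0
  H (suc b) (suc r) = + 2 * H b (suc r) + H b r

  -- With x marking the index `j`, the transform is a product over coordinates. A point of `T`
  -- forces a one and gives only a sign. Any other point gives (1 + x) + 1 = 2 + x where `y` is 0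
  -- and (1 + x) - 1 = x where `y` is 1. So this is the coefficient of x^j in ± x^outside (2 +
  -- x)^neither, and `H b r` is that of x^r in (2 + x)^b.
  coverTransform : ∀ {n} → Word n → Word n → ℕ → ℤ
  coverTransform []          []          zero    = 1ℤ
  coverTransform []          []          (suc j) = 0ℤ
  coverTransform (true ∷ T)  (b ∷ y)     j       = sgn b * coverTransform T y j
  coverTransform (false ∷ T) (false ∷ y) zero    = + 2 * coverTransform T y 0
  coverTransform (false ∷ T) (false ∷ y) (suc j) = + 2 * coverTransform T y (suc j) + coverTransform T y j
  coverTransform (false ∷ T) (true ∷ y)  zero    = 0ℤ
  coverTransform (false ∷ T) (true ∷ y)  (suc j) = coverTransform T y j

  -- Zeros are counted, not ones: when `T ⊑ c` they all lie outside `T`, so the points of `T` and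
  -- the remaining points do not interact.
  cover : ∀ {n} → Word n → ℕ → Word n → ℤ
  cover T j c = ⟦ T ⊑ c ⟧ * + (zeros c choose j)

  fourier-cover : ∀ {n} (T y : Word n) j → fourier (cover T j) y ≡ coverTransform T y j
  fourier-cover []          []          zero    = refl
  fourier-cover []          []          (suc j) = refl
  fourier-cover (true ∷ T)  (b ∷ y)     j = begin
    Σw (λ c → 0ℤ * + (suc (zeros c) choose j) * χ (false ∷ c) (b ∷ y)) +
    Σw (λ c → cover T j c * χ (true ∷ c) (b ∷ y))
      ≡⟨ cong₂ _+_ (Σw-0 {f = λ c → 0ℤ * + (suc (zeros c) choose j) * χ (false ∷ c) (b ∷ y)} (λ c → refl)) (Σw-cong (λ c → trans (cong (cover T j c *_) (dot-∷ true c b y)) (swap (cover T j c) (sgn b) (χ c y)))) ⟩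
    0ℤ + Σw (λ c → sgn b * (cover T j c * χ c y))
      ≡⟨ trans (+-identityˡ _) (Σw-* (sgn b) (λ c → cover T j c * χ c y)) ⟩
    sgn b * fourier (cover T j) y
      ≡⟨ cong (sgn b *_) (fourier-cover T y j) ⟩
    sgn b * coverTransform T y j ∎
    where
    swap : ∀ a b c → a * (b * c) ≡ b * (a * c)
    swap = solve-∀
  fourier-cover (false ∷ T) (b ∷ y) zero = begin
    Σw (λ c → cover (false ∷ T) 0 (false ∷ c) * χ (false ∷ c) (b ∷ y)) +
    Σw (λ c → cover T 0 c * χ (true ∷ c) (b ∷ y))
      ≡⟨ cong₂ _+_ (Σw-cong (λ c → cong (cover T 0 c *_) (trans (dot-∷ false c b y) (*-identityˡ _))))
                   (Σw-cong (λ c → trans (cong (cover T 0 c *_) (dot-∷ true c b y)) (swap (cover T 0 c) (sgn b) (χ c y)))) ⟩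
    F + Σw (λ c → sgn b * (cover T 0 c * χ c y))
      ≡⟨ cong (λ x → F + x) (Σw-* (sgn b) (λ c → cover T 0 c * χ c y)) ⟩
    F + sgn b * F
      ≡⟨ cong (λ x → x + sgn b * x) (fourier-cover T y 0) ⟩
    coverTransform T y 0 + sgn b * coverTransform T y 0
      ≡⟨ final b ⟩
    coverTransform (false ∷ T) (b ∷ y) 0 ∎
    where
    F = fourier (cover T 0) y
    swap : ∀ a b c → a * (b * c) ≡ b * (a * c)
    swap = solve-∀
    double : ∀ x → x + 1ℤ * x ≡ + 2 * x
    double = solve-∀
    cancel : ∀ x → x + -1ℤ * x ≡ 0ℤ
    cancel = solve-∀
    final : ∀ b → coverTransform T y 0 + sgn b * coverTransform T y 0 ≡ coverTransform (false ∷ T) (b ∷ y) 0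
    final false = double (coverTransform T y 0)
    final true  = cancel (coverTransform T y 0)
  fourier-cover (false ∷ T) (b ∷ y) (suc j) = begin
    Σw (λ c → ⟦ T ⊑ c ⟧ * + (suc (zeros c) choose suc j) * χ (false ∷ c) (b ∷ y)) +
    Σw (λ c → cover T (suc j) c * χ (true ∷ c) (b ∷ y))
      ≡⟨ cong₂ _+_ (Σw-cong (λ c → trans (cong₂ (λ u v → ⟦ T ⊑ c ⟧ * u * v) (pascal (zeros c) j) (dot-∷ false c b y))
                                          (expand ⟦ T ⊑ c ⟧ _ _ (χ c y))))
                   (Σw-cong (λ c → trans (cong (cover T (suc j) c *_) (dot-∷ true c b y)) (swap (cover T (suc j) c) (sgn b) (χ c y)))) ⟩
    Σw (λ c → cover T j c * χ c y + cover T (suc j) c * χ c y) + Σw (λ c → sgn b * (cover T (suc j) c * χ c y))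
      ≡⟨ cong₂ _+_ (Σw-+ (λ c → cover T j c * χ c y) _) (Σw-* (sgn b) (λ c → cover T (suc j) c * χ c y)) ⟩
    (fourier (cover T j) y + fourier (cover T (suc j)) y) + sgn b * fourier (cover T (suc j)) y
      ≡⟨ cong₂ (λ u v → (u + v) + sgn b * v) (fourier-cover T y j) (fourier-cover T y (suc j)) ⟩
    (coverTransform T y j + coverTransform T y (suc j)) + sgn b * coverTransform T y (suc j)
      ≡⟨ final b ⟩
    coverTransform (false ∷ T) (b ∷ y) (suc j) ∎
    where
    swap : ∀ a b c → a * (b * c) ≡ b * (a * c)
    swap = solve-∀
    expand : ∀ a u v x → a * (u + v) * (1ℤ * x) ≡ a * u * x + a * v * x
    expand = solve-∀
    double : ∀ u v → (u + v) + 1ℤ * v ≡ + 2 * v + u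
    double = solve-∀
    cancel : ∀ u v → (u + v) + -1ℤ * v ≡ u
    cancel = solve-∀
    final : ∀ b → (coverTransform T y j + coverTransform T y (suc j)) + sgn b * coverTransform T y (suc j)
                ≡ coverTransform (false ∷ T) (b ∷ y) (suc j)
    final false = double (coverTransform T y j) (coverTransform T y (suc j))
    final true  = cancel (coverTransform T y j) (coverTransform T y (suc j))

  sgnPow : ℕ → ℤ
  sgnPow zero    = 1ℤ
  sgnPow (suc i) = -1ℤ * sgnPow i

  -- The generating function is divisible by x to the power `outside T y`.
  coverTransform-low : ∀ {n} (T y : Word n) j → j ℕ.< outside T y → coverTransform T y j ≡ 0ℤ
  coverTransform-low []          []          j       ()
  coverTransform-low (true ∷ T)  (b ∷ y)     j       p = trans (cong (sgn b *_) (coverTransform-low T y j p)) (*-zeroʳ (sgn b))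
  coverTransform-low (false ∷ T) (false ∷ y) zero    p = cong (+ 2 *_) (coverTransform-low T y 0 p)
  coverTransform-low (false ∷ T) (false ∷ y) (suc j) p =
    cong₂ (λ u v → + 2 * u + v) (coverTransform-low T y (suc j) p) (coverTransform-low T y j (ℕₚ.<-trans (ℕₚ.n<1+n j) p))
  coverTransform-low (false ∷ T) (true ∷ y)  zero    p = refl
  coverTransform-low (false ∷ T) (true ∷ y)  (suc j) (s≤s p) = coverTransform-low T y j p

  -- Dividing the generating function by that power of x leaves a sign times (2 + x) to the power
  -- `neither T y`.
  coverTransform-high : ∀ {n} (T y : Word n) r →
    coverTransform T y (outside T y ℕ.+ r) ≡ sgnPow (inside T y) * H (neither T y) r
  coverTransform-high []          []          zero    = refl
  coverTransform-high []          []          (suc r) = refl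
  coverTransform-high (true ∷ T)  (false ∷ y) r = trans (*-identityˡ _) (coverTransform-high T y r)
  coverTransform-high (true ∷ T)  (true ∷ y)  r =
    trans (cong (-1ℤ *_) (coverTransform-high T y r)) (sym (*-assoc -1ℤ (sgnPow (inside T y)) (H (neither T y) r)))
  coverTransform-high (false ∷ T) (true ∷ y)  r = coverTransform-high T y r
  -- The recursion branches on whether the index `outside T y + 0` is zero. If it is not, the
  -- additional summand sits one place below the lowest power of x and vanishes.
  coverTransform-high (false ∷ T) (false ∷ y) zero with outside T y in e
  ... | zero  = trans (cong (+ 2 *_) (trans (cong (coverTransform T y) (cong (ℕ._+ 0) (sym e))) (coverTransform-high T y 0)))
                      (swap (+ 2) (sgnPow (inside T y)) (H (neither T y) 0))
    where
    swap : ∀ a b c → a * (b * c) ≡ b * (a * c)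
    swap = solve-∀
  ... | suc a = begin
    + 2 * coverTransform T y (suc a ℕ.+ 0) + coverTransform T y (a ℕ.+ 0)
      ≡⟨ cong₂ (λ u v → + 2 * u + v) (trans (cong (coverTransform T y) (cong (ℕ._+ 0) (sym e))) (coverTransform-high T y 0))
               (coverTransform-low T y (a ℕ.+ 0) (subst₂ ℕ._<_ (sym (ℕₚ.+-identityʳ a)) (sym e) (ℕₚ.n<1+n a))) ⟩
    + 2 * (sgnPow (inside T y) * H (neither T y) 0) + 0ℤ
      ≡⟨ swap (+ 2) (sgnPow (inside T y)) (H (neither T y) 0) ⟩
    sgnPow (inside T y) * (+ 2 * H (neither T y) 0) ∎
    where
    swap : ∀ a b c → a * (b * c) + 0ℤ ≡ b * (a * c)
    swap = solve-∀
  coverTransform-high (false ∷ T) (false ∷ y) (suc r) = begin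
    coverTransform (false ∷ T) (false ∷ y) (outside T y ℕ.+ suc r)
      ≡⟨ cong (coverTransform (false ∷ T) (false ∷ y)) (ℕₚ.+-suc (outside T y) r) ⟩
    + 2 * coverTransform T y (suc (outside T y ℕ.+ r)) + coverTransform T y (outside T y ℕ.+ r)
      ≡⟨ cong₂ (λ u v → + 2 * u + v)
           (trans (cong (coverTransform T y) (sym (ℕₚ.+-suc (outside T y) r))) (coverTransform-high T y (suc r)))
           (coverTransform-high T y r) ⟩
    + 2 * (sgnPow (inside T y) * H (neither T y) (suc r)) + sgnPow (inside T y) * H (neither T y) r
      ≡⟨ factor (+ 2) (sgnPow (inside T y)) (H (neither T y) (suc r)) (H (neither T y) r) ⟩
    sgnPow (inside T y) * (+ 2 * H (neither T y) (suc r) + H (neither T y) r) ∎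
    where
    factor : ∀ a b c d → a * (b * c) + b * d ≡ b * (a * c + d)
    factor = solve-∀

-- Double counting for weighted families of blocks.

module Designs where
  open WordSums
  open Incidence
  open import Data.Bool using (Bool; true; false; T)
  open import Data.Nat as ℕ using (ℕ; zero; suc; z≤n; s≤s; _∸_; _≡ᵇ_)
  import Data.Nat.Properties as ℕₚ
  open import Data.Nat.Combinatorics using (nCn≡1; k>n⇒nCk≡0) renaming (_C_ to _choose_)
  open import Data.Integer using (ℤ; +_; 0ℤ; 1ℤ; _+_; _*_)
  open import Data.Integer.Properties
  open import Data.Integer.Tactic.RingSolver using (solve-∀)
  open import Data.Vec using ([]; _∷_; replicate)
  open import Data.Fin.Subset using (∣_∣)
  open import Data.Product using (∃; _,_)
  open import Relation.Nullary using (yes; no)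
  open import Relation.Binary.PropositionalEquality
  open ≡-Reasoning

  zeros+weight : ∀ {n} (c : Word n) → zeros c ℕ.+ ∣ c ∣ ≡ n
  zeros+weight []          = refl
  zeros+weight (false ∷ c) = cong suc (zeros+weight c)
  zeros+weight (true ∷ c)  = trans (ℕₚ.+-suc (zeros c) ∣ c ∣) (cong suc (zeros+weight c))

  inside+outside : ∀ {n} (T c : Word n) → inside T c ℕ.+ outside T c ≡ ∣ c ∣
  inside+outside []          []          = refl
  inside+outside (true ∷ T)  (true ∷ c)  = cong suc (inside+outside T c)
  inside+outside (true ∷ T)  (false ∷ c) = inside+outside T c
  inside+outside (false ∷ T) (true ∷ c)  = trans (ℕₚ.+-suc (inside T c) _) (cong suc (inside+outside T c))
  inside+outside (false ∷ T) (false ∷ c) = inside+outside T c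

  size+outside+neither : ∀ {n} (T c : Word n) → ∣ T ∣ ℕ.+ outside T c ℕ.+ neither T c ≡ n
  size+outside+neither []          []          = refl
  size+outside+neither (true ∷ T)  (b ∷ c)     = cong suc (size+outside+neither T c)
  size+outside+neither (false ∷ T) (true ∷ c)  =
    trans (cong (ℕ._+ neither T c) (ℕₚ.+-suc ∣ T ∣ (outside T c))) (cong suc (size+outside+neither T c))
  size+outside+neither (false ∷ T) (false ∷ c) =
    trans (ℕₚ.+-suc (∣ T ∣ ℕ.+ outside T c) (neither T c)) (cong suc (size+outside+neither T c))

  inside≤size : ∀ {n} (T c : Word n) → inside T c ℕ.≤ ∣ T ∣
  inside≤size []          []          = z≤n
  inside≤size (true ∷ T)  (true ∷ c)  = s≤s (inside≤size T c)
  inside≤size (true ∷ T)  (false ∷ c) = ℕₚ.m≤n⇒m≤1+n (inside≤size T c)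
  inside≤size (false ∷ T) (b ∷ c)     = inside≤size T c

  ⊑⇒inside : ∀ {n} (T c : Word n) → T ⊑ c ≡ true → inside T c ≡ ∣ T ∣
  ⊑⇒inside []          []          _ = refl
  ⊑⇒inside (true ∷ T)  (true ∷ c)  p = cong suc (⊑⇒inside T c p)
  ⊑⇒inside (false ∷ T) (b ∷ c)     p = ⊑⇒inside T c p

  ⋢⇒inside : ∀ {n} (T c : Word n) → T ⊑ c ≡ false → inside T c ℕ.< ∣ T ∣
  ⋢⇒inside []          []          ()
  ⋢⇒inside (true ∷ T)  (true ∷ c)  p = s≤s (⋢⇒inside T c p)
  ⋢⇒inside (true ∷ T)  (false ∷ c) p = s≤s (inside≤size T c)
  ⋢⇒inside (false ∷ T) (b ∷ c)     p = ⋢⇒inside T c p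

  -- As `inside T c` never exceeds `∣ T ∣`, the top binomial is 0 or 1; this lets containment enter
  -- expansions in the binomials of `inside T c`.
  inside-choose-size : ∀ {n} (T c : Word n) → + (inside T c choose ∣ T ∣) ≡ ⟦ T ⊑ c ⟧
  inside-choose-size T c with T ⊑ c in e
  ... | true  = cong +_ (trans (cong (_choose ∣ T ∣) (⊑⇒inside T c e)) (nCn≡1 ∣ T ∣))
  ... | false = cong +_ (k>n⇒nCk≡0 (⋢⇒inside T c e))

  ⊑-size : ∀ {n} (S T : Word n) → S ⊑ T ≡ true → ∣ S ∣ ℕ.≤ ∣ T ∣
  ⊑-size S T p = subst (ℕ._≤ ∣ T ∣) (⊑⇒inside S T p) (subst (inside S T ℕ.≤_) (inside+outside S T) (ℕₚ.m≤m+n _ _))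

  inside-self : ∀ {n} (T : Word n) → inside T T ≡ ∣ T ∣
  inside-self []          = refl
  inside-self (true ∷ T)  = cong suc (inside-self T)
  inside-self (false ∷ T) = inside-self T

  full : ∀ {n} → Word n
  full {n} = replicate n true

  empty : ∀ {n} → Word n
  empty {n} = replicate n false

  inside-full : ∀ {n} (c : Word n) → inside full c ≡ ∣ c ∣
  inside-full []          = refl
  inside-full (true ∷ c)  = cong suc (inside-full c)
  inside-full (false ∷ c) = inside-full c

  ⊑-full : ∀ {n} (T : Word n) → T ⊑ full ≡ true
  ⊑-full []          = refl
  ⊑-full (true ∷ T)  = ⊑-full T
  ⊑-full (false ∷ T) = ⊑-full T

  size-full : ∀ n → ∣ full {n} ∣ ≡ n
  size-full zero    = refl
  size-full (suc n) = cong suc (size-full n)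

  size-empty : ∀ n → ∣ empty {n} ∣ ≡ 0
  size-empty zero    = refl
  size-empty (suc n) = size-empty n

  ofSize : ∀ {n} → ℕ → Word n → ℤ
  ofSize k T = ⟦ ∣ T ∣ ≡ᵇ k ⟧

  -- A set between `S` and `c` is fixed by choosing `r` points of `c` outside `S`; the induction
  -- takes or leaves each such point, which is Pascal's rule.
  Σ-between : ∀ {n} (S c : Word n) r →
    Σw (λ T → ofSize (∣ S ∣ ℕ.+ r) T * (⟦ S ⊑ T ⟧ * ⟦ T ⊑ c ⟧)) ≡ ⟦ S ⊑ c ⟧ * + (outside S c choose r)
  Σ-between []          []          zero    = refl
  Σ-between []          []          (suc r) = refl
  Σ-between {suc n} (true ∷ S)  (true ∷ c)  r = begin
    Σw {n} (λ T → ofSize (suc ∣ S ∣ ℕ.+ r) (false ∷ T) * 0ℤ) + Σw (λ T → ofSize (∣ S ∣ ℕ.+ r) T * (⟦ S ⊑ T ⟧ * ⟦ T ⊑ c ⟧))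
      ≡⟨ cong₂ _+_ (Σw-0 {n = n} (λ T → *-zeroʳ (ofSize (suc ∣ S ∣ ℕ.+ r) (false ∷ T)))) (Σ-between S c r) ⟩
    0ℤ + ⟦ S ⊑ c ⟧ * + (outside S c choose r)
      ≡⟨ +-identityˡ _ ⟩
    ⟦ S ⊑ c ⟧ * + (outside S c choose r) ∎
  Σ-between {suc n} (true ∷ S)  (false ∷ c) r =
    cong₂ _+_ (Σw-0 {n = n} (λ T → *-zeroʳ (ofSize (suc ∣ S ∣ ℕ.+ r) (false ∷ T))))
              (Σw-0 {n = n} (λ T → trans (cong (ofSize (∣ S ∣ ℕ.+ r) T *_) (*-zeroʳ ⟦ S ⊑ T ⟧)) (*-zeroʳ (ofSize (∣ S ∣ ℕ.+ r) T))))
  Σ-between {suc n} (false ∷ S) (false ∷ c) r = begin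
    Σw (λ T → ofSize (∣ S ∣ ℕ.+ r) T * (⟦ S ⊑ T ⟧ * ⟦ T ⊑ c ⟧)) + Σw (λ T → ofSize (∣ S ∣ ℕ.+ r) (true ∷ T) * (⟦ S ⊑ T ⟧ * 0ℤ))
      ≡⟨ cong₂ _+_ (Σ-between S c r)
           (Σw-0 {n = n} (λ T → trans (cong (ofSize (∣ S ∣ ℕ.+ r) (true ∷ T) *_) (*-zeroʳ ⟦ S ⊑ T ⟧)) (*-zeroʳ (ofSize (∣ S ∣ ℕ.+ r) (true ∷ T))))) ⟩
    ⟦ S ⊑ c ⟧ * + (outside S c choose r) + 0ℤ
      ≡⟨ +-identityʳ _ ⟩
    ⟦ S ⊑ c ⟧ * + (outside S c choose r) ∎
  Σ-between {suc n} (false ∷ S) (true ∷ c) zero = begin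
    Σw (λ T → ofSize (∣ S ∣ ℕ.+ 0) T * (⟦ S ⊑ T ⟧ * ⟦ T ⊑ c ⟧)) + Σw (λ T → ofSize (∣ S ∣ ℕ.+ 0) (true ∷ T) * (⟦ S ⊑ T ⟧ * ⟦ T ⊑ c ⟧))
      ≡⟨ cong₂ _+_ (Σ-between S c 0) (Σw-0 {n = n} tooBig) ⟩
    ⟦ S ⊑ c ⟧ * 1ℤ + 0ℤ
      ≡⟨ +-identityʳ _ ⟩
    ⟦ S ⊑ c ⟧ * 1ℤ ∎
    where
    tooBig : ∀ T → ofSize (∣ S ∣ ℕ.+ 0) (true ∷ T) * (⟦ S ⊑ T ⟧ * ⟦ T ⊑ c ⟧) ≡ 0ℤ
    tooBig T with S ⊑ T in e
    ... | false = *-zeroʳ (ofSize (∣ S ∣ ℕ.+ 0) (true ∷ T))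
    ... | true with suc ∣ T ∣ ≡ᵇ ∣ S ∣ ℕ.+ 0 in e′
    ...   | false = refl
    ...   | true with () ← ℕₚ.<-irrefl refl (ℕₚ.<-≤-trans (s≤s (⊑-size S T e))
                             (ℕₚ.≤-reflexive (trans (ℕₚ.≡ᵇ⇒≡ (suc ∣ T ∣) (∣ S ∣ ℕ.+ 0) (subst Data.Bool.T (sym e′) _)) (ℕₚ.+-identityʳ ∣ S ∣))))
  Σ-between {suc n} (false ∷ S) (true ∷ c) (suc r) = begin
    Σw (λ T → ofSize (∣ S ∣ ℕ.+ suc r) T * (⟦ S ⊑ T ⟧ * ⟦ T ⊑ c ⟧)) + Σw (λ T → ofSize (∣ S ∣ ℕ.+ suc r) (true ∷ T) * (⟦ S ⊑ T ⟧ * ⟦ T ⊑ c ⟧))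
      ≡⟨ cong₂ _+_ (Σ-between S c (suc r))
           (trans (Σw-cong (λ T → cong (λ k → ⟦ suc ∣ T ∣ ≡ᵇ k ⟧ * (⟦ S ⊑ T ⟧ * ⟦ T ⊑ c ⟧)) (ℕₚ.+-suc ∣ S ∣ r))) (Σ-between S c r)) ⟩
    ⟦ S ⊑ c ⟧ * + (outside S c choose suc r) + ⟦ S ⊑ c ⟧ * + (outside S c choose r)
      ≡⟨ trans (+-comm (⟦ S ⊑ c ⟧ * + (outside S c choose suc r)) _) (sym (*-distribˡ-+ ⟦ S ⊑ c ⟧ (+ (outside S c choose r)) _)) ⟩
    ⟦ S ⊑ c ⟧ * (+ (outside S c choose r) + + (outside S c choose suc r))
      ≡⟨ cong (⟦ S ⊑ c ⟧ *_) (sym (pascal (outside S c) r)) ⟩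
    ⟦ S ⊑ c ⟧ * + (suc (outside S c) choose suc r) ∎

  -- A set contained in both is a subset of the intersection, which has `inside T c` points.
  Σ-common : ∀ {n} (T c : Word n) s →
    Σw (λ S → ofSize s S * (⟦ S ⊑ T ⟧ * ⟦ S ⊑ c ⟧)) ≡ + (inside T c choose s)
  Σ-common []          []          zero    = refl
  Σ-common []          []          (suc s) = refl
  Σ-common {suc n} (true ∷ T)  (true ∷ c)  zero    =
    trans (cong₂ _+_ (Σ-common T c 0) (Σw-0 {n = n} {f = λ S → ofSize 0 (true ∷ S) * (⟦ S ⊑ T ⟧ * ⟦ S ⊑ c ⟧)} (λ S → refl))) refl
  Σ-common {suc n} (true ∷ T)  (true ∷ c)  (suc s) =
    trans (cong₂ _+_ (Σ-common T c (suc s)) (Σ-common T c s))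
          (trans (+-comm (+ (inside T c choose suc s)) (+ (inside T c choose s))) (sym (pascal (inside T c) s)))
  Σ-common {suc n} (true ∷ T)  (false ∷ c) s       =
    trans (cong₂ _+_ (Σ-common T c s)
            (Σw-0 {n = n} (λ S → trans (cong (ofSize s (true ∷ S) *_) (*-zeroʳ ⟦ S ⊑ T ⟧)) (*-zeroʳ (ofSize s (true ∷ S))))))
          (+-identityʳ _)
  Σ-common {suc n} (false ∷ T) (b ∷ c)     s       =
    trans (cong₂ _+_ (Σ-common T c s) (Σw-0 {n = n} (λ S → *-zeroʳ (ofSize s (true ∷ S)))))
          (+-identityʳ _)

  -- X weighs the words; for the indicator of a set of blocks, covering X T counts the blocks containing T.
  covering : ∀ {n} → (Word n → ℤ) → Word n → ℤ
  covering X T = Σw (λ c → X c * ⟦ T ⊑ c ⟧)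

  Balanced : ∀ {n} → (Word n → ℤ) → ℕ → Set
  Balanced X t = ∀ T T′ → ∣ T ∣ ≡ t → ∣ T′ ∣ ≡ t → covering X T ≡ covering X T′

  ofSize-cong : ∀ {n} s (f g : Word n → ℤ) → (∀ S → ∣ S ∣ ≡ s → f S ≡ g S) → ∀ S → ofSize s S * f S ≡ ofSize s S * g S
  ofSize-cong s f g h S with ∣ S ∣ ≡ᵇ s in e
  ... | false = refl
  ... | true  = cong (1ℤ *_) (h S (ℕₚ.≡ᵇ⇒≡ ∣ S ∣ s (subst Data.Bool.T (sym e) _)))

  -- Double counting of the pairs of an `s`-set and a block `c` containing it, with the `s`-set
  -- inside `T`. It is applied with all points as `T` for the divisibility conditions, and with a
  -- codeword as `T` for intersection numbers.
  Σ-inside-choose : ∀ {n} (X : Word n → ℤ) T s (S₀ : Word n) → Balanced X s → ∣ S₀ ∣ ≡ s →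
    Σw (λ c → X c * + (inside T c choose s)) ≡ + (∣ T ∣ choose s) * covering X S₀
  Σ-inside-choose X T s S₀ bal S₀-size = begin
    Σw (λ c → X c * + (inside T c choose s))
      ≡⟨ Σw-cong (λ c → trans (cong (X c *_) (sym (Σ-common T c s))) (sym (Σw-* (X c) (λ S → ofSize s S * (⟦ S ⊑ T ⟧ * ⟦ S ⊑ c ⟧))))) ⟩
    Σw (λ c → Σw (λ S → X c * (ofSize s S * (⟦ S ⊑ T ⟧ * ⟦ S ⊑ c ⟧))))
      ≡⟨ Σw-swap (λ c S → X c * (ofSize s S * (⟦ S ⊑ T ⟧ * ⟦ S ⊑ c ⟧))) ⟩
    Σw (λ S → Σw (λ c → X c * (ofSize s S * (⟦ S ⊑ T ⟧ * ⟦ S ⊑ c ⟧))))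
      ≡⟨ Σw-cong (λ S → trans (Σw-cong (λ c → pull (X c) (ofSize s S) ⟦ S ⊑ T ⟧ ⟦ S ⊑ c ⟧))
                       (trans (Σw-* (ofSize s S * ⟦ S ⊑ T ⟧) (λ c → X c * ⟦ S ⊑ c ⟧)) (*-assoc (ofSize s S) ⟦ S ⊑ T ⟧ (covering X S)))) ⟩
    Σw (λ S → ofSize s S * (⟦ S ⊑ T ⟧ * covering X S))
      ≡⟨ Σw-cong (ofSize-cong s _ (λ S → ⟦ S ⊑ T ⟧ * covering X S₀) (λ S e → cong (⟦ S ⊑ T ⟧ *_) (bal S S₀ e S₀-size))) ⟩
    Σw (λ S → ofSize s S * (⟦ S ⊑ T ⟧ * covering X S₀))
      ≡⟨ Σw-cong (λ S → trans (cong (ofSize s S *_) (idem (S ⊑ T))) (rotate (ofSize s S) (⟦ S ⊑ T ⟧ * ⟦ S ⊑ T ⟧) (covering X S₀))) ⟩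
    Σw (λ S → covering X S₀ * (ofSize s S * (⟦ S ⊑ T ⟧ * ⟦ S ⊑ T ⟧)))
      ≡⟨ Σw-* (covering X S₀) (λ S → ofSize s S * (⟦ S ⊑ T ⟧ * ⟦ S ⊑ T ⟧)) ⟩
    covering X S₀ * Σw (λ S → ofSize s S * (⟦ S ⊑ T ⟧ * ⟦ S ⊑ T ⟧))
      ≡⟨ cong (covering X S₀ *_) (trans (Σ-common T T s) (cong (λ k → + (k choose s)) (inside-self T))) ⟩
    covering X S₀ * + (∣ T ∣ choose s)
      ≡⟨ *-comm (covering X S₀) (+ (∣ T ∣ choose s)) ⟩
    + (∣ T ∣ choose s) * covering X S₀ ∎
    where
    pull : ∀ x o a b → x * (o * (a * b)) ≡ o * a * (x * b)
    pull = solve-∀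
    rotate : ∀ o a k → o * (a * k) ≡ k * (o * a)
    rotate = solve-∀
    idem : ∀ b → ⟦ b ⟧ * covering X S₀ ≡ ⟦ b ⟧ * ⟦ b ⟧ * covering X S₀
    idem true  = refl
    idem false = refl

  OfWeight : ∀ {n} → (Word n → ℤ) → ℕ → Set
  OfWeight X w = ∀ c → ∣ c ∣ ≢ w → X c ≡ 0ℤ

  ofSize-inhabited : ∀ {n k} → k ℕ.≤ n → ∃ λ (T : Word n) → ∣ T ∣ ≡ k
  ofSize-inhabited {n} z≤n = empty , size-empty n
  ofSize-inhabited (s≤s p) with T , e ← ofSize-inhabited p = true ∷ T , cong suc e

  -- Counting the pairs of an (s + 1)-set above `S` and a block above it in two ways gives (w - s)
  -- λ_s = (n - s) λ_(s+1); since s < w, the factor w - s cancels.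
  balanced-down : ∀ {n} {X : Word n → ℤ} {w} s → OfWeight X w → w ℕ.≤ n → suc s ℕ.≤ w → Balanced X (suc s) → Balanced X s
  balanced-down {n} {X} {w} s ofW w≤n s<w bal S S′ S-size S′-size with U , U-size ← ofSize-inhabited (ℕₚ.≤-trans s<w w≤n) =
    *-cancelʳ-≡ (covering X S) (covering X S′) (+ (w ∸ s)) {{nz}}
      (trans (sym (double S S-size)) (trans (common S S-size U U-size) (trans (sym (common S′ S′-size U U-size)) (double S′ S′-size))))
    where
    nz : Data.Integer.NonZero (+ (w ∸ s))
    nz = ℕ.>-nonZero (ℕₚ.m<n⇒0<n∸m s<w)
    pull : ∀ x o a b → x * (o * (a * b)) ≡ o * (a * (x * b))
    pull = solve-∀
    double : ∀ S → ∣ S ∣ ≡ s → Σw (λ T → ofSize (s ℕ.+ 1) T * (⟦ S ⊑ T ⟧ * covering X T)) ≡ covering X S * + (w ∸ s)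
    double S S-size = begin
      Σw (λ T → ofSize (s ℕ.+ 1) T * (⟦ S ⊑ T ⟧ * covering X T))
        ≡⟨ Σw-cong (λ T → trans (sym (*-assoc (ofSize (s ℕ.+ 1) T) ⟦ S ⊑ T ⟧ _)) (trans (sym (Σw-* (ofSize (s ℕ.+ 1) T * ⟦ S ⊑ T ⟧) (λ c → X c * ⟦ T ⊑ c ⟧)))
             (Σw-cong (λ c → trans (*-assoc (ofSize (s ℕ.+ 1) T) ⟦ S ⊑ T ⟧ _) (sym (pull (X c) (ofSize (s ℕ.+ 1) T) ⟦ S ⊑ T ⟧ ⟦ T ⊑ c ⟧)))))) ⟩
      Σw (λ T → Σw (λ c → X c * (ofSize (s ℕ.+ 1) T * (⟦ S ⊑ T ⟧ * ⟦ T ⊑ c ⟧))))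
        ≡⟨ Σw-swap (λ T c → X c * (ofSize (s ℕ.+ 1) T * (⟦ S ⊑ T ⟧ * ⟦ T ⊑ c ⟧))) ⟩
      Σw (λ c → Σw (λ T → X c * (ofSize (s ℕ.+ 1) T * (⟦ S ⊑ T ⟧ * ⟦ T ⊑ c ⟧))))
        ≡⟨ Σw-cong (λ c → trans (Σw-* (X c) (λ T → ofSize (s ℕ.+ 1) T * (⟦ S ⊑ T ⟧ * ⟦ T ⊑ c ⟧)))
             (cong (X c *_) (trans (Σw-cong (λ T → cong (λ k → ofSize (k ℕ.+ 1) T * (⟦ S ⊑ T ⟧ * ⟦ T ⊑ c ⟧)) (sym S-size))) (Σ-between S c 1)))) ⟩
      Σw (λ c → X c * (⟦ S ⊑ c ⟧ * + (outside S c choose 1)))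
        ≡⟨ Σw-cong pointwise ⟩
      Σw (λ c → + (w ∸ s) * (X c * ⟦ S ⊑ c ⟧))
        ≡⟨ Σw-* (+ (w ∸ s)) (λ c → X c * ⟦ S ⊑ c ⟧) ⟩
      + (w ∸ s) * covering X S
        ≡⟨ *-comm (+ (w ∸ s)) (covering X S) ⟩
      covering X S * + (w ∸ s) ∎
      where
      open import Data.Nat.Combinatorics using (nC1≡n)
      pointwise : ∀ c → X c * (⟦ S ⊑ c ⟧ * + (outside S c choose 1)) ≡ + (w ∸ s) * (X c * ⟦ S ⊑ c ⟧)
      pointwise c with ∣ c ∣ ℕ.≟ w
      ... | no ≢w rewrite ofW c ≢w = sym (*-zeroʳ (+ (w ∸ s)))
      ... | yes ≡w with S ⊑ c in e
      ...   | false = trans (*-zeroʳ (X c)) (sym (trans (cong (+ (w ∸ s) *_) (*-zeroʳ (X c))) (*-zeroʳ (+ (w ∸ s)))))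
      ...   | true  = trans (cong (λ k → X c * (1ℤ * + k)) (trans (nC1≡n (outside S c)) out)) (swap (X c) (+ (w ∸ s)))
        where
        swap : ∀ x k → x * (1ℤ * k) ≡ k * (x * 1ℤ)
        swap = solve-∀
        out : outside S c ≡ w ∸ s
        out = begin
          outside S c                         ≡⟨ ℕₚ.m+n∸m≡n s (outside S c) ⟨
          s ℕ.+ outside S c ∸ s               ≡⟨ cong (λ k → k ℕ.+ outside S c ∸ s) (trans (sym S-size) (sym (⊑⇒inside S c e))) ⟩
          inside S c ℕ.+ outside S c ∸ s      ≡⟨ cong (_∸ s) (trans (inside+outside S c) ≡w) ⟩
          w ∸ s ∎
    common : ∀ S → ∣ S ∣ ≡ s → ∀ U → ∣ U ∣ ≡ suc s → Σw (λ T → ofSize (s ℕ.+ 1) T * (⟦ S ⊑ T ⟧ * covering X T)) ≡ covering X U * + (n ∸ s)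
    common S S-size U U-size = begin
      Σw (λ T → ofSize (s ℕ.+ 1) T * (⟦ S ⊑ T ⟧ * covering X T))
        ≡⟨ Σw-cong (ofSize-cong (s ℕ.+ 1) _ (λ T → ⟦ S ⊑ T ⟧ * covering X U)
             (λ T e → cong (⟦ S ⊑ T ⟧ *_) (bal T U (trans e (ℕₚ.+-comm s 1)) U-size))) ⟩
      Σw (λ T → ofSize (s ℕ.+ 1) T * (⟦ S ⊑ T ⟧ * covering X U))
        ≡⟨ Σw-cong (λ T → trans (move (ofSize (s ℕ.+ 1) T) ⟦ S ⊑ T ⟧ (covering X U))
             (cong (λ b → covering X U * (ofSize (s ℕ.+ 1) T * (⟦ S ⊑ T ⟧ * ⟦ b ⟧))) (sym (⊑-full T)))) ⟩
      Σw (λ T → covering X U * (ofSize (s ℕ.+ 1) T * (⟦ S ⊑ T ⟧ * ⟦ T ⊑ full ⟧)))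
        ≡⟨ Σw-* (covering X U) (λ T → ofSize (s ℕ.+ 1) T * (⟦ S ⊑ T ⟧ * ⟦ T ⊑ full ⟧)) ⟩
      covering X U * Σw (λ T → ofSize (s ℕ.+ 1) T * (⟦ S ⊑ T ⟧ * ⟦ T ⊑ full ⟧))
        ≡⟨ cong (covering X U *_) (trans (Σw-cong (λ T → cong (λ k → ofSize (k ℕ.+ 1) T * (⟦ S ⊑ T ⟧ * ⟦ T ⊑ full ⟧)) (sym S-size))) (Σ-between S full 1)) ⟩
      covering X U * (⟦ S ⊑ full ⟧ * + (outside S full choose 1))
        ≡⟨ cong (covering X U *_) (trans (cong₂ (λ b k → ⟦ b ⟧ * + k) (⊑-full S) (trans (nC1≡n (outside S full)) out)) (*-identityˡ _)) ⟩
      covering X U * + (n ∸ s) ∎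
      where
      open import Data.Nat.Combinatorics using (nC1≡n)
      move : ∀ o a k → o * (a * k) ≡ k * (o * (a * 1ℤ))
      move = solve-∀
      out : outside S full ≡ n ∸ s
      out = begin
        outside S full                         ≡⟨ ℕₚ.m+n∸m≡n s (outside S full) ⟨
        s ℕ.+ outside S full ∸ s               ≡⟨ cong (λ k → k ℕ.+ outside S full ∸ s) (trans (sym S-size) (sym (⊑⇒inside S full (⊑-full S)))) ⟩
        inside S full ℕ.+ outside S full ∸ s   ≡⟨ cong (_∸ s) (trans (inside+outside S full) (size-full n)) ⟩
        n ∸ s ∎

-- Support designs as weighted families, complementary blocks, and divisibility.

module Complements where
  open WordSums
  open Incidence
  open Designs
  open import Data.Bool using (Bool; true; false; not)
  open import Data.Nat as ℕ using (ℕ; zero; suc)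
  import Data.Nat.Properties as ℕₚ
  open import Data.Nat.Combinatorics using (k>n⇒nCk≡0) renaming (_C_ to _choose_)
  open import Data.Integer using (ℤ; +_; 0ℤ; 1ℤ; -1ℤ; _+_; _*_; _-_; -_)
  open import Data.Integer.Properties
  open import Data.Integer.Tactic.RingSolver using (solve-∀)
  open import Data.Vec using ([]; _∷_)
  import Data.Vec as Vec
  open import Data.List as List using (List; _++_; map; filterᵇ)
  open import Data.Fin.Subset using (∣_∣)
  open import Data.Fin.Subset.Properties using (_⊆?_)
  open import Data.Product using (_,_)
  open import Function using (_∘_)
  open import Relation.Nullary using (yes; no; does)
  open import Relation.Binary.PropositionalEquality
  open ≡-Reasoning

  block : ∀ {n} → Code n → ℕ → Word n → ℤ
  block C w c = ⟦ isWeight C w c ⟧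

  Σl : ∀ {n} → (Word n → ℤ) → List (Word n) → ℤ
  Σl f List.[]       = 0ℤ
  Σl f (c List.∷ cs) = f c + Σl f cs

  Σl-++ : ∀ {n} (f : Word n → ℤ) cs ds → Σl f (cs ++ ds) ≡ Σl f cs + Σl f ds
  Σl-++ f List.[]       ds = sym (+-identityˡ _)
  Σl-++ f (c List.∷ cs) ds = trans (cong (λ x → f c + x) (Σl-++ f cs ds)) (sym (+-assoc (f c) (Σl f cs) (Σl f ds)))

  Σl-map : ∀ {n} (f : Word (suc n) → ℤ) b cs → Σl f (map (b ∷_) cs) ≡ Σl (f ∘ (b ∷_)) cs
  Σl-map f b List.[]       = refl
  Σl-map f b (c List.∷ cs) = cong (λ x → f (b ∷ c) + x) (Σl-map f b cs)

  Σl-allWords : ∀ {n} (f : Word n → ℤ) → Σl f (allWords n) ≡ Σw f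
  Σl-allWords {zero}  f = +-identityʳ (f [])
  Σl-allWords {suc n} f = begin
    Σl f (map (false ∷_) (allWords n) ++ map (true ∷_) (allWords n))
      ≡⟨ Σl-++ f (map (false ∷_) (allWords n)) (map (true ∷_) (allWords n)) ⟩
    Σl f (map (false ∷_) (allWords n)) + Σl f (map (true ∷_) (allWords n))
      ≡⟨ cong₂ _+_ (trans (Σl-map f false (allWords n)) (Σl-allWords (f ∘ (false ∷_))))
                   (trans (Σl-map f true (allWords n)) (Σl-allWords (f ∘ (true ∷_)))) ⟩
    Σw f ∎

  does-⊆? : ∀ {n} (T c : Word n) → does (T ⊆? c) ≡ T ⊑ c
  does-⊆? []          []          = refl
  does-⊆? (true ∷ T)  (true ∷ c)  = does-⊆? T c
  does-⊆? (true ∷ T)  (false ∷ c) = refl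
  does-⊆? (false ∷ T) (true ∷ c)  = does-⊆? T c
  does-⊆? (false ∷ T) (false ∷ c) = does-⊆? T c

  count-filter : ∀ {n} (T : Word n) (p : Word n → Bool) cs →
    + blocksContaining T (map support (filterᵇ p cs)) ≡ Σl (λ c → ⟦ p c ⟧ * ⟦ T ⊑ c ⟧) cs
  count-filter T p List.[]       = refl
  count-filter T p (c List.∷ cs) with p c
  ... | false = trans (count-filter T p cs) (sym (+-identityˡ _))
  ... | true  with T ⊑ c | does (T ⊆? c) | does-⊆? T c
  ...   | true  | true  | _ = cong (λ x → 1ℤ + x) (count-filter T p cs)
  ...   | false | false | _ = trans (count-filter T p cs) (sym (+-identityˡ _))

  blocksContaining≡covering : ∀ {n} (C : Code n) w T → + blocksContaining T (supportDesign C w) ≡ covering (block C w) T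
  blocksContaining≡covering {n} C w T =
    trans (count-filter T (isWeight C w) (allWords n)) (Σl-allWords (λ c → ⟦ isWeight C w c ⟧ * ⟦ T ⊑ c ⟧))

  design⇒balanced : ∀ {n} {C : Code n} {t w} → IsTDesign t (supportDesign C w) → Balanced (block C w) t
  design⇒balanced {C = C} {w = w} des T T′ e e′ =
    trans (sym (blocksContaining≡covering C w T)) (trans (cong +_ (des T T′ e e′)) (blocksContaining≡covering C w T′))

  balanced⇒design : ∀ {n} {C : Code n} {t w} → Balanced (block C w) t → IsTDesign t (supportDesign C w)
  balanced⇒design {C = C} {w = w} bal T T′ e e′ =
    +-injective (trans (blocksContaining≡covering C w T) (trans (bal T T′ e e′) (sym (blocksContaining≡covering C w T′))))

  comp : ∀ {n} → Word n → Word n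
  comp = Vec.map not

  Σw-comp : ∀ {n} (f : Word n → ℤ) → Σw (f ∘ comp) ≡ Σw f
  Σw-comp {zero}  f = refl
  Σw-comp {suc n} f = trans (cong₂ _+_ (Σw-comp (f ∘ (true ∷_))) (Σw-comp (f ∘ (false ∷_)))) (+-comm (Σw (f ∘ (true ∷_))) _)

  -- Inclusion-exclusion truncated after order `t`: the sum of (-1)^s (b choose s) over s ≤ t.
  alternating : ℕ → ℕ → ℤ
  alternating zero    b = 1ℤ
  alternating (suc t) b = alternating t b + sgnPow (suc t) * + (b choose suc t)

  -- Pascal's rule makes the sum telescope.
  alternating-suc : ∀ t b → alternating t (suc b) ≡ sgnPow t * + (b choose t)
  alternating-suc zero    b = refl
  alternating-suc (suc t) b = begin
    alternating t (suc b) + -1ℤ * sgnPow t * + (suc b choose suc t)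
      ≡⟨ cong₂ (λ u v → u + -1ℤ * sgnPow t * v) (alternating-suc t b) (pascal b t) ⟩
    sgnPow t * + (b choose t) + -1ℤ * sgnPow t * (+ (b choose t) + + (b choose suc t))
      ≡⟨ cancel (sgnPow t) (+ (b choose t)) (+ (b choose suc t)) ⟩
    -1ℤ * sgnPow t * + (b choose suc t) ∎
    where
    cancel : ∀ s u v → s * u + -1ℤ * s * (u + v) ≡ -1ℤ * s * v
    cancel = solve-∀

  alternating-0 : ∀ t → alternating t 0 ≡ 1ℤ
  alternating-0 zero    = refl
  alternating-0 (suc t) = trans (cong₂ _+_ (alternating-0 t) (*-zeroʳ (sgnPow (suc t)))) refl

  -- If the intersection has `b + 1` points, the sum is ± (b choose |T|), and this vanishes because
  -- b < |T|.
  disjoint : ∀ {n} (T c : Word n) → ⟦ T ⊑ comp c ⟧ ≡ alternating ∣ T ∣ (inside T c)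
  disjoint T c with inside T c in e
  ... | zero  = trans (cong ⟦_⟧ (sub T c e)) (sym (alternating-0 ∣ T ∣))
    where
    sub : ∀ {n} (T c : Word n) → inside T c ≡ 0 → T ⊑ comp c ≡ true
    sub []          []          _ = refl
    sub (true ∷ T)  (false ∷ c) e = sub T c e
    sub (false ∷ T) (b ∷ c)     e = sub T c e
  ... | suc b = trans (cong ⟦_⟧ (nsub T c e)) (sym (trans (alternating-suc ∣ T ∣ b)
      (trans (cong (λ k → sgnPow ∣ T ∣ * + k) (k>n⇒nCk≡0 (subst (ℕ._≤ ∣ T ∣) e (inside≤size T c)))) (*-zeroʳ (sgnPow ∣ T ∣)))))
    where
    nsub : ∀ {n b} (T c : Word n) → inside T c ≡ suc b → T ⊑ comp c ≡ false
    nsub []          []          ()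
    nsub (true ∷ T)  (true ∷ c)  e = refl
    nsub (true ∷ T)  (false ∷ c) e = nsub T c e
    nsub (false ∷ T) (b ∷ c)     e = nsub T c e

  -- Each order of the inclusion-exclusion is evaluated by `Σ-inside-choose`, whose result sees `T`
  -- only through its size.
  Σ-alternating : ∀ {n} (X : Word n → ℤ) T T′ → ∣ T ∣ ≡ ∣ T′ ∣ → ∀ t → t ℕ.≤ n → (∀ s → s ℕ.≤ t → Balanced X s) →
    Σw (λ c → X c * alternating t (inside T c)) ≡ Σw (λ c → X c * alternating t (inside T′ c))
  Σ-alternating X T T′ e zero    _   bal = refl
  Σ-alternating {n} X T T′ e (suc t) t<n bal with S , S-size ← ofSize-inhabited t<n = begin
    Σw (λ c → X c * alternating (suc t) (inside T c))
      ≡⟨ split T ⟩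
    Σw (λ c → X c * alternating t (inside T c)) + sgnPow (suc t) * Σw (λ c → X c * + (inside T c choose suc t))
      ≡⟨ cong₂ (λ u v → u + sgnPow (suc t) * v)
           (Σ-alternating X T T′ e t (ℕₚ.<⇒≤ t<n) (λ s s≤t → bal s (ℕₚ.m≤n⇒m≤1+n s≤t)))
           (trans (Σ-inside-choose X T (suc t) S (bal (suc t) ℕₚ.≤-refl) S-size)
             (trans (cong (λ k → + (k choose suc t) * covering X S) e) (sym (Σ-inside-choose X T′ (suc t) S (bal (suc t) ℕₚ.≤-refl) S-size)))) ⟩
    Σw (λ c → X c * alternating t (inside T′ c)) + sgnPow (suc t) * Σw (λ c → X c * + (inside T′ c choose suc t))
      ≡⟨ split T′ ⟨
    Σw (λ c → X c * alternating (suc t) (inside T′ c)) ∎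
    where
    expand : ∀ x a s b → x * (a + s * b) ≡ x * a + s * (x * b)
    expand = solve-∀
    split : ∀ T → Σw (λ c → X c * alternating (suc t) (inside T c))
                ≡ Σw (λ c → X c * alternating t (inside T c)) + sgnPow (suc t) * Σw (λ c → X c * + (inside T c choose suc t))
    split T = trans (Σw-cong (λ c → expand (X c) (alternating t (inside T c)) (sgnPow (suc t)) _))
             (trans (Σw-+ (λ c → X c * alternating t (inside T c)) _)
                    (cong (λ x → Σw (λ c → X c * alternating t (inside T c)) + x) (Σw-* (sgnPow (suc t)) (λ c → X c * + (inside T c choose suc t)))))

  -- For `block C w` this is the δ_w of the overview.
  imbalance : ∀ {n} → (Word n → ℤ) → Word n → Word n → ℤ
  imbalance X T T′ = covering X T - covering X T′

  -- A complement contains `T` exactly when the block misses `T`. In the inclusion-exclusion for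
  -- this, the orders up to `t` agree for `T` and `T′` by balance, so only the top order survives,
  -- with its sign.
  complement-imbalance : ∀ {n} {X X′ : Word n → ℤ} t → (∀ c → X′ (comp c) ≡ X c) → t ℕ.< n → (∀ s → s ℕ.≤ t → Balanced X s) →
    ∀ T T′ → ∣ T ∣ ≡ suc t → ∣ T′ ∣ ≡ suc t → imbalance X′ T T′ ≡ sgnPow (suc t) * imbalance X T T′
  complement-imbalance {n} {X} {X′} t X′-comp t<n bal T T′ T-size T′-size = begin
    covering X′ T - covering X′ T′
      ≡⟨ cong₂ _-_ (expand T T-size) (expand T′ T′-size) ⟩
    (A T + sgnPow (suc t) * covering X T) - (A T′ + sgnPow (suc t) * covering X T′)
      ≡⟨ cong (λ x → (x + sgnPow (suc t) * covering X T) - (A T′ + sgnPow (suc t) * covering X T′))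
           (Σ-alternating X T T′ (trans T-size (sym T′-size)) t (ℕₚ.<⇒≤ t<n) bal) ⟩
    (A T′ + sgnPow (suc t) * covering X T) - (A T′ + sgnPow (suc t) * covering X T′)
      ≡⟨ cancel (A T′) (sgnPow (suc t)) (covering X T) (covering X T′) ⟩
    sgnPow (suc t) * imbalance X T T′ ∎
    where
    A : Word n → ℤ
    A T = Σw (λ c → X c * alternating t (inside T c))
    cancel : ∀ a s u v → (a + s * u) - (a + s * v) ≡ s * (u - v)
    cancel = solve-∀
    distrib : ∀ x a s b → x * (a + s * b) ≡ x * a + s * (x * b)
    distrib = solve-∀
    expand : ∀ T → ∣ T ∣ ≡ suc t → covering X′ T ≡ A T + sgnPow (suc t) * covering X T
    expand T T-size = begin
      covering X′ T
        ≡⟨ Σw-comp (λ c → X′ c * ⟦ T ⊑ c ⟧) ⟨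
      Σw (λ c → X′ (comp c) * ⟦ T ⊑ comp c ⟧)
        ≡⟨ Σw-cong (λ c → cong₂ _*_ (X′-comp c) (trans (disjoint T c) (cong (λ k → alternating k (inside T c)) T-size))) ⟩
      Σw (λ c → X c * (alternating t (inside T c) + sgnPow (suc t) * + (inside T c choose suc t)))
        ≡⟨ Σw-cong (λ c → trans (distrib (X c) (alternating t (inside T c)) (sgnPow (suc t)) _)
             (cong (λ k → X c * alternating t (inside T c) + sgnPow (suc t) * (X c * k))
               (trans (cong (λ k → + (inside T c choose k)) (sym T-size)) (inside-choose-size T c)))) ⟩
      Σw (λ c → X c * alternating t (inside T c) + sgnPow (suc t) * (X c * ⟦ T ⊑ c ⟧))
        ≡⟨ Σw-+ (λ c → X c * alternating t (inside T c)) _ ⟩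
      A T + Σw (λ c → sgnPow (suc t) * (X c * ⟦ T ⊑ c ⟧))
        ≡⟨ cong (λ x → A T + x) (Σw-* (sgnPow (suc t)) (λ c → X c * ⟦ T ⊑ c ⟧)) ⟩
      A T + sgnPow (suc t) * covering X T ∎

  balanced-0 : ∀ {n} (X : Word n → ℤ) → Balanced X 0
  balanced-0 X T T′ e e′ = trans (cong (covering X) (unique T e)) (cong (covering X) (sym (unique T′ e′)))
    where
    unique : ∀ {n} (T : Word n) → ∣ T ∣ ≡ 0 → T ≡ empty
    unique []          _ = refl
    unique (false ∷ T) e = cong (false ∷_) (unique T e)

  -- The case of `Σ-inside-choose` in which `T` consists of all points, which every block meets in
  -- `w` points.
  divisibility : ∀ {n} {X : Word n → ℤ} {w} t → OfWeight X w → Balanced X t → ∀ S → ∣ S ∣ ≡ t →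
    Σw X * + (w choose t) ≡ + (n choose t) * covering X S
  divisibility {n} {X} {w} t ofW bal S S-size = begin
    Σw X * + (w choose t)
      ≡⟨ *-comm (Σw X) _ ⟩
    + (w choose t) * Σw X
      ≡⟨ Σw-* (+ (w choose t)) X ⟨
    Σw (λ c → + (w choose t) * X c)
      ≡⟨ Σw-cong pointwise ⟩
    Σw (λ c → X c * + (inside full c choose t))
      ≡⟨ Σ-inside-choose X full t S bal S-size ⟩
    + (∣ full {n} ∣ choose t) * covering X S
      ≡⟨ cong (λ k → + (k choose t) * covering X S) (size-full n) ⟩
    + (n choose t) * covering X S ∎
    where
    pointwise : ∀ c → + (w choose t) * X c ≡ X c * + (inside full c choose t)
    pointwise c with ∣ c ∣ ℕ.≟ w
    ... | no ≢w  rewrite ofW c ≢w = *-zeroʳ (+ (w choose t))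
    ... | yes ≡w = trans (*-comm (+ (w choose t)) (X c)) (cong (λ k → X c * + (k choose t)) (sym (trans (inside-full c) ≡w)))

-- Evaluating polynomials with prescribed roots through falling-factorial moments.

module RootPolynomials where
  open WordSums
  open Incidence using (pascal)
  open import Data.Nat as ℕ using (ℕ; zero; suc; s≤s; _!)
  import Data.Nat.Properties as ℕₚ
  open import Data.Nat.Combinatorics renaming (_C_ to _choose_)
  open import Data.Integer using (ℤ; +_; 0ℤ; 1ℤ; _+_; _*_; _-_; -_)
  open import Data.Integer.Properties
  open import Data.Integer.Tactic.RingSolver using (solve-∀)
  open import Data.List using (List; []; _∷_; _++_; length)
  open import Relation.Binary.PropositionalEquality
  open ≡-Reasoning

  absorption : ∀ m j → + (m choose suc j) * + suc j ≡ + (m choose j) * (+ m - + j)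
  absorption zero    zero    = refl
  absorption zero    (suc j) = sym (*-zeroˡ (+ 0 - + suc j))
  absorption (suc m) zero    = begin
    + (suc m choose 1) * 1ℤ           ≡⟨ cong (_* 1ℤ) (pascal m 0) ⟩
    (1ℤ + + (m choose 1)) * 1ℤ        ≡⟨ *-distribʳ-+ 1ℤ 1ℤ (+ (m choose 1)) ⟩
    1ℤ + + (m choose 1) * 1ℤ          ≡⟨ cong (λ x → 1ℤ + x) (absorption m 0) ⟩
    1ℤ + 1ℤ * (+ m - 0ℤ)              ≡⟨ shift (+ m) ⟩
    1ℤ * (1ℤ + + m - 0ℤ) ∎
    where
    shift : ∀ x → 1ℤ + 1ℤ * (x - 0ℤ) ≡ 1ℤ * (1ℤ + x - 0ℤ)
    shift = solve-∀
  absorption (suc m) (suc i) = begin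
    + (suc m choose suc (suc i)) * + suc (suc i)
      ≡⟨ cong (_* + suc (suc i)) (pascal m (suc i)) ⟩
    (b + c) * (1ℤ + (1ℤ + + i))
      ≡⟨ expand b c (+ i) ⟩
    b * (1ℤ + + i) + b + c * (1ℤ + (1ℤ + + i))
      ≡⟨ cong (λ x → b * (1ℤ + + i) + b + x) (absorption m (suc i)) ⟩
    b * (1ℤ + + i) + b + b * (+ m - (1ℤ + + i))
      ≡⟨ cong (λ x → x + b + b * (+ m - (1ℤ + + i))) (absorption m i) ⟩
    a * (+ m - + i) + b + b * (+ m - (1ℤ + + i))
      ≡⟨ collect a b (+ m) (+ i) ⟩
    (a + b) * (1ℤ + + m - (1ℤ + + i))
      ≡⟨ cong (_* (1ℤ + + m - (1ℤ + + i))) (sym (pascal m i)) ⟩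
    + (suc m choose suc i) * (+ suc m - + suc i) ∎
    where
    a = + (m choose i)
    b = + (m choose suc i)
    c = + (m choose suc (suc i))
    expand : ∀ b c i → (b + c) * (1ℤ + (1ℤ + i)) ≡ b * (1ℤ + i) + b + c * (1ℤ + (1ℤ + i))
    expand = solve-∀
    collect : ∀ a b m i → a * (m - i) + b + b * (m - (1ℤ + i)) ≡ (a + b) * (1ℤ + m - (1ℤ + i))
    collect = solve-∀

  falling : ℤ → ℕ → ℤ
  falling z zero    = 1ℤ
  falling z (suc j) = falling z j * (z - + j)

  falling-choose : ∀ m j → falling (+ m) j ≡ + (j !) * + (m choose j)
  falling-choose m zero    = refl
  falling-choose m (suc j) = begin
    falling (+ m) j * (+ m - + j)              ≡⟨ cong (_* (+ m - + j)) (falling-choose m j) ⟩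
    + (j !) * + (m choose j) * (+ m - + j)     ≡⟨ *-assoc (+ (j !)) (+ (m choose j)) (+ m - + j) ⟩
    + (j !) * (+ (m choose j) * (+ m - + j))   ≡⟨ cong (+ (j !) *_) (absorption m j) ⟨
    + (j !) * (+ (m choose suc j) * + suc j)   ≡⟨ swap (+ (j !)) (+ (m choose suc j)) (+ suc j) ⟩
    + suc j * + (j !) * + (m choose suc j)     ≡⟨ cong (_* + (m choose suc j)) (pos-* (suc j) (j !)) ⟨
    + (suc j ℕ.* j !) * + (m choose suc j) ∎
    where
    swap : ∀ a b c → a * (b * c) ≡ c * a * b
    swap = solve-∀

  rootPoly : List ℕ → ℤ → ℤ
  rootPoly []      z = 1ℤ
  rootPoly (r ∷ R) z = (z - + r) * rootPoly R z

  rootPoly-++ : ∀ R S z → rootPoly (R ++ S) z ≡ rootPoly R z * rootPoly S z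
  rootPoly-++ []      S z = sym (*-identityˡ _)
  rootPoly-++ (r ∷ R) S z =
    trans (cong ((z - + r) *_) (rootPoly-++ R S z)) (sym (*-assoc (z - + r) (rootPoly R z) (rootPoly S z)))

  -- The effect on falling-factorial moments f j = Σ ε(c) z^(j) of multiplying ε by ∏ (z - r).
  apply : List ℕ → (ℕ → ℤ) → ℕ → ℤ
  apply []      f = f
  apply (r ∷ R) f = apply R (λ j → f (suc j) + (+ j - + r) * f j)

  apply-cong : ∀ R {f g : ℕ → ℤ} → (∀ j → f j ≡ g j) → ∀ j → apply R f j ≡ apply R g j
  apply-cong []      e = e
  apply-cong (r ∷ R) e = apply-cong R (λ j → cong₂ (λ u v → u + (+ j - + r) * v) (e (suc j)) (e j))

  moment : ∀ {n} → (Word n → ℤ) → (Word n → ℤ) → ℕ → ℤ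
  moment z ε j = Σw (λ c → ε c * falling (z c) j)

  -- For falling powers, (z - r) z^(j) = z^(j+1) + (j - r) z^(j); each root is one use of this rule.
  moment-rootPoly : ∀ {n} (z : Word n → ℤ) R ε j →
    moment z (λ c → ε c * rootPoly R (z c)) j ≡ apply R (moment z ε) j
  moment-rootPoly z []      ε j = Σw-cong (λ c → cong (_* falling (z c) j) (*-identityʳ (ε c)))
  moment-rootPoly z (r ∷ R) ε j = begin
    moment z (λ c → ε c * ((z c - + r) * rootPoly R (z c))) j
      ≡⟨ Σw-cong (λ c → cong (_* falling (z c) j) (sym (*-assoc (ε c) (z c - + r) (rootPoly R (z c))))) ⟩
    moment z (λ c → ε c * (z c - + r) * rootPoly R (z c)) j
      ≡⟨ moment-rootPoly z R (λ c → ε c * (z c - + r)) j ⟩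
    apply R (moment z (λ c → ε c * (z c - + r))) j
      ≡⟨ apply-cong R step j ⟩
    apply (r ∷ R) (moment z ε) j ∎
    where
    expand : ∀ e z r f j → e * (z - r) * f ≡ e * (f * (z - j)) + (j - r) * (e * f)
    expand = solve-∀
    step : ∀ i → moment z (λ c → ε c * (z c - + r)) i ≡ moment z ε (suc i) + (+ i - + r) * moment z ε i
    step i = begin
      Σw (λ c → ε c * (z c - + r) * falling (z c) i)
        ≡⟨ Σw-cong (λ c → expand (ε c) (z c) (+ r) (falling (z c) i) (+ i)) ⟩
      Σw (λ c → ε c * falling (z c) (suc i) + (+ i - + r) * (ε c * falling (z c) i))
        ≡⟨ Σw-+ (λ c → ε c * falling (z c) (suc i)) (λ c → (+ i - + r) * (ε c * falling (z c) i)) ⟩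
      moment z ε (suc i) + Σw (λ c → (+ i - + r) * (ε c * falling (z c) i))
        ≡⟨ cong (λ x → moment z ε (suc i) + x) (Σw-* (+ i - + r) (λ c → ε c * falling (z c) i)) ⟩
      moment z ε (suc i) + (+ i - + r) * moment z ε i ∎

  Σ-rootPoly : ∀ {n} (z : Word n → ℤ) R ε → Σw (λ c → ε c * rootPoly R (z c)) ≡ apply R (moment z ε) 0
  Σ-rootPoly z R ε = trans (Σw-cong (λ c → sym (*-identityʳ (ε c * rootPoly R (z c))))) (moment-rootPoly z R ε 0)

  -- Each root raises the highest moment involved by one.
  apply-zero : ∀ R {f : ℕ → ℤ} J → (∀ j → j ℕ.< J → f j ≡ 0ℤ) → ∀ j → j ℕ.+ length R ℕ.< J → apply R f j ≡ 0ℤ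
  apply-zero []      J h j p = h j (subst (ℕ._< J) (ℕₚ.+-identityʳ j) p)
  apply-zero (r ∷ R) {f} (suc J) h j p = apply-zero R J
    (λ i i<J → trans (cong₂ (λ u v → u + (+ i - + r) * v) (h (suc i) (s≤s i<J)) (h i (ℕₚ.m<n⇒m<1+n i<J)))
                     (trans (+-identityˡ _) (*-zeroʳ (+ i - + r))))
    j (ℕ.s<s⁻¹ (subst (ℕ._< suc J) (ℕₚ.+-suc j (length R)) p))

  -- The polynomial is monic, so the top moment enters with coefficient 1.
  apply-top : ∀ R {f : ℕ → ℤ} → (∀ j → j ℕ.< length R → f j ≡ 0ℤ) → apply R f 0 ≡ f (length R)
  apply-top []      h = refl
  apply-top (r ∷ R) {f} h = trans
    (apply-top R (λ i i<R → trans (cong₂ (λ u v → u + (+ i - + r) * v) (h (suc i) (s≤s i<R)) (h i (ℕₚ.m<n⇒m<1+n i<R)))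
                                  (trans (+-identityˡ _) (*-zeroʳ (+ i - + r)))))
    (trans (cong (λ v → f (suc (length R)) + (+ length R - + r) * v) (h (length R) ℕₚ.≤-refl))
           (trans (cong (λ x → f (suc (length R)) + x) (*-zeroʳ (+ length R - + r))) (+-identityʳ _)))

  -- The value of apply R f 0 when length R = J + 2 and f vanishes below J, as a function of f J, f (J + 1), f (J + 2).
  window : List ℕ → ℕ → ℤ → ℤ → ℤ → ℤ
  window (r ∷ R)     (suc J) a b c = window R J a (b + (+ suc J - + r) * a) (c + (+ suc (suc J) - + r) * b)
  window (r ∷ s ∷ _) zero    a b c = c + (1ℤ - + r) * b - + s * (b - + r * a)
  window _           _       a b c = 0ℤ

  -- Extracting the common factor `X`, which later contains the unknown imbalance, leaves a window
  -- of plain numbers that can be evaluated.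
  apply-window : ∀ R J {f : ℕ → ℤ} X {a b c} → length R ≡ 2 ℕ.+ J → (∀ j → j ℕ.< J → f j ≡ 0ℤ) →
    f J ≡ X * a → f (suc J) ≡ X * b → f (2 ℕ.+ J) ≡ X * c → apply R f 0 ≡ X * window R J a b c
  apply-window (r ∷ s ∷ []) zero {f} X {a} {b} {c} _ h ea eb ec = begin
    (f 2 + (1ℤ - + r) * f 1) + (0ℤ - + s) * (f 1 + (0ℤ - + r) * f 0)
      ≡⟨ cong₂ (λ u v → (v + (1ℤ - + r) * u) + (0ℤ - + s) * (u + (0ℤ - + r) * f 0)) eb ec ⟩
    (X * c + (1ℤ - + r) * (X * b)) + (0ℤ - + s) * (X * b + (0ℤ - + r) * f 0)
      ≡⟨ cong (λ u → (X * c + (1ℤ - + r) * (X * b)) + (0ℤ - + s) * (X * b + (0ℤ - + r) * u)) ea ⟩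
    (X * c + (1ℤ - + r) * (X * b)) + (0ℤ - + s) * (X * b + (0ℤ - + r) * (X * a))
      ≡⟨ collect X a b c (+ r) (+ s) ⟩
    X * (c + (1ℤ - + r) * b - + s * (b - + r * a)) ∎
    where
    collect : ∀ X a b c r s → (X * c + (1ℤ - r) * (X * b)) + (0ℤ - s) * (X * b + (0ℤ - r) * (X * a))
                            ≡ X * (c + (1ℤ - r) * b - s * (b - r * a))
    collect = solve-∀
  apply-window (r ∷ R) (suc J) {f} X {a} {b} {c} l h ea eb ec =
    apply-window R J X (ℕₚ.suc-injective l)
      (λ i i<J → trans (cong₂ (λ u v → u + (+ i - + r) * v) (h (suc i) (s≤s i<J)) (h i (ℕₚ.m<n⇒m<1+n i<J)))
                       (trans (+-identityˡ _) (*-zeroʳ (+ i - + r))))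
      (trans (cong₂ (λ u v → u + (+ J - + r) * v) ea (h J ℕₚ.≤-refl)) (vanish (X * a) (+ J - + r)))
      (trans (cong₂ (λ u v → u + (+ suc J - + r) * v) eb ea) (collect X b (+ suc J - + r) a))
      (trans (cong₂ (λ u v → u + (+ suc (suc J) - + r) * v) ec eb) (collect X c (+ suc (suc J) - + r) b))
    where
    vanish : ∀ x y → x + y * 0ℤ ≡ x
    vanish = solve-∀
    collect : ∀ X b k a → X * b + k * (X * a) ≡ X * (b + k * a)
    collect = solve-∀

-- Moments of self-dual codes with a gap above the minimum weight.

module Moments where
  open WordSums
  open Incidence
  open Designs
  open Complements
  open RootPolynomials
  open import Data.Bool using (Bool; true; false; if_then_else_; T)
  open import Data.Nat as ℕ using (ℕ; zero; suc; _∸_; _≡ᵇ_; _≤ᵇ_; _!; _^_)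
  import Data.Nat.Properties as ℕₚ
  open import Data.Nat.Combinatorics using () renaming (_C_ to _choose_)
  open import Data.Integer using (ℤ; +_; 0ℤ; 1ℤ; _+_; _*_; _-_; -_)
  open import Data.Integer.Properties
  open import Data.Integer.Tactic.RingSolver using (solve-∀)
  open import Data.List using (length)
  open import Data.Vec using ([]; _∷_)
  open import Data.Fin.Subset using (∣_∣)
  open import Data.Product using (∃; _,_; proj₂)
  open import Data.Sum using (_⊎_; inj₁; inj₂)
  open import Data.Empty using (⊥-elim)
  open import Function using (_∘_)
  open import Relation.Binary.Definitions using (tri<; tri≈; tri>)
  open import Relation.Binary.PropositionalEquality
  open ≡-Reasoning

  -- At least |y| - |T| points of `y` lie outside `T`, so the index is below the lowest power of x.
  coverTransform-zero : ∀ {n} (T y : Word n) j → ∣ T ∣ ℕ.+ j ℕ.< ∣ y ∣ → coverTransform T y j ≡ 0ℤ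
  coverTransform-zero T y j p = coverTransform-low T y j (ℕₚ.+-cancelˡ-< (inside T y) j (outside T y)
    (ℕₚ.≤-<-trans (ℕₚ.+-monoˡ-≤ j (inside≤size T y)) (subst (∣ T ∣ ℕ.+ j ℕ.<_) (sym (inside+outside T y)) p)))

  -- The value of coverTransform T y j at a word y of weight d, when ∣ T ∣ = t, j + t = d + s, N = n - d,
  -- as a function of i = ∣ T ∩ y ∣.
  profile : (t N s i : ℕ) → ℤ
  profile t N s i = if t ∸ i ≤ᵇ s then sgnPow i * H (N ∸ (t ∸ i)) (s ∸ (t ∸ i)) else 0ℤ

  coverTransform-profile : ∀ {n} (T y : Word n) j {d} s → ∣ y ∣ ≡ d → j ℕ.+ ∣ T ∣ ≡ d ℕ.+ s →
    coverTransform T y j ≡ profile ∣ T ∣ (n ∸ d) s (inside T y)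
  coverTransform-profile {n} T y j {d} s refl eq with ∣ T ∣ ∸ inside T y ≤ᵇ s in le
  ... | true = trans (cong (coverTransform T y) (sym outside+r)) (trans (coverTransform-high T y (s ∸ u))
                 (cong (λ b → sgnPow (inside T y) * H b (s ∸ u)) neither≡))
    where
    i = inside T y
    o = outside T y
    -- `u` points of `T` are missed by `y`, so `j` exceeds `outside T y` by s - u.
    u = ∣ T ∣ ∸ i
    i+u : i ℕ.+ u ≡ ∣ T ∣
    i+u = ℕₚ.m+[n∸m]≡n (inside≤size T y)
    u+r : u ℕ.+ (s ∸ u) ≡ s
    u+r = ℕₚ.m+[n∸m]≡n (ℕₚ.≤ᵇ⇒≤ u s (subst Data.Bool.T (sym le) _))
    shuffle : ∀ o r i u → o ℕ.+ r ℕ.+ (i ℕ.+ u) ≡ i ℕ.+ o ℕ.+ (u ℕ.+ r)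
    shuffle = NS.solve-∀
      where import Data.Nat.Tactic.RingSolver as NS
    outside+r : o ℕ.+ (s ∸ u) ≡ j
    outside+r = ℕₚ.+-cancelʳ-≡ ∣ T ∣ _ _ (begin
      o ℕ.+ (s ∸ u) ℕ.+ ∣ T ∣          ≡⟨ cong (o ℕ.+ (s ∸ u) ℕ.+_) (sym i+u) ⟩
      o ℕ.+ (s ∸ u) ℕ.+ (i ℕ.+ u)      ≡⟨ shuffle o (s ∸ u) i u ⟩
      i ℕ.+ o ℕ.+ (u ℕ.+ (s ∸ u))      ≡⟨ cong₂ ℕ._+_ (inside+outside T y) u+r ⟩
      ∣ y ∣ ℕ.+ s                      ≡⟨ sym eq ⟩
      j ℕ.+ ∣ T ∣ ∎)
    shuffle′ : ∀ i u o v → i ℕ.+ u ℕ.+ o ℕ.+ v ≡ i ℕ.+ o ℕ.+ (u ℕ.+ v)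
    shuffle′ = NS.solve-∀
      where import Data.Nat.Tactic.RingSolver as NS
    neither≡ : neither T y ≡ n ∸ ∣ y ∣ ∸ u
    neither≡ = begin
      neither T y                                          ≡⟨ ℕₚ.m+n∸m≡n u (neither T y) ⟨
      u ℕ.+ neither T y ∸ u                                ≡⟨ cong (_∸ u) (sym (ℕₚ.m+n∸m≡n ∣ y ∣ (u ℕ.+ neither T y))) ⟩
      ∣ y ∣ ℕ.+ (u ℕ.+ neither T y) ∸ ∣ y ∣ ∸ u            ≡⟨ cong (λ k → k ∸ ∣ y ∣ ∸ u) (begin
        ∣ y ∣ ℕ.+ (u ℕ.+ neither T y)            ≡⟨ cong (ℕ._+ (u ℕ.+ neither T y)) (sym (inside+outside T y)) ⟩
        i ℕ.+ o ℕ.+ (u ℕ.+ neither T y)          ≡⟨ shuffle′ i u o (neither T y) ⟨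
        i ℕ.+ u ℕ.+ o ℕ.+ neither T y            ≡⟨ cong (λ k → k ℕ.+ o ℕ.+ neither T y) i+u ⟩
        ∣ T ∣ ℕ.+ o ℕ.+ neither T y              ≡⟨ size+outside+neither T y ⟩
        n ∎) ⟩
      n ∸ ∣ y ∣ ∸ u ∎
  ... | false = coverTransform-low T y j (ℕₚ.+-cancelʳ-< (∣ T ∣) j (outside T y) (subst (ℕ._< outside T y ℕ.+ ∣ T ∣) (sym eq) lt))
    where
    u = ∣ T ∣ ∸ inside T y
    s<u : s ℕ.< u
    s<u = ℕₚ.≰⇒> λ u≤s → subst Data.Bool.T le (ℕₚ.≤⇒≤ᵇ u≤s)
    shuffle : ∀ i o u → o ℕ.+ (i ℕ.+ u) ≡ i ℕ.+ o ℕ.+ u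
    shuffle = NS.solve-∀
      where import Data.Nat.Tactic.RingSolver as NS
    lt : ∣ y ∣ ℕ.+ s ℕ.< outside T y ℕ.+ ∣ T ∣
    lt = subst (∣ y ∣ ℕ.+ s ℕ.<_)
      (trans (cong (ℕ._+ u) (sym (inside+outside T y))) (trans (sym (shuffle (inside T y) (outside T y) u))
        (cong (outside T y ℕ.+_) (ℕₚ.m+[n∸m]≡n (inside≤size T y)))))
      (ℕₚ.+-monoʳ-< ∣ y ∣ s<u)

  -- Self-dual codes whose nonzero weights are at least d and avoid d + 1, d + 2, d + 3.
  record Gapped {n} (C : Code n) (d : ℕ) : Set where
    field
      selfDual : SelfDual C
      d>0      : 0 ℕ.< d
      gap      : ∀ y → y ∈C C → ∣ y ∣ ≡ 0 ⊎ ∣ y ∣ ≡ d ⊎ 4 ℕ.+ d ℕ.≤ ∣ y ∣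

  far⇒≤ : ∀ {w d} → w ≡ d ⊎ 4 ℕ.+ d ℕ.≤ w → d ℕ.≤ w
  far⇒≤ (inj₁ w≡d) = ℕₚ.≤-reflexive (sym w≡d)
  far⇒≤ {d = d} (inj₂ far) = ℕₚ.≤-trans (ℕₚ.m≤n+m d 4) far

  size-nonneg : ∀ {n} (C : Code n) → ∃ λ k → size C ≡ + k
  size-nonneg {zero} C with C []
  ... | true  = 1 , refl
  ... | false = 0 , refl
  size-nonneg {suc n} C with size-nonneg (C ∘ (false ∷_)) | size-nonneg (C ∘ (true ∷_))
  ... | k , e | l , e′ = k ℕ.+ l , cong₂ _+_ e e′

  zero-weight : ∀ {n} (y : Word n) → ∣ y ∣ ≡ 0 → y ≡ empty
  zero-weight []          _ = refl
  zero-weight (false ∷ y) e = cong (false ∷_) (zero-weight y e)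

  coverTransform-empty : ∀ {n} (T : Word n) j → coverTransform T empty j ≡ H (n ∸ ∣ T ∣) j
  coverTransform-empty {n} T j = begin
    coverTransform T empty j                                     ≡⟨ cong (λ o → coverTransform T empty (o ℕ.+ j)) (sym out) ⟩
    coverTransform T empty (outside T empty ℕ.+ j)               ≡⟨ coverTransform-high T empty j ⟩
    sgnPow (inside T empty) * H (neither T empty) j              ≡⟨ cong₂ (λ i b → sgnPow i * H b j) ins nei ⟩
    1ℤ * H (n ∸ ∣ T ∣) j                                         ≡⟨ *-identityˡ _ ⟩
    H (n ∸ ∣ T ∣) j ∎
    where
    io = trans (inside+outside T empty) (size-empty n)
    ins : inside T empty ≡ 0
    ins = ℕₚ.m+n≡0⇒m≡0 (inside T empty) io
    out : outside T empty ≡ 0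
    out = ℕₚ.m+n≡0⇒n≡0 (inside T empty) io
    nei : neither T empty ≡ n ∸ ∣ T ∣
    nei = trans (sym (ℕₚ.m+n∸m≡n ∣ T ∣ (neither T empty)))
      (cong (_∸ ∣ T ∣) (trans (cong (ℕ._+ neither T empty) (trans (sym (ℕₚ.+-identityʳ ∣ T ∣)) (cong (∣ T ∣ ℕ.+_) (sym out)))) (size+outside+neither T empty)))

  coverSum : ∀ {n} → Code n → Word n → ℕ → ℤ
  coverSum C T j = Σw (λ c → ⟦ C c ⟧ * cover T j c)

  coverSum-transform : ∀ {n} {C : Code n} → SelfDual C → ∀ T j → size C * coverSum C T j ≡ Σw (λ y → ⟦ C y ⟧ * coverTransform T y j)
  coverSum-transform {C = C} sd T j = trans (sym (poisson sd (cover T j))) (Σw-cong (λ y → cong (⟦ C y ⟧ *_) (fourier-cover T y j)))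

  Σw-single : ∀ {n} {f : Word n → ℤ} → (∀ y → ∣ y ∣ ≢ 0 → f y ≡ 0ℤ) → Σw f ≡ f empty
  Σw-single {zero}  h = refl
  Σw-single {suc n} {f} h = trans
    (cong₂ _+_ (Σw-single (λ y y≢0 → h (false ∷ y) y≢0)) (Σw-0 (λ y → h (true ∷ y) (λ ()))))
    (+-identityʳ (f empty))

  H-0 : ∀ b → H b 0 ≡ + (2 ^ b)
  H-0 zero    = refl
  H-0 (suc b) = trans (cong (+ 2 *_) (H-0 b)) (sym (pos-* 2 (2 ^ b)))

  dot-empty : ∀ {n} (c : Word n) → dot empty c ≡ false
  dot-empty []      = refl
  dot-empty (b ∷ c) = dot-empty c

  empty∈C : ∀ {n} {C : Code n} → SelfDual C → empty ∈C C
  empty∈C sd = proj₂ (sd empty) (λ d _ → dot-empty d)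

  empty⊑ : ∀ {n} (c : Word n) → empty ⊑ c ≡ true
  empty⊑ []      = refl
  empty⊑ (b ∷ c) = empty⊑ c

  -- Poisson summation for the constant function 1: on the dual side only the zero word survives,
  -- with value 2^n.
  size² : ∀ {n} {C : Code n} → SelfDual C → size C * size C ≡ + (2 ^ n)
  size² {n} {C} sd = begin
    size C * size C
      ≡⟨ cong (size C *_) (Σw-cong (λ c → trans (sym (*-identityʳ ⟦ C c ⟧)) (cong (λ b → ⟦ C c ⟧ * (⟦ b ⟧ * 1ℤ)) (sym (empty⊑ c))))) ⟩
    size C * coverSum C empty 0
      ≡⟨ coverSum-transform sd empty 0 ⟩
    Σw (λ y → ⟦ C y ⟧ * coverTransform empty y 0)
      ≡⟨ Σw-single (λ y y≢0 → trans (cong (⟦ C y ⟧ *_) (coverTransform-zero empty y 0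
           (subst (ℕ._< ∣ y ∣) (sym (trans (ℕₚ.+-identityʳ _) (size-empty n))) (ℕₚ.n≢0⇒n>0 y≢0)))) (*-zeroʳ ⟦ C y ⟧)) ⟩
    ⟦ C (empty {n}) ⟧ * coverTransform (empty {n}) (empty {n}) 0
      ≡⟨ cong₂ (λ b x → ⟦ b ⟧ * x) (empty∈C sd) (trans (coverTransform-empty {n} empty 0) (cong (λ k → H (n ∸ k) 0) (size-empty n))) ⟩
    1ℤ * H n 0
      ≡⟨ trans (*-identityˡ _) (H-0 n) ⟩
    + (2 ^ n) ∎

  -- Dimension theory is bypassed: `size C` is a nonnegative integer with the same square as 2^k.
  size-half : ∀ {n k} {C : Code n} → SelfDual C → n ≡ k ℕ.+ k → size C ≡ + (2 ^ k)
  size-half {n} {k} {C} sd n≡2k with s , e ← size-nonneg C = trans e (cong +_ s≡2^k)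
    where
    s² : s ℕ.* s ≡ 2 ^ k ℕ.* 2 ^ k
    s² = +-injective (begin
      + (s ℕ.* s)              ≡⟨ pos-* s s ⟩
      + s * + s                ≡⟨ cong₂ _*_ (sym e) (sym e) ⟩
      size C * size C          ≡⟨ size² sd ⟩
      + (2 ^ n)                ≡⟨ cong +_ (trans (cong (2 ^_) n≡2k) (ℕₚ.^-distribˡ-+-* 2 k k)) ⟩
      + (2 ^ k ℕ.* 2 ^ k) ∎)
    s≡2^k : s ≡ 2 ^ k
    s≡2^k with ℕₚ.<-cmp s (2 ^ k)
    ... | tri≈ _ p _ = p
    ... | tri< p _ _ = ⊥-elim (ℕₚ.<-irrefl s² (ℕₚ.*-mono-< p p))
    ... | tri> _ _ p = ⊥-elim (ℕₚ.<-irrefl (sym s²) (ℕₚ.*-mono-< p p))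

  module _ {n : ℕ} {C : Code n} {d : ℕ} (gapped : Gapped C d) where
    open Gapped gapped

    -- On the dual side only the zero word survives, and its transform depends on `T` through its
    -- size alone.
    coverSum-low : ∀ T T′ j → ∣ T ∣ ≡ ∣ T′ ∣ → ∣ T ∣ ℕ.+ j ℕ.< d → size C * (coverSum C T j - coverSum C T′ j) ≡ 0ℤ
    coverSum-low T T′ j e p = begin
      size C * (coverSum C T j - coverSum C T′ j)
        ≡⟨ *-distribˡ-- (size C) (coverSum C T j) (coverSum C T′ j) ⟩
      size C * coverSum C T j - size C * coverSum C T′ j
        ≡⟨ cong₂ _-_ (coverSum-transform selfDual T j) (coverSum-transform selfDual T′ j) ⟩
      Σw (λ y → ⟦ C y ⟧ * coverTransform T y j) - Σw (λ y → ⟦ C y ⟧ * coverTransform T′ y j)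
        ≡⟨ cong (λ x → x - Σw (λ y → ⟦ C y ⟧ * coverTransform T′ y j)) (Σw-cong same) ⟩
      Σw (λ y → ⟦ C y ⟧ * coverTransform T′ y j) - Σw (λ y → ⟦ C y ⟧ * coverTransform T′ y j)
        ≡⟨ +-inverseʳ (Σw (λ y → ⟦ C y ⟧ * coverTransform T′ y j)) ⟩
      0ℤ ∎
      where
      *-distribˡ-- : ∀ a b c → a * (b - c) ≡ a * b - a * c
      *-distribˡ-- = solve-∀
      same : ∀ y → ⟦ C y ⟧ * coverTransform T y j ≡ ⟦ C y ⟧ * coverTransform T′ y j
      same y with C y in y∈
      ... | false = refl
      ... | true with gap y y∈
      ...   | inj₁ y0 rewrite zero-weight y y0 =
              cong (1ℤ *_) (trans (coverTransform-empty T j) (trans (cong (λ k → H (n ∸ k) j) e) (sym (coverTransform-empty T′ j))))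
      ...   | inj₂ far = cong (1ℤ *_) (trans (coverTransform-zero T y j (ℕₚ.<-≤-trans p d≤))
                                             (sym (coverTransform-zero T′ y j (ℕₚ.<-≤-trans (subst (λ k → k ℕ.+ j ℕ.< d) e p) d≤))))
        where
        d≤ = far⇒≤ far

    profileSum : ℕ → ℕ → Word n → ℤ
    profileSum t s T = Σw (λ y → block C d y * profile t (n ∸ d) s (inside T y))

    -- Here the gap is used: with s < 4 the words of weight at least d + 4 still contribute nothing,
    -- the zero word cancels in the difference, and the words of weight d remain.
    coverSum-high : ∀ T T′ j t s → ∣ T ∣ ≡ t → ∣ T′ ∣ ≡ t → j ℕ.+ t ≡ d ℕ.+ s → s ℕ.< 4 →
      size C * (coverSum C T j - coverSum C T′ j) ≡ profileSum t s T - profileSum t s T′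
    coverSum-high T T′ j t s T-size T′-size eq s<4 = begin
      size C * (coverSum C T j - coverSum C T′ j)
        ≡⟨ *-distribˡ-- (size C) (coverSum C T j) (coverSum C T′ j) ⟩
      size C * coverSum C T j - size C * coverSum C T′ j
        ≡⟨ cong₂ _-_ (coverSum-transform selfDual T j) (coverSum-transform selfDual T′ j) ⟩
      Σw (λ y → ⟦ C y ⟧ * coverTransform T y j) - Σw (λ y → ⟦ C y ⟧ * coverTransform T′ y j)
        ≡⟨ Σw-- (λ y → ⟦ C y ⟧ * coverTransform T y j) (λ y → ⟦ C y ⟧ * coverTransform T′ y j) ⟨
      Σw (λ y → ⟦ C y ⟧ * coverTransform T y j - ⟦ C y ⟧ * coverTransform T′ y j)
        ≡⟨ Σw-cong pointwise ⟩
      Σw (λ y → block C d y * P T y - block C d y * P T′ y)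
        ≡⟨ Σw-- (λ y → block C d y * P T y) (λ y → block C d y * P T′ y) ⟩
      profileSum t s T - profileSum t s T′ ∎
      where
      P : Word n → Word n → ℤ
      P T y = profile t (n ∸ d) s (inside T y)
      *-distribˡ-- : ∀ a b c → a * (b - c) ≡ a * b - a * c
      *-distribˡ-- = solve-∀
      0<d : d ≢ 0
      0<d = ℕₚ.n>0⇒n≢0 d>0
      false≡ᵇ : ∀ {a b} → a ≢ b → (a ≡ᵇ b) ≡ false
      false≡ᵇ {a} {b} a≢b with a ≡ᵇ b in e
      ... | false = refl
      ... | true  = ⊥-elim (a≢b (ℕₚ.≡ᵇ⇒≡ a b (subst Data.Bool.T (sym e) _)))
      true≡ᵇ : ∀ {a b} → a ≡ b → (a ≡ᵇ b) ≡ true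
      true≡ᵇ {zero}  refl = refl
      true≡ᵇ {suc a} refl = true≡ᵇ {a} refl
      big : ∀ {y : Word n} → 4 ℕ.+ d ℕ.≤ ∣ y ∣ → t ℕ.+ j ℕ.< ∣ y ∣
      big p = ℕₚ.<-≤-trans (subst (ℕ._< 4 ℕ.+ d) (trans (sym eq) (ℕₚ.+-comm j t)) (subst (d ℕ.+ s ℕ.<_) (ℕₚ.+-comm d 4) (ℕₚ.+-monoʳ-< d s<4))) p
      pointwise : ∀ y → ⟦ C y ⟧ * coverTransform T y j - ⟦ C y ⟧ * coverTransform T′ y j
                      ≡ block C d y * P T y - block C d y * P T′ y
      pointwise y with C y in y∈
      ... | false = refl
      ... | true with gap y y∈
      ...   | inj₁ y0 rewrite false≡ᵇ {∣ y ∣} {d} (λ e → 0<d (trans (sym e) y0)) | zero-weight y y0 =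
              trans (cong (λ x → 1ℤ * x - 1ℤ * coverTransform T′ empty j)
                (trans (coverTransform-empty T j) (trans (cong (λ k → H (n ∸ k) j) (trans T-size (sym T′-size))) (sym (coverTransform-empty T′ j)))))
                (+-inverseʳ (1ℤ * coverTransform T′ empty j))
      ...   | inj₂ (inj₁ y≡d) rewrite true≡ᵇ {∣ y ∣} {d} y≡d =
              cong₂ (λ a b → 1ℤ * a - 1ℤ * b)
                (trans (coverTransform-profile T y j s y≡d (trans (cong (j ℕ.+_) T-size) eq)) (cong (λ k → profile k (n ∸ d) s (inside T y)) T-size))
                (trans (coverTransform-profile T′ y j s y≡d (trans (cong (j ℕ.+_) T′-size) eq)) (cong (λ k → profile k (n ∸ d) s (inside T′ y)) T′-size))
      ...   | inj₂ (inj₂ far) rewrite false≡ᵇ {∣ y ∣} {d} (ℕₚ.>⇒≢ (ℕₚ.<-≤-trans (ℕₚ.m≤n+m (suc d) 3) far)) =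
              cong₂ (λ a b → 1ℤ * a - 1ℤ * b)
                (coverTransform-zero T y j (subst (λ k → k ℕ.+ j ℕ.< ∣ y ∣) (sym T-size) (big {y} far)))
                (coverTransform-zero T′ y j (subst (λ k → k ℕ.+ j ℕ.< ∣ y ∣) (sym T′-size) (big {y} far)))

    weighing : Word n → Word n → Word n → ℤ
    weighing T T′ c = ⟦ C c ⟧ * (⟦ T ⊑ c ⟧ - ⟦ T′ ⊑ c ⟧)

    moment-weighing : ∀ T T′ j → moment (λ c → + zeros c) (weighing T T′) j ≡ + (j !) * (coverSum C T j - coverSum C T′ j)
    moment-weighing T T′ j = begin
      Σw (λ c → weighing T T′ c * falling (+ zeros c) j)
        ≡⟨ Σw-cong (λ c → trans (cong (weighing T T′ c *_) (falling-choose (zeros c) j))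
             (expand ⟦ C c ⟧ ⟦ T ⊑ c ⟧ ⟦ T′ ⊑ c ⟧ (+ (j !)) (+ (zeros c choose j)))) ⟩
      Σw (λ c → + (j !) * (⟦ C c ⟧ * cover T j c - ⟦ C c ⟧ * cover T′ j c))
        ≡⟨ trans (Σw-* (+ (j !)) (λ c → ⟦ C c ⟧ * cover T j c - ⟦ C c ⟧ * cover T′ j c)) (cong (+ (j !) *_) (Σw-- (λ c → ⟦ C c ⟧ * cover T j c) (λ c → ⟦ C c ⟧ * cover T′ j c))) ⟩
      + (j !) * (coverSum C T j - coverSum C T′ j) ∎
      where
      expand : ∀ x a b f k → x * (a - b) * (f * k) ≡ f * (x * (a * k) - x * (b * k))
      expand = solve-∀

    -- At s = 0 a minimum weight word has to contain the whole of `T` to contribute.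
    profileSum-0 : ∀ t T → ∣ T ∣ ≡ t → profileSum t 0 T ≡ sgnPow t * + (2 ^ (n ∸ d)) * covering (block C d) T
    profileSum-0 t T T-size = trans (Σw-cong pointwise) (Σw-* (sgnPow t * + (2 ^ (n ∸ d))) (λ y → block C d y * ⟦ T ⊑ y ⟧))
      where
      swap : ∀ x y → x * y ≡ y * (x * 1ℤ)
      swap = solve-∀
      pointwise : ∀ y → block C d y * profile t (n ∸ d) 0 (inside T y) ≡ sgnPow t * + (2 ^ (n ∸ d)) * (block C d y * ⟦ T ⊑ y ⟧)
      pointwise y with T ⊑ y in e
      ... | true  rewrite trans (⊑⇒inside T y e) T-size | ℕₚ.n∸n≡0 t | H-0 (n ∸ d) = swap (block C d y) _
      ... | false with t ∸ inside T y in e′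
      ...   | suc u = trans (*-zeroʳ (block C d y)) (sym (trans (cong (sgnPow t * + (2 ^ (n ∸ d)) *_) (*-zeroʳ (block C d y))) (*-zeroʳ (sgnPow t * + (2 ^ (n ∸ d))))))
      ...   | zero  = ⊥-elim (ℕₚ.<⇒≱ (subst (inside T y ℕ.<_) T-size (⋢⇒inside T y e)) (ℕₚ.m∸n≡0⇒m≤n e′))

    covering-transform : ∀ j → j ℕ.< d → size C * coverSum C empty j ≡ Σw (λ (x : Word n) → + (zeros x choose j))
    covering-transform j j<d = begin
      size C * coverSum C empty j
        ≡⟨ coverSum-transform selfDual empty j ⟩
      Σw (λ y → ⟦ C y ⟧ * coverTransform empty y j)
        ≡⟨ Σw-single zero-elsewhere ⟩
      ⟦ C (empty {n}) ⟧ * coverTransform (empty {n}) (empty {n}) j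
        ≡⟨ trans (cong (λ b → ⟦ b ⟧ * coverTransform (empty {n}) (empty {n}) j) (empty∈C selfDual)) (*-identityˡ _) ⟩
      coverTransform (empty {n}) (empty {n}) j
        ≡⟨ fourier-cover {n} empty empty j ⟨
      Σw (λ (x : Word n) → cover empty j x * χ x empty)
        ≡⟨ Σw-cong {n} (λ x → trans (cong₂ (λ a b → ⟦ a ⟧ * + (zeros x choose j) * sgn b) (empty⊑ x) (trans (dot-comm x empty) (dot-empty x)))
             (unit (+ (zeros x choose j)))) ⟩
      Σw (λ (x : Word n) → + (zeros x choose j)) ∎
      where
      unit : ∀ x → 1ℤ * x * 1ℤ ≡ x
      unit = solve-∀
      zero-elsewhere : ∀ y → ∣ y ∣ ≢ 0 → ⟦ C y ⟧ * coverTransform empty y j ≡ 0ℤ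
      zero-elsewhere y y≢0 with C y in y∈
      ... | false = refl
      ... | true with gap y y∈
      ...   | inj₁ y0 = ⊥-elim (y≢0 y0)
      ...   | inj₂ far = cong (1ℤ *_) (coverTransform-zero empty y j
                (subst (λ k → k ℕ.+ j ℕ.< ∣ y ∣) (sym (size-empty n)) (ℕₚ.<-≤-trans j<d (far⇒≤ far))))

    -- A self-dual code of minimum weight at least d is an orthogonal array of strength d - 1: a
    -- polynomial of lower degree in the number of zeros has the same average over the code as over
    -- all words. The factor `size C` is right because its square is the number of words.
    quadrature : ∀ R → length R ℕ.< d →
      size C * Σw (λ c → ⟦ C c ⟧ * rootPoly R (+ zeros c)) ≡ Σw (λ (x : Word n) → rootPoly R (+ zeros x))
    quadrature R R<d = i-j≡0⇒i≡j _ _ (begin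
      size C * Σw (λ c → ⟦ C c ⟧ * Q c) - Σw Q
        ≡⟨ cong (_- Σw Q) (sym (Σw-* (size C) (λ c → ⟦ C c ⟧ * Q c))) ⟩
      Σw (λ c → size C * (⟦ C c ⟧ * Q c)) - Σw Q
        ≡⟨ Σw-- (λ c → size C * (⟦ C c ⟧ * Q c)) Q ⟨
      Σw (λ c → size C * (⟦ C c ⟧ * Q c) - Q c)
        ≡⟨ Σw-cong (λ c → collect (size C) ⟦ C c ⟧ (Q c)) ⟩
      Σw (λ c → η c * Q c)
        ≡⟨ Σ-rootPoly (λ c → + zeros c) R η ⟩
      apply R (moment (λ c → + zeros c) η) 0
        ≡⟨ apply-zero R d low 0 R<d ⟩
      0ℤ ∎)
      where
      Q : Word n → ℤ
      Q c = rootPoly R (+ zeros c)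
      η : Word n → ℤ
      η c = size C * ⟦ C c ⟧ - 1ℤ
      collect : ∀ s x q → s * (x * q) - q ≡ (s * x - 1ℤ) * q
      collect = solve-∀
      expand : ∀ s x f k → (s * x - 1ℤ) * (f * k) ≡ f * (s * (x * (1ℤ * k)) - k)
      expand = solve-∀
      low : ∀ j → j ℕ.< d → moment (λ c → + zeros c) η j ≡ 0ℤ
      low j j<d = begin
        Σw (λ c → η c * falling (+ zeros c) j)
          ≡⟨ Σw-cong (λ c → trans (cong (η c *_) (falling-choose (zeros c) j)) (trans (expand (size C) ⟦ C c ⟧ (+ (j !)) (+ (zeros c choose j)))
               (cong (λ b → + (j !) * (size C * (⟦ C c ⟧ * (⟦ b ⟧ * + (zeros c choose j))) - + (zeros c choose j))) (sym (empty⊑ c))))) ⟩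
        Σw (λ c → + (j !) * (size C * (⟦ C c ⟧ * cover empty j c) - + (zeros c choose j)))
          ≡⟨ Σw-* (+ (j !)) (λ c → size C * (⟦ C c ⟧ * cover empty j c) - + (zeros c choose j)) ⟩
        + (j !) * Σw (λ c → size C * (⟦ C c ⟧ * cover empty j c) - + (zeros c choose j))
          ≡⟨ cong (+ (j !) *_) (trans (Σw-- (λ c → size C * (⟦ C c ⟧ * cover empty j c)) (λ c → + (zeros c choose j)))
               (cong₂ _-_ (trans (Σw-* (size C) (λ c → ⟦ C c ⟧ * cover empty j c)) (covering-transform j j<d)) refl)) ⟩
        + (j !) * (Σw (λ (c : Word n) → + (zeros c choose j)) - Σw (λ (c : Word n) → + (zeros c choose j)))
          ≡⟨ trans (cong (+ (j !) *_) (+-inverseʳ (Σw (λ (c : Word n) → + (zeros c choose j))))) (*-zeroʳ (+ (j !))) ⟩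
        0ℤ ∎

-- Polynomials whose roots form progressions of step four: values and signs.

module Progressions where
  open WordSums
  open Incidence
  open Designs
  open Complements
  open RootPolynomials
  open Moments
  open import Data.Nat as ℕ using (ℕ; zero; suc; z≤n; s≤s; _∸_; _!; _^_)
  import Data.Nat.Properties as ℕₚ
  import Data.Nat.Tactic.RingSolver as NS
  open import Data.Integer using (ℤ; +_; 0ℤ; 1ℤ; -1ℤ; _+_; _*_; _-_; -_)
  open import Data.Integer.Properties
  open import Data.Integer.Tactic.RingSolver using (solve-∀)
  open import Data.List using (List; []; _∷_; _++_; length)
  import Data.List.Properties as Listₚ
  open import Data.List.Membership.Propositional using (_∈_)
  open import Data.List.Relation.Unary.Any using (here; there)
  open import Data.List.Relation.Unary.All as All using (All; []; _∷_)
  open import Data.List.Relation.Unary.AllPairs using ([]; _∷_)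
  open import Data.List.Relation.Unary.Unique.Propositional using (Unique)
  open import Data.Product using (∃; _,_)
  open import Data.Sum using (_⊎_; inj₁; inj₂)
  open import Data.Empty using (⊥-elim)
  open import Relation.Nullary using (yes; no)
  open import Relation.Binary.PropositionalEquality
  open ≡-Reasoning

  progression : ℕ → ℕ → List ℕ
  progression a zero    = []
  progression a (suc k) = a ∷ progression (4 ℕ.+ a) k

  length-progression : ∀ a k → length (progression a k) ≡ k
  length-progression a zero    = refl
  length-progression a (suc k) = cong suc (length-progression (4 ℕ.+ a) k)

  shift-index : ∀ a i → a ℕ.+ 4 ℕ.* suc i ≡ 4 ℕ.+ a ℕ.+ 4 ℕ.* i
  shift-index = NS.solve-∀

  progression-root : ∀ a k i → i ℕ.< k → rootPoly (progression a k) (+ (a ℕ.+ 4 ℕ.* i)) ≡ 0ℤ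
  progression-root a (suc k) zero    _ = trans (cong (λ x → (+ x - + a) * rootPoly (progression (4 ℕ.+ a) k) (+ (a ℕ.+ 0))) (ℕₚ.+-identityʳ a))
    (trans (cong (_* rootPoly (progression (4 ℕ.+ a) k) (+ (a ℕ.+ 0))) (+-inverseʳ (+ a))) (*-zeroˡ (rootPoly (progression (4 ℕ.+ a) k) (+ (a ℕ.+ 0)))))
  progression-root a (suc k) (suc i) (s≤s i<k) = trans
    (cong ((+ (a ℕ.+ 4 ℕ.* suc i) - + a) *_)
      (trans (cong (λ z → rootPoly (progression (4 ℕ.+ a) k) (+ z)) (shift-index a i)) (progression-root (4 ℕ.+ a) k i i<k)))
    (*-zeroʳ (+ (a ℕ.+ 4 ℕ.* suc i) - + a))

  progression-snoc : ∀ a k z → rootPoly (progression a (suc k)) z ≡ rootPoly (progression a k) z * (z - + (a ℕ.+ 4 ℕ.* k))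
  progression-snoc a zero    z = trans (*-comm (z - + a) 1ℤ) (cong (λ x → 1ℤ * (z - + x)) (sym (ℕₚ.+-identityʳ a)))
  progression-snoc a (suc k) z = begin
    (z - + a) * rootPoly (progression (4 ℕ.+ a) (suc k)) z
      ≡⟨ cong ((z - + a) *_) (progression-snoc (4 ℕ.+ a) k z) ⟩
    (z - + a) * (rootPoly (progression (4 ℕ.+ a) k) z * (z - + (4 ℕ.+ a ℕ.+ 4 ℕ.* k)))
      ≡⟨ *-assoc (z - + a) (rootPoly (progression (4 ℕ.+ a) k) z) _ ⟨
    (z - + a) * rootPoly (progression (4 ℕ.+ a) k) z * (z - + (4 ℕ.+ a ℕ.+ 4 ℕ.* k))
      ≡⟨ cong (λ x → (z - + a) * rootPoly (progression (4 ℕ.+ a) k) z * (z - + x)) (sym (shift-index a k)) ⟩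
    (z - + a) * rootPoly (progression (4 ℕ.+ a) k) z * (z - + (a ℕ.+ 4 ℕ.* suc k)) ∎

  progression-++ : ∀ a k l → progression a (k ℕ.+ l) ≡ progression a k ++ progression (a ℕ.+ 4 ℕ.* k) l
  progression-++ a zero    l = cong (λ x → progression x l) (sym (ℕₚ.+-identityʳ a))
  progression-++ a (suc k) l = cong (a ∷_) (trans (progression-++ (4 ℕ.+ a) k l) (cong (λ x → progression (4 ℕ.+ a) k ++ progression x l) (sym (shift-index a k))))

  -- The bound `a + 4 * k` is the first member beyond the progression, so every factor is positive;
  -- strict positivity is recorded by exhibiting a successor.
  above : ∀ a k z → a ℕ.+ 4 ℕ.* k ℕ.≤ z → ∃ λ x → rootPoly (progression a k) (+ z) ≡ + suc x
  above a zero    z _ = 0 , refl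
  above a (suc k) z p with above (4 ℕ.+ a) k z (subst (ℕ._≤ z) (shift-index a k) p)
  ... | x , e with z ∸ a | ℕₚ.m+[n∸m]≡n (ℕₚ.≤-trans (ℕₚ.m≤m+n a (4 ℕ.* suc k)) p)
  ...   | zero  | e′ = ⊥-elim (ℕₚ.<-irrefl (trans (sym (ℕₚ.+-identityʳ a)) e′) (ℕₚ.<-≤-trans (ℕₚ.m<m+n a (s≤s z≤n)) p))
  ...   | suc y | e′ = x ℕ.+ y ℕ.* suc x , trans (cong₂ _*_ diff e) (sym (pos-* (suc y) (suc x)))
    where
    diff : + z - + a ≡ + suc y
    diff = trans (cong (λ k → + k - + a) (sym e′)) (cancel (+ a) (+ suc y))
      where
      cancel : ∀ a b → a + b - a ≡ b
      cancel = solve-∀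

  below : ∀ a k z → z ℕ.< a → ∃ λ x → rootPoly (progression a k) (+ z) ≡ sgnPow k * + suc x
  below a zero    z _ = 0 , refl
  below a (suc k) z p with below (4 ℕ.+ a) k z (ℕₚ.<-≤-trans p (ℕₚ.m≤n+m a 4))
  ... | x , e with a ∸ z | ℕₚ.m+[n∸m]≡n (ℕₚ.<⇒≤ p)
  ...   | zero  | e′ = ⊥-elim (ℕₚ.<-irrefl (trans (sym (ℕₚ.+-identityʳ z)) e′) p)
  ...   | suc y | e′ = x ℕ.+ y ℕ.* suc x , trans (cong₂ _*_ diff e) (trans (swap (+ suc y) (sgnPow k) (+ suc x)) (cong (sgnPow (suc k) *_) (sym (pos-* (suc y) (suc x)))))
    where
    swap : ∀ y s x → (-1ℤ * y) * (s * x) ≡ -1ℤ * s * (y * x)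
    swap = solve-∀
    diff : + z - + a ≡ -1ℤ * + suc y
    diff = trans (cong (λ k → + z - + k) (sym e′)) (cancel (+ z) (+ suc y))
      where
      cancel : ∀ a b → a - (a + b) ≡ -1ℤ * b
      cancel = solve-∀

  -- At the next member of the progression the factors are 4, 8, ..., 4k.
  top-value : ∀ a k → rootPoly (progression a k) (+ (a ℕ.+ 4 ℕ.* k)) ≡ + (4 ^ k ℕ.* k !)
  top-value a zero    = refl
  top-value a (suc k) = begin
    (+ (a ℕ.+ 4 ℕ.* suc k) - + a) * rootPoly (progression (4 ℕ.+ a) k) (+ (a ℕ.+ 4 ℕ.* suc k))
      ≡⟨ cong₂ _*_ (cancel (+ a) (+ (4 ℕ.* suc k))) (trans (cong (λ z → rootPoly (progression (4 ℕ.+ a) k) (+ z)) (shift-index a k)) (top-value (4 ℕ.+ a) k)) ⟩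
    + (4 ℕ.* suc k) * + (4 ^ k ℕ.* k !)
      ≡⟨ pos-* (4 ℕ.* suc k) (4 ^ k ℕ.* k !) ⟨
    + (4 ℕ.* suc k ℕ.* (4 ^ k ℕ.* k !))
      ≡⟨ cong +_ (regroup (suc k) (4 ^ k) (k !)) ⟩
    + (4 ^ suc k ℕ.* suc k !) ∎
    where
    cancel : ∀ a b → a + b - a ≡ b
    cancel = solve-∀
    regroup : ∀ k x y → 4 ℕ.* k ℕ.* (x ℕ.* y) ≡ 4 ℕ.* x ℕ.* (k ℕ.* y)
    regroup = NS.solve-∀

  bottom-value : ∀ a k → rootPoly (progression (4 ℕ.+ a) k) (+ a) ≡ sgnPow k * + (4 ^ k ℕ.* k !)
  bottom-value a zero    = refl
  bottom-value a (suc k) = begin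
    rootPoly (progression (4 ℕ.+ a) (suc k)) (+ a)
      ≡⟨ progression-snoc (4 ℕ.+ a) k (+ a) ⟩
    rootPoly (progression (4 ℕ.+ a) k) (+ a) * (+ a - + (4 ℕ.+ a ℕ.+ 4 ℕ.* k))
      ≡⟨ cong₂ _*_ (bottom-value a k) (trans (cong (λ x → + a - + x) (sym (shift-index a k))) (cancel (+ a) (+ (4 ℕ.* suc k)))) ⟩
    sgnPow k * + (4 ^ k ℕ.* k !) * (-1ℤ * + (4 ℕ.* suc k))
      ≡⟨ regroup (sgnPow k) (+ (4 ^ k ℕ.* k !)) (+ (4 ℕ.* suc k)) ⟩
    -1ℤ * sgnPow k * (+ (4 ℕ.* suc k) * + (4 ^ k ℕ.* k !))
      ≡⟨ cong (-1ℤ * sgnPow k *_) (sym (pos-* (4 ℕ.* suc k) (4 ^ k ℕ.* k !))) ⟩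
    -1ℤ * sgnPow k * + (4 ℕ.* suc k ℕ.* (4 ^ k ℕ.* k !))
      ≡⟨ cong (λ x → -1ℤ * sgnPow k * + x) (regroup′ (suc k) (4 ^ k) (k !)) ⟩
    sgnPow (suc k) * + (4 ^ suc k ℕ.* suc k !) ∎
    where
    cancel : ∀ a b → a - (a + b) ≡ -1ℤ * b
    cancel = solve-∀
    regroup : ∀ s x y → s * x * (-1ℤ * y) ≡ -1ℤ * s * (y * x)
    regroup = solve-∀
    regroup′ : ∀ k x y → 4 ℕ.* k ℕ.* (x ℕ.* y) ≡ 4 ℕ.* x ℕ.* (k ℕ.* y)
    regroup′ = NS.solve-∀

  -- progression a (p + 1 + q) without its p-th member
  punctured : ℕ → ℕ → ℕ → List ℕ
  punctured a p q = progression a p ++ progression (a ℕ.+ 4 ℕ.* suc p) q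

  length-punctured : ∀ a p q → length (punctured a p q) ≡ p ℕ.+ q
  length-punctured a p q = trans (Listₚ.length-++ (progression a p)) (cong₂ ℕ._+_ (length-progression a p) (length-progression _ q))

  punctured-full : ∀ a p q z → rootPoly (punctured a p q) z * (z - + (a ℕ.+ 4 ℕ.* p)) ≡ rootPoly (progression a (p ℕ.+ suc q)) z
  punctured-full a p q z = begin
    rootPoly (punctured a p q) z * v
      ≡⟨ cong (_* v) (rootPoly-++ (progression a p) (progression (a ℕ.+ 4 ℕ.* suc p) q) z) ⟩
    rootPoly (progression a p) z * rootPoly (progression (a ℕ.+ 4 ℕ.* suc p) q) z * v
      ≡⟨ cong (λ x → rootPoly (progression a p) z * rootPoly (progression x q) z * v) (shift a p) ⟩
    rootPoly (progression a p) z * rootPoly (progression (4 ℕ.+ (a ℕ.+ 4 ℕ.* p)) q) z * v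
      ≡⟨ move (rootPoly (progression a p) z) _ v ⟩
    rootPoly (progression a p) z * (v * rootPoly (progression (4 ℕ.+ (a ℕ.+ 4 ℕ.* p)) q) z)
      ≡⟨ rootPoly-++ (progression a p) (progression (a ℕ.+ 4 ℕ.* p) (suc q)) z ⟨
    rootPoly (progression a p ++ progression (a ℕ.+ 4 ℕ.* p) (suc q)) z
      ≡⟨ cong (λ R → rootPoly R z) (sym (progression-++ a p (suc q))) ⟩
    rootPoly (progression a (p ℕ.+ suc q)) z ∎
    where
    v = z - + (a ℕ.+ 4 ℕ.* p)
    shift : ∀ a p → a ℕ.+ 4 ℕ.* suc p ≡ 4 ℕ.+ (a ℕ.+ 4 ℕ.* p)
    shift = NS.solve-∀
    move : ∀ x y v → x * y * v ≡ x * (v * y)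
    move = solve-∀

  node-injective : ∀ a {i j} → a ℕ.+ 4 ℕ.* i ≡ a ℕ.+ 4 ℕ.* j → i ≡ j
  node-injective a {i} {j} e = ℕₚ.*-cancelˡ-≡ i j 4 (ℕₚ.+-cancelˡ-≡ a _ _ e)

  -- The full progression vanishes at this point while the factor left out does not.
  punctured-root : ∀ a p q i → i ℕ.≤ p ℕ.+ q → i ≢ p → rootPoly (punctured a p q) (+ (a ℕ.+ 4 ℕ.* i)) ≡ 0ℤ
  punctured-root a p q i i≤ i≢p with i*j≡0⇒i≡0∨j≡0 (rootPoly (punctured a p q) z) (trans (punctured-full a p q z)
      (progression-root a (p ℕ.+ suc q) i (subst (i ℕ.<_) (sym (ℕₚ.+-suc p q)) (s≤s i≤))))
    where z = + (a ℕ.+ 4 ℕ.* i)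
  ... | inj₁ e = e
  ... | inj₂ e = ⊥-elim (i≢p (node-injective a (+-injective (i-j≡0⇒i≡j _ _ e))))

  sumOver : List ℕ → (ℕ → ℤ) → ℤ
  sumOver []      f = 0ℤ
  sumOver (i ∷ E) f = f i + sumOver E f

  Σw-sumOver : ∀ {n} E (g : ℕ → Word n → ℤ) → Σw (λ c → sumOver E (λ i → g i c)) ≡ sumOver E (λ i → Σw (g i))
  Σw-sumOver {n} []  g = Σw-0 {n} (λ c → refl)
  Σw-sumOver (i ∷ E) g = trans (Σw-+ (g i) (λ c → sumOver E (λ i → g i c))) (cong (λ x → Σw (g i) + x) (Σw-sumOver E g))

  sumOver-0 : ∀ E {f : ℕ → ℤ} → (∀ i → i ∈ E → f i ≡ 0ℤ) → sumOver E f ≡ 0ℤ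
  sumOver-0 []      h = refl
  sumOver-0 (i ∷ E) h = cong₂ _+_ (h i (here refl)) (sumOver-0 E (λ j j∈ → h j (there j∈)))

  -- The alternative in the last premise lets `E` omit indices at which the summand is known to
  -- vanish, as it does at the roots of a polynomial.
  sumOver-single : ∀ {E} {f : ℕ → ℤ} → Unique E → ∀ {i₀} → (∀ i → i ∈ E → i ≢ i₀ → f i ≡ 0ℤ) →
    (i₀ ∈ E ⊎ f i₀ ≡ 0ℤ) → sumOver E f ≡ f i₀
  sumOver-single {[]}    _          h (inj₂ e) = sym e
  sumOver-single {i ∷ E} {f} (i∉E ∷ u) {i₀} h o with i ℕ.≟ i₀
  ... | yes refl = trans (cong (λ x → f i + x) (sumOver-0 E (λ j j∈ → h j (there j∈) (λ j≡i → All.lookup i∉E j∈ (sym j≡i))))) (+-identityʳ (f i))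
  ... | no i≢i₀  = trans (cong₂ _+_ (h i (here refl) i≢i₀) (sumOver-single u (λ j j∈ → h j (there j∈)) (strip o))) (+-identityˡ (f i₀))
    where
    strip : i₀ ∈ i ∷ E ⊎ f i₀ ≡ 0ℤ → i₀ ∈ E ⊎ f i₀ ≡ 0ℤ
    strip (inj₁ (here e))   = ⊥-elim (i≢i₀ (sym e))
    strip (inj₁ (there i∈)) = inj₁ i∈
    strip (inj₂ e)          = inj₂ e

-- Weights, complements and size of an extremal code of length 24m + 16.

module ExtremalCodes where
  open WordSums
  open Incidence
  open Designs
  open Complements
  open Moments
  open import Data.Bool using (Bool; true; false; _∧_; _xor_; not; T)
  open import Data.Bool.Properties using (not-involutive)
  open import Data.Nat as ℕ using (ℕ; zero; suc; z≤n; s≤s; _+_; _*_; _∸_; _≤_; _<_; _≡ᵇ_; _/_)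
  import Data.Nat.Properties as ℕₚ
  import Data.Nat.Tactic.RingSolver as NS
  open import Data.Nat.DivMod using (+-distrib-/-∣ˡ; m*n/n≡m)
  open import Data.Nat.Divisibility using (m∣m*n)
  open import Data.Integer using (+_)
  open import Data.Vec using ([]; _∷_)
  open import Data.Fin.Subset using (∣_∣)
  open import Data.Product using (∃; _,_; _×_; proj₁; proj₂)
  open import Data.Sum using (_⊎_; inj₁; inj₂)
  open import Data.Empty using (⊥-elim)
  open import Relation.Nullary using (yes; no)
  open import Relation.Binary.PropositionalEquality
  open ≡-Reasoning

  parity : ℕ → Bool
  parity zero    = false
  parity (suc n) = not (parity n)

  parity-+ : ∀ a b → parity (a + b) ≡ parity a xor parity b
  parity-+ zero    b = refl
  parity-+ (suc a) b with parity a | parity-+ a b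
  ... | true  | e = trans (cong not e) (not-involutive (parity b))
  ... | false | e = cong not e

  parity-4* : ∀ k → parity (4 * k) ≡ false
  parity-4* k = trans (parity-+ k (k + (k + (k + 0)))) (trans (cong (parity k xor_) (trans (parity-+ k (k + (k + 0)))
    (cong (parity k xor_) (trans (parity-+ k (k + 0)) (cong (parity k xor_) (cong parity (ℕₚ.+-identityʳ k))))))) (four (parity k)))
    where
    four : ∀ b → b xor (b xor (b xor b)) ≡ false
    four true  = refl
    four false = refl

  dot-full : ∀ {n} (c : Word n) → dot full c ≡ parity ∣ c ∣
  dot-full []          = refl
  dot-full (true ∷ c)  = cong not (dot-full c)
  dot-full (false ∷ c) = dot-full c

  comp≡⊕full : ∀ {n} (c : Word n) → comp c ≡ c ⊕ full
  comp≡⊕full []          = refl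
  comp≡⊕full (true ∷ c)  = cong (false ∷_) (comp≡⊕full c)
  comp≡⊕full (false ∷ c) = cong (true ∷_) (comp≡⊕full c)

  weight-comp : ∀ {n} (c : Word n) → ∣ comp c ∣ ≡ zeros c
  weight-comp []          = refl
  weight-comp (true ∷ c)  = weight-comp c
  weight-comp (false ∷ c) = cong suc (weight-comp c)

  -- The all-one word is orthogonal to every word of even weight; this closes the code under
  -- complements.
  full∈C : ∀ {n} {C : Code n} → SelfDual C → DoublyEven C → full ∈C C
  full∈C sd de = proj₂ (sd full) λ c c∈ → trans (dot-full c) (even (de c c∈))
    where
    even : ∀ {w} → Div4 w → parity w ≡ false
    even (div4 k) = parity-4* k

  C-comp : ∀ {n} {C : Code n} → SelfDual C → DoublyEven C → ∀ c → C (comp c) ≡ C c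
  C-comp {C = C} sd de c = trans (cong C (comp≡⊕full c)) (∈C-translate sd (full∈C sd de) c)

  ≡ᵇ-⇔ : ∀ {a b a′ b′} → (a ≡ b → a′ ≡ b′) → (a′ ≡ b′ → a ≡ b) → (a′ ≡ᵇ b′) ≡ (a ≡ᵇ b)
  ≡ᵇ-⇔ {a} {b} {a′} {b′} f g with a ≡ᵇ b in e | a′ ≡ᵇ b′ in e′
  ... | true  | true  = refl
  ... | false | false = refl
  ... | true  | false = ⊥-elim (subst T e′ (ℕₚ.≡⇒≡ᵇ a′ b′ (f (ℕₚ.≡ᵇ⇒≡ a b (subst T (sym e) _)))))
  ... | false | true  = ⊥-elim (subst T e (ℕₚ.≡⇒≡ᵇ a b (g (ℕₚ.≡ᵇ⇒≡ a′ b′ (subst T (sym e′) _)))))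

  block-comp : ∀ {n} {C : Code n} → SelfDual C → DoublyEven C → ∀ {w w′} → w + w′ ≡ n → ∀ c → block C w′ (comp c) ≡ block C w c
  block-comp {n} {C} sd de {w} {w′} e c = cong ⟦_⟧ (cong₂ _∧_ (C-comp sd de c) (≡ᵇ-⇔ {∣ c ∣} {w} there back))
    where
    sum : ∣ c ∣ + ∣ comp c ∣ ≡ n
    sum = trans (cong (λ k → ∣ c ∣ + k) (weight-comp c)) (trans (ℕₚ.+-comm ∣ c ∣ (zeros c)) (zeros+weight c))
    there : ∣ c ∣ ≡ w → ∣ comp c ∣ ≡ w′
    there refl = ℕₚ.+-cancelˡ-≡ ∣ c ∣ _ _ (trans sum (sym e))
    back : ∣ comp c ∣ ≡ w′ → ∣ c ∣ ≡ w
    back refl = ℕₚ.+-cancelʳ-≡ ∣ comp c ∣ _ _ (trans sum (sym e))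

  block-ofWeight : ∀ {n} (C : Code n) w → OfWeight (block C w) w
  block-ofWeight C w c ≢w with C c | ∣ c ∣ ≡ᵇ w in e
  ... | false | _     = refl
  ... | true  | false = refl
  ... | true  | true  = ⊥-elim (≢w (ℕₚ.≡ᵇ⇒≡ ∣ c ∣ w (subst T (sym e) _)))

  [24m+16]/24 : ∀ m → (24 * m + 16) / 24 ≡ m
  [24m+16]/24 m = begin
    (24 * m + 16) / 24        ≡⟨ +-distrib-/-∣ˡ 16 (m∣m*n m) ⟩
    24 * m / 24 + 0           ≡⟨ ℕₚ.+-identityʳ _ ⟩
    24 * m / 24               ≡⟨ cong (_/ 24) (ℕₚ.*-comm 24 m) ⟩
    m * 24 / 24               ≡⟨ m*n/n≡m m 24 ⟩
    m ∎

  module _ (m : ℕ) {C : Code (24 * m + 16)} (ext : ExtremalDoublyEvenSelfDual C) where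
    d : ℕ
    d = 4 * m + 4

    isSelfDual : SelfDual C
    isSelfDual = proj₁ ext

    isDoublyEven : DoublyEven C
    isDoublyEven = proj₁ (proj₂ ext)

    d≤weight : ∀ c → c ∈C C → ∣ c ∣ ≢ 0 → d ≤ ∣ c ∣
    d≤weight c c∈ ≢0 = subst (λ k → 4 * k + 4 ≤ ∣ c ∣) ([24m+16]/24 m) (proj₂ (proj₂ (proj₂ ext)) c c∈ ≢0)

    minimalWord : ∃ λ c → c ∈C C × ∣ c ∣ ≡ d
    minimalWord with c , c∈ , _ , e ← proj₁ (proj₂ (proj₂ ext)) = c , c∈ , trans e (cong (λ k → 4 * k + 4) ([24m+16]/24 m))

    d≡4* : d ≡ 4 * suc m
    d≡4* = ring m
      where
      ring : ∀ m → 4 * m + 4 ≡ 4 * suc m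
      ring = NS.solve-∀

    weight-form : ∀ c → c ∈C C → ∣ c ∣ ≡ 0 ⊎ (∃ λ k → ∣ c ∣ ≡ 4 * (suc m + k))
    weight-form c c∈ with ∣ c ∣ ℕ.≟ 0
    ... | yes e = inj₁ e
    ... | no ≢0 = inj₂ (quarter (isDoublyEven c c∈) (subst (_≤ ∣ c ∣) d≡4* (d≤weight c c∈ ≢0)))
      where
      quarter : ∀ {w} → Div4 w → 4 * suc m ≤ w → ∃ λ k → w ≡ 4 * (suc m + k)
      quarter (div4 k) p = k ∸ suc m , cong (4 *_) (sym (ℕₚ.m+[n∸m]≡n {suc m} {k} (ℕₚ.*-cancelˡ-≤ {suc m} {k} 4 p)))

    gapped : Gapped C d
    gapped = record
      { selfDual = isSelfDual
      ; d>0 = subst (0 <_) (sym d≡4*) (s≤s z≤n)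
      ; gap = gap }
      where
      gap : ∀ y → y ∈C C → ∣ y ∣ ≡ 0 ⊎ ∣ y ∣ ≡ d ⊎ 4 + d ≤ ∣ y ∣
      gap y y∈ with weight-form y y∈
      ... | inj₁ e = inj₁ e
      ... | inj₂ (zero , e) = inj₂ (inj₁ (trans e (trans (cong (4 *_) (ℕₚ.+-identityʳ (suc m))) (sym d≡4*))))
      ... | inj₂ (suc k , e) = inj₂ (inj₂ (subst (4 + d ≤_) (trans (ring m k) (sym e)) (ℕₚ.m≤m+n (4 + d) (4 * k))))
        where
        ring : ∀ m k → 4 + (4 * m + 4) + 4 * k ≡ 4 * (suc m + suc k)
        ring = NS.solve-∀

    -- The weight bound applies to a codeword and to its complement, so besides the two trivial
    -- words the number of zeros runs through d, d + 4, ..., n - d, which are 4m + 3 values.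
    node-form : ∀ c → c ∈C C → ∣ c ∣ ≡ 0 ⊎ ∣ c ∣ ≡ 24 * m + 16 ⊎ (∃ λ i → i ≤ 4 * m + 2 × zeros c ≡ d + 4 * i)
    node-form c c∈ with weight-form c c∈ | weight-form (comp c) (trans (C-comp isSelfDual isDoublyEven c) c∈)
    ... | inj₁ e       | _            = inj₁ e
    ... | inj₂ _       | inj₁ e′      = inj₂ (inj₁ (trans (cong (_+ ∣ c ∣) (sym (trans (sym (weight-comp c)) e′))) (zeros+weight c)))
    ... | inj₂ (k , e) | inj₂ (i , e′) = inj₂ (inj₂ (i , bound , trans z (ring m i)))
      where
      z : zeros c ≡ 4 * (suc m + i)
      z = trans (sym (weight-comp c)) e′
      ring : ∀ m i → 4 * (suc m + i) ≡ 4 * m + 4 + 4 * i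
      ring = NS.solve-∀
      ring₁ : ∀ m i k → 4 * (suc m + i) + 4 * (suc m + k) ≡ 8 * m + 8 + 4 * (i + k)
      ring₁ = NS.solve-∀
      ring₂ : ∀ m → 24 * m + 16 ≡ 8 * m + 8 + 4 * (4 * m + 2)
      ring₂ = NS.solve-∀
      i+k : i + k ≡ 4 * m + 2
      i+k = ℕₚ.*-cancelˡ-≡ (i + k) (4 * m + 2) 4 (ℕₚ.+-cancelˡ-≡ (8 * m + 8) _ _ (begin
        8 * m + 8 + 4 * (i + k)                  ≡⟨ ring₁ m i k ⟨
        4 * (suc m + i) + 4 * (suc m + k)        ≡⟨ cong₂ _+_ (sym z) (sym e) ⟩
        zeros c + ∣ c ∣                          ≡⟨ zeros+weight c ⟩
        24 * m + 16                              ≡⟨ ring₂ m ⟩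
        8 * m + 8 + 4 * (4 * m + 2) ∎))
      bound : i ≤ 4 * m + 2
      bound = subst (i ≤_) i+k (ℕₚ.m≤m+n i k)

    size-value : size C ≡ + (2 ℕ.^ (12 * m + 8))
    size-value = size-half {k = 12 * m + 8} isSelfDual (ring m)
      where
      ring : ∀ m → 24 * m + 16 ≡ 12 * m + 8 + (12 * m + 8)
      ring = NS.solve-∀

-- Profiles of minimum weight words in the binomial basis.

module Profiles where
  open WordSums
  open Incidence
  open Designs
  open Complements
  open RootPolynomials
  open Moments
  open Progressions
  open ExtremalCodes
  open import Data.Nat as ℕ using (ℕ; zero; suc; s≤s; _^_)
  import Data.Nat.Properties as ℕₚ
  open import Data.Nat.Combinatorics using () renaming (_C_ to _choose_)
  open import Data.Integer using (ℤ; +_; 0ℤ; 1ℤ; -1ℤ; _+_; _*_; _-_; -_)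
  open import Data.Integer.Properties
  open import Data.Integer.Tactic.RingSolver using (solve-∀)
  open import Relation.Binary.PropositionalEquality
  open ≡-Reasoning

  sgnPow-+ : ∀ a b → sgnPow (a ℕ.+ b) ≡ sgnPow a * sgnPow b
  sgnPow-+ zero    b = sym (*-identityˡ _)
  sgnPow-+ (suc a) b = trans (cong (-1ℤ *_) (sgnPow-+ a b)) (sym (*-assoc -1ℤ (sgnPow a) (sgnPow b)))

  sgnPow-4* : ∀ k → sgnPow (4 ℕ.* k) ≡ 1ℤ
  sgnPow-4* zero    = refl
  sgnPow-4* (suc k) = trans (cong sgnPow (ℕₚ.*-suc 4 k)) (trans (cong (λ x → -1ℤ * (-1ℤ * (-1ℤ * (-1ℤ * x)))) (sgnPow-4* k)) refl)

  -- A coefficient of (2 + x)^(b + 1); the shift of the exponent, here and in `H-2`, avoids powers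
  -- of 2 with truncated exponents.
  H-1 : ∀ b → H (suc b) 1 ≡ + (2 ^ b) * + suc b
  H-1 zero    = refl
  H-1 (suc b) = begin
    + 2 * H (suc b) 1 + H (suc b) 0                     ≡⟨ cong₂ (λ u v → + 2 * u + v) (H-1 b) (trans (H-0 (suc b)) (pos-* 2 (2 ^ b))) ⟩
    + 2 * (+ (2 ^ b) * + suc b) + + 2 * + (2 ^ b)       ≡⟨ ring (+ (2 ^ b)) (+ suc b) ⟩
    + 2 * + (2 ^ b) * (1ℤ + + suc b)                    ≡⟨ cong (_* + suc (suc b)) (sym (pos-* 2 (2 ^ b))) ⟩
    + (2 ^ suc b) * + suc (suc b) ∎
    where
    ring : ∀ x y → + 2 * (x * y) + + 2 * x ≡ + 2 * x * (1ℤ + y)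
    ring = solve-∀

  H-2 : ∀ b → H (suc (suc b)) 2 ≡ + (2 ^ b) * + (suc (suc b) choose 2)
  H-2 zero    = refl
  H-2 (suc b) = begin
    + 2 * H (suc (suc b)) 2 + H (suc (suc b)) 1
      ≡⟨ cong₂ (λ u v → + 2 * u + v) (H-2 b) (trans (H-1 (suc b)) (cong (_* + suc (suc b)) (pos-* 2 (2 ^ b)))) ⟩
    + 2 * (+ (2 ^ b) * + (suc (suc b) choose 2)) + + 2 * + (2 ^ b) * + suc (suc b)
      ≡⟨ ring (+ (2 ^ b)) (+ (suc (suc b) choose 2)) (+ suc (suc b)) ⟩
    + 2 * + (2 ^ b) * (+ suc (suc b) + + (suc (suc b) choose 2))
      ≡⟨ cong₂ _*_ (sym (pos-* 2 (2 ^ b))) (trans (cong (λ k → + k + + (suc (suc b) choose 2)) (sym (nC1≡n (suc (suc b))))) (sym (pascal (suc (suc b)) 1))) ⟩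
    + (2 ^ suc b) * + (suc (suc (suc b)) choose 2) ∎
    where
    open import Data.Nat.Combinatorics using (nC1≡n)
    ring : ∀ x y z → + 2 * (x * y) + + 2 * x * z ≡ + 2 * x * (z + y)
    ring = solve-∀

  -- `sixth`, `fifth` and `fourth` are the finite differences of the profile at 0, obtained from its
  -- values at i = 4, 5, 6. Only `sixth` survives later: the sums of the lower binomials are fixed
  -- by balance below strength six.
  sixth : ℕ → ℕ → ℤ
  sixth zero          b = + (2 ^ b) * + 4
  sixth (suc zero)    b = + (2 ^ b) * (+ 2 * + (8 ℕ.+ b))
  sixth (suc (suc _)) b = + (2 ^ b) * + ((2 ℕ.+ b) choose 2 ℕ.+ 6 ℕ.* (2 ℕ.+ b) ℕ.+ 9)

  fifth : ℕ → ℕ → ℤ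
  fifth zero          b = 0ℤ
  fifth (suc zero)    b = - (+ (2 ^ b) * + 2)
  fifth (suc (suc _)) b = - (+ (2 ^ b) * + (6 ℕ.+ b))

  fourth : ℕ → ℕ → ℤ
  fourth (suc (suc _)) b = + (2 ^ b)
  fourth _             b = 0ℤ

  combo₀ : ∀ x y z → 0ℤ ≡ x * 0ℤ + (y * 0ℤ + z * 0ℤ)
  combo₀ = solve-∀

  combo₄ : ∀ x y z → z ≡ x * 0ℤ + (y * 0ℤ + z * 1ℤ)
  combo₄ = solve-∀

  combo₅ : ∀ x y z → y + + 5 * z ≡ x * 0ℤ + (y * 1ℤ + z * + 5)
  combo₅ = solve-∀

  combo₆ : ∀ x y z → x + + 6 * y + + 15 * z ≡ x * 1ℤ + (y * + 6 + z * + 15)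
  combo₆ = solve-∀

  -- Newton's interpolation of the profile in the binomial basis; its lower coefficients vanish for s ≤ 2.
  profile-newton : ∀ b s i → s ℕ.≤ 2 → i ℕ.≤ 6 →
    profile 6 (2 ℕ.+ b) s i ≡ sixth s b * + (i choose 6) + (fifth s b * + (i choose 5) + fourth s b * + (i choose 4))
  profile-newton b 0 0 _ _ = combo₀ (sixth 0 b) (fifth 0 b) (fourth 0 b)
  profile-newton b 0 1 _ _ = combo₀ (sixth 0 b) (fifth 0 b) (fourth 0 b)
  profile-newton b 0 2 _ _ = combo₀ (sixth 0 b) (fifth 0 b) (fourth 0 b)
  profile-newton b 0 3 _ _ = combo₀ (sixth 0 b) (fifth 0 b) (fourth 0 b)
  profile-newton b 0 4 _ _ = combo₄ (sixth 0 b) (fifth 0 b) (fourth 0 b)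
  profile-newton b 0 5 _ _ = combo₅ (sixth 0 b) (fifth 0 b) (fourth 0 b)
  profile-newton b 0 6 _ _ = trans (trans (*-identityˡ _) (trans (cong (λ x → + 2 * (+ 2 * x)) (H-0 b)) (ring (+ (2 ^ b))))) (combo₆ (sixth 0 b) 0ℤ 0ℤ)
    where
    ring : ∀ x → + 2 * (+ 2 * x) ≡ x * + 4 + + 6 * 0ℤ + + 15 * 0ℤ
    ring = solve-∀
  profile-newton b 1 0 _ _ = combo₀ (sixth 1 b) (fifth 1 b) (fourth 1 b)
  profile-newton b 1 1 _ _ = combo₀ (sixth 1 b) (fifth 1 b) (fourth 1 b)
  profile-newton b 1 2 _ _ = combo₀ (sixth 1 b) (fifth 1 b) (fourth 1 b)
  profile-newton b 1 3 _ _ = combo₀ (sixth 1 b) (fifth 1 b) (fourth 1 b)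
  profile-newton b 1 4 _ _ = combo₄ (sixth 1 b) (fifth 1 b) (fourth 1 b)
  profile-newton b 1 5 _ _ = trans (cong (λ x → -1ℤ * (+ 2 * x)) (H-0 b)) (trans (ring (+ (2 ^ b))) (combo₅ (sixth 1 b) (fifth 1 b) 0ℤ))
    where
    ring : ∀ x → -1ℤ * (+ 2 * x) ≡ - (x * + 2) + + 5 * 0ℤ
    ring = solve-∀
  profile-newton b 1 6 _ _ = trans (cong (1ℤ *_) (trans (H-1 (suc b)) (cong (_* + suc (suc b)) (pos-* 2 (2 ^ b)))))
    (trans (ring (+ (2 ^ b)) (+ b)) (combo₆ (sixth 1 b) (fifth 1 b) 0ℤ))
    where
    ring : ∀ x b → 1ℤ * (+ 2 * x * (+ 2 + b)) ≡ x * (+ 2 * (+ 8 + b)) + + 6 * (- (x * + 2)) + + 15 * 0ℤ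
    ring = solve-∀
  profile-newton b 2 0 _ _ = combo₀ (sixth 2 b) (fifth 2 b) (fourth 2 b)
  profile-newton b 2 1 _ _ = combo₀ (sixth 2 b) (fifth 2 b) (fourth 2 b)
  profile-newton b 2 2 _ _ = combo₀ (sixth 2 b) (fifth 2 b) (fourth 2 b)
  profile-newton b 2 3 _ _ = combo₀ (sixth 2 b) (fifth 2 b) (fourth 2 b)
  profile-newton b 2 4 _ _ = trans (trans (*-identityˡ _) (H-0 b)) (combo₄ (sixth 2 b) (fifth 2 b) (fourth 2 b))
  profile-newton b 2 5 _ _ = trans (cong (-1ℤ *_) (H-1 b)) (trans (ring (+ (2 ^ b)) (+ b)) (combo₅ (sixth 2 b) (fifth 2 b) (fourth 2 b)))
    where
    ring : ∀ x b → -1ℤ * (x * (1ℤ + b)) ≡ - (x * (+ 6 + b)) + + 5 * x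
    ring = solve-∀
  profile-newton b 2 6 _ _ = trans (cong (1ℤ *_) (H-2 b)) (trans (ring (+ (2 ^ b)) (+ b) (+ ((2 ℕ.+ b) choose 2)))
    (trans (cong (λ x → + (2 ^ b) * x + + 6 * (- (+ (2 ^ b) * (+ 6 + + b))) + + 15 * + (2 ^ b))
      (cong (λ x → + ((2 ℕ.+ b) choose 2) + x + + 9) (sym (pos-* 6 (2 ℕ.+ b)))))
    (combo₆ (sixth 2 b) (fifth 2 b) (fourth 2 b))))
    where
    ring : ∀ x b c → 1ℤ * (x * c) ≡ x * (c + + 6 * (+ 2 + b) + + 9) + + 6 * (- (x * (+ 6 + b))) + + 15 * x
    ring = solve-∀
  profile-newton b (suc (suc (suc s))) i (s≤s (s≤s ())) _
  profile-newton b s (suc (suc (suc (suc (suc (suc (suc i))))))) _ (s≤s (s≤s (s≤s (s≤s (s≤s (s≤s ()))))))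

-- From sums over the code to sums over a few weights.

module NodeSums where
  open WordSums
  open Incidence
  open Designs
  open Complements
  open RootPolynomials
  open Moments
  open Progressions
  open ExtremalCodes
  open Profiles
  open import Data.Bool using (true; false; _∧_; T)
  open import Data.Nat as ℕ using (ℕ; suc; _∸_; _≡ᵇ_)
  import Data.Nat.Properties as ℕₚ
  import Data.Nat.Tactic.RingSolver as NS
  open import Data.Integer using (ℤ; +_; 0ℤ; 1ℤ; _+_; _*_; _-_; -_)
  open import Data.Integer.Properties
  open import Data.Integer.Tactic.RingSolver using (solve-∀)
  open import Data.List using ([]; _∷_)
  open import Data.List.Membership.Propositional using (_∈_; _∉_)
  open import Data.List.Membership.DecPropositional ℕ._≟_ using (_∈?_)
  open import Data.List.Relation.Unary.All as All using (All; []; _∷_)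
  open import Data.List.Relation.Unary.AllPairs using ([]; _∷_)
  open import Data.List.Relation.Unary.Unique.Propositional using (Unique)
  open import Data.Fin.Subset using (∣_∣)
  open import Data.Vec using ([]; _∷_)
  open import Data.Product using (_,_)
  open import Data.Sum using (_⊎_; inj₁; inj₂)
  open import Relation.Nullary using (yes; no)
  open import Relation.Binary.PropositionalEquality
  open ≡-Reasoning

  no-zeros-⊑ : ∀ {n} (T c : Word n) → zeros c ≡ 0 → T ⊑ c ≡ true
  no-zeros-⊑ []          []         _ = refl
  no-zeros-⊑ (true ∷ T)  (true ∷ c) e = no-zeros-⊑ T c e
  no-zeros-⊑ (false ∷ T) (true ∷ c) e = no-zeros-⊑ T c e

  module _ (m : ℕ) {C : Code (24 ℕ.* m ℕ.+ 16)} (ext : ExtremalDoublyEvenSelfDual C) where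
    private
      n = 24 ℕ.* m ℕ.+ 16
      d₀ = 4 ℕ.* m ℕ.+ 4
      P = 4 ℕ.* m ℕ.+ 2
      g = gapped m ext

    -- Numbers of zeros, not weights: index `P` belongs to the minimum weight d and index 0 to the
    -- weight n - d.
    node : ℕ → ℕ
    node i = d₀ ℕ.+ 4 ℕ.* i

    nodeWeight : ℕ → ℕ
    nodeWeight i = n ∸ node i

    nodeBlock : ℕ → Word n → ℤ
    nodeBlock i = block C (nodeWeight i)

    node≤n : ∀ {i} → i ℕ.≤ P → node i ℕ.≤ n
    node≤n {i} i≤P = ℕₚ.≤-trans (ℕₚ.+-monoʳ-≤ d₀ (ℕₚ.*-monoʳ-≤ 4 i≤P)) (subst (node P ℕ.≤_) (ring m) (ℕₚ.m≤m+n (node P) d₀))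
      where
      ring : ∀ m → 4 ℕ.* m ℕ.+ 4 ℕ.+ 4 ℕ.* (4 ℕ.* m ℕ.+ 2) ℕ.+ (4 ℕ.* m ℕ.+ 4) ≡ 24 ℕ.* m ℕ.+ 16
      ring = NS.solve-∀

    nodeWeight-P : nodeWeight P ≡ d₀
    nodeWeight-P = trans (cong (_∸ node P) (ring m)) (ℕₚ.m+n∸m≡n (node P) d₀)
      where
      ring : ∀ m → 24 ℕ.* m ℕ.+ 16 ≡ 4 ℕ.* m ℕ.+ 4 ℕ.+ 4 ℕ.* (4 ℕ.* m ℕ.+ 2) ℕ.+ (4 ℕ.* m ℕ.+ 4)
      ring = NS.solve-∀

    -- The all-one word contains both sets and the zero word neither, since their size is positive;
    -- so both drop out of the difference. The nodes outside `E` are removed by the zeros of `q`.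
    node-sum : ∀ T T′ {t} → ∣ T ∣ ≡ suc t → ∣ T′ ∣ ≡ suc t → ∀ (q : ℤ → ℤ) E → Unique E → All (ℕ._≤ P) E →
      (∀ i → i ℕ.≤ P → i ∉ E → q (+ node i) ≡ 0ℤ) →
      Σw (λ c → weighing g T T′ c * q (+ zeros c)) ≡ sumOver E (λ i → q (+ node i) * imbalance (nodeBlock i) T T′)
    node-sum T T′ T-size T′-size q E uniq bounded vanish = begin
      Σw (λ c → weighing g T T′ c * q (+ zeros c))
        ≡⟨ Σw-cong pointwise ⟩
      Σw (λ c → sumOver E (λ i → q (+ node i) * (nodeBlock i c * x c)))
        ≡⟨ Σw-sumOver E (λ i c → q (+ node i) * (nodeBlock i c * x c)) ⟩
      sumOver E (λ i → Σw (λ c → q (+ node i) * (nodeBlock i c * x c)))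
        ≡⟨ sumOver-cong E (λ i → trans (Σw-* (q (+ node i)) (λ c → nodeBlock i c * x c)) (cong (q (+ node i) *_)
             (trans (Σw-cong (λ c → *-distribˡ-- (nodeBlock i c) ⟦ T ⊑ c ⟧ ⟦ T′ ⊑ c ⟧)) (Σw-- (λ c → nodeBlock i c * ⟦ T ⊑ c ⟧) (λ c → nodeBlock i c * ⟦ T′ ⊑ c ⟧))))) ⟩
      sumOver E (λ i → q (+ node i) * imbalance (nodeBlock i) T T′) ∎
      where
      x : Word n → ℤ
      x c = ⟦ T ⊑ c ⟧ - ⟦ T′ ⊑ c ⟧
      *-distribˡ-- : ∀ a b c → a * (b - c) ≡ a * b - a * c
      *-distribˡ-- = solve-∀
      sumOver-cong : ∀ E {f f′ : ℕ → ℤ} → (∀ i → f i ≡ f′ i) → sumOver E f ≡ sumOver E f′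
      sumOver-cong []      h = refl
      sumOver-cong (i ∷ E) h = cong₂ _+_ (h i) (sumOver-cong E h)
      x-full : ∀ c → ∣ c ∣ ≡ n → x c ≡ 0ℤ
      x-full c e = cong₂ (λ a b → ⟦ a ⟧ - ⟦ b ⟧) (no-zeros-⊑ T c none) (no-zeros-⊑ T′ c none)
        where
        none : zeros c ≡ 0
        none = ℕₚ.+-cancelʳ-≡ ∣ c ∣ (zeros c) 0 (trans (zeros+weight c) (sym e))
      x-empty : ∀ c → ∣ c ∣ ≡ 0 → x c ≡ 0ℤ
      x-empty c e = cong₂ (λ a b → ⟦ a ⟧ - ⟦ b ⟧) (not⊑ T T-size) (not⊑ T′ T′-size)
        where
        not⊑ : ∀ T {t} → ∣ T ∣ ≡ suc t → T ⊑ c ≡ false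
        not⊑ T T-size with T ⊑ c in e′
        ... | false = refl
        ... | true  with () ← subst₂ ℕ._≤_ T-size e (⊑-size T c e′)
      vanishes : ∀ c → x c ≡ 0ℤ → ⟦ C c ⟧ * x c * q (+ zeros c) ≡ sumOver E (λ i → q (+ node i) * (nodeBlock i c * x c))
      vanishes c e = trans (cong (λ y → ⟦ C c ⟧ * y * q (+ zeros c)) e) (trans (cong (_* q (+ zeros c)) (*-zeroʳ ⟦ C c ⟧))
        (sym (sumOver-0 E (λ i _ → trans (cong (λ y → q (+ node i) * (nodeBlock i c * y)) e)
          (trans (cong (q (+ node i) *_) (*-zeroʳ (nodeBlock i c))) (*-zeroʳ (q (+ node i))))))))
      pointwise : ∀ c → ⟦ C c ⟧ * x c * q (+ zeros c) ≡ sumOver E (λ i → q (+ node i) * (nodeBlock i c * x c))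
      pointwise c = go (C c) refl
        where
        blockOff : ∀ i → C c ≡ false → nodeBlock i c ≡ 0ℤ
        blockOff i e = cong (λ b → ⟦ b ∧ (∣ c ∣ ≡ᵇ nodeWeight i) ⟧) e
        go : ∀ b → C c ≡ b → ⟦ C c ⟧ * x c * q (+ zeros c) ≡ sumOver E (λ i → q (+ node i) * (nodeBlock i c * x c))
        go false e = trans (cong (λ b → ⟦ b ⟧ * x c * q (+ zeros c)) e)
          (sym (sumOver-0 E (λ i _ → trans (cong (λ y → q (+ node i) * (y * x c)) (blockOff i e)) (*-zeroʳ (q (+ node i))))))
        go true c∈ with node-form m ext c c∈
        ... | inj₁ e = vanishes c (x-empty c e)
        ... | inj₂ (inj₁ e) = vanishes c (x-full c e)
        ... | inj₂ (inj₂ (i₀ , i₀≤P , z≡)) = sym (trans (sumOver-single uniq others member) here-value)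
          where
          weight≡ : ∣ c ∣ ≡ nodeWeight i₀
          weight≡ = trans (sym (ℕₚ.m+n∸m≡n (zeros c) ∣ c ∣)) (cong₂ _∸_ (zeros+weight c) z≡)
          f : ℕ → ℤ
          f i = q (+ node i) * (nodeBlock i c * x c)
          others : ∀ i → i ∈ E → i ≢ i₀ → f i ≡ 0ℤ
          others i i∈ i≢ = trans (cong (λ y → q (+ node i) * (y * x c)) (block-ofWeight C (nodeWeight i) c (λ e →
            i≢ (node-injective d₀ (ℕₚ.∸-cancelˡ-≡ (node≤n (All.lookup bounded i∈)) (node≤n i₀≤P) (trans (sym e) weight≡))))))
            (*-zeroʳ (q (+ node i)))
          member : i₀ ∈ E ⊎ f i₀ ≡ 0ℤ
          member with i₀ ∈? E
          ... | yes i∈ = inj₁ i∈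
          ... | no i∉  = inj₂ (trans (cong (_* (nodeBlock i₀ c * x c)) (vanish i₀ i₀≤P i∉)) (*-zeroˡ (nodeBlock i₀ c * x c)))
          here-value : f i₀ ≡ ⟦ C c ⟧ * x c * q (+ zeros c)
          here-value = begin
            q (+ node i₀) * (nodeBlock i₀ c * x c)
              ≡⟨ cong₂ (λ z b → q (+ z) * (b * x c)) (sym z≡) on ⟩
            q (+ zeros c) * (1ℤ * x c)
              ≡⟨ *-comm (q (+ zeros c)) _ ⟩
            1ℤ * x c * q (+ zeros c)
              ≡⟨ cong (λ b → ⟦ b ⟧ * x c * q (+ zeros c)) (sym c∈) ⟩
            ⟦ C c ⟧ * x c * q (+ zeros c) ∎
            where
            on : nodeBlock i₀ c ≡ 1ℤ
            on = cong₂ (λ a b → ⟦ a ∧ b ⟧) c∈ (≡ᵇ-⇔ {0} {0} (λ _ → weight≡) (λ _ → refl))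

-- The minimum weight words up to strength three.

module StrengthThree where
  open WordSums
  open Incidence
  open Designs
  open Complements
  open RootPolynomials
  open Moments
  open Progressions
  open ExtremalCodes
  open Profiles
  open NodeSums
  open import Data.Bool using (T)
  open import Data.Nat as ℕ using (ℕ; zero; suc; z≤n; s≤s; _∸_; _!; _^_)
  import Data.Nat.Properties as ℕₚ
  import Data.Nat.Tactic.RingSolver as NS
  open import Data.Integer using (ℤ; +_; 0ℤ; -1ℤ; _+_; _*_; _-_; -_)
  open import Data.Integer.Properties
  open import Data.Integer.Tactic.RingSolver using (solve-∀)
  open import Data.List using (List; []; _∷_; _++_; length)
  import Data.List.Properties as Listₚ
  open import Data.List.Membership.Propositional using (_∉_)
  open import Data.List.Relation.Unary.Any using (here; there)
  open import Data.List.Relation.Unary.All as All using (All; []; _∷_)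
  open import Data.List.Relation.Unary.AllPairs using ([]; _∷_)
  open import Data.List.Relation.Unary.Unique.Propositional using (Unique)
  open import Data.Fin.Subset using (∣_∣)
  open import Data.Vec using ([]; _∷_)
  open import Data.Product using (∃; _,_; proj₁; proj₂)
  open import Data.Sum using (inj₁; inj₂)
  open import Data.Empty using (⊥-elim)
  open import Relation.Binary.PropositionalEquality
  open ≡-Reasoning

  Positive : List ℕ → ℕ → Set
  Positive R z = ∃ λ x → rootPoly R (+ z) ≡ + suc x

  Alternating : List ℕ → ℕ → Set
  Alternating R z = ∃ λ x → rootPoly R (+ z) ≡ sgnPow (length R) * + suc x

  suc*suc : ∀ x y → + suc x * + suc y ≡ + suc (y ℕ.+ x ℕ.* suc y)
  suc*suc x y = sym (pos-* (suc x) (suc y))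

  positive-++ : ∀ {R S z} → Positive R z → Positive S z → Positive (R ++ S) z
  positive-++ {R} {S} {z} (x , e) (y , e′) =
    y ℕ.+ x ℕ.* suc y , trans (rootPoly-++ R S (+ z)) (trans (cong₂ _*_ e e′) (suc*suc x y))

  alternating-++ : ∀ {R S z} → Alternating R z → Alternating S z → Alternating (R ++ S) z
  alternating-++ {R} {S} {z} (x , e) (y , e′) = y ℕ.+ x ℕ.* suc y , (begin
    rootPoly (R ++ S) (+ z)
      ≡⟨ trans (rootPoly-++ R S (+ z)) (cong₂ _*_ e e′) ⟩
    sgnPow (length R) * + suc x * (sgnPow (length S) * + suc y)
      ≡⟨ ring (sgnPow (length R)) (+ suc x) (sgnPow (length S)) (+ suc y) ⟩
    sgnPow (length R) * sgnPow (length S) * (+ suc x * + suc y)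
      ≡⟨ cong₂ _*_ (trans (sym (sgnPow-+ (length R) (length S))) (cong sgnPow (sym (Listₚ.length-++ R)))) (suc*suc x y) ⟩
    sgnPow (length (R ++ S)) * + suc (y ℕ.+ x ℕ.* suc y) ∎)
    where
    ring : ∀ a x b y → a * x * (b * y) ≡ a * b * (x * y)
    ring = solve-∀

  progression-alternating : ∀ a k z → z ℕ.< a → Alternating (progression a k) z
  progression-alternating a k z p with x , e ← below a k z p =
    x , trans e (cong (λ l → sgnPow l * + suc x) (sym (length-progression a k)))

  sgnPow-odd : ∀ k → sgnPow (4 ℕ.* k ℕ.+ 1) ≡ -1ℤ
  sgnPow-odd k = trans (sgnPow-+ (4 ℕ.* k) 1) (cong (_* -1ℤ) (sgnPow-4* k))

  positive-multiple : ∀ {x y} δ → y ≡ + suc x → y * δ ≡ 0ℤ → δ ≡ 0ℤ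
  positive-multiple {x} {y} δ e p with i*j≡0⇒i≡0∨j≡0 y p
  ... | inj₂ δ≡0 = δ≡0
  ... | inj₁ y≡0 with () ← trans (sym e) y≡0

  module _ (m : ℕ) {C : Code (24 ℕ.* m ℕ.+ 16)} (ext : ExtremalDoublyEvenSelfDual C) where
    private
      n = 24 ℕ.* m ℕ.+ 16
      d₀ = 4 ℕ.* m ℕ.+ 4
      P = 4 ℕ.* m ℕ.+ 2
      g = gapped m ext
      K = 2 ^ (12 ℕ.* m ℕ.+ 8)
      nd = node m ext
      nb = nodeBlock m ext

    minBlock : Word n → ℤ
    minBlock = block C d₀

    K*-cancel : ∀ x y → size C * x ≡ + K * y → x ≡ y
    K*-cancel x y e = *-cancelˡ-≡ (+ K) x y {{ℕₚ.m^n≢0 2 (12 ℕ.* m ℕ.+ 8)}} (trans (cong (_* x) (sym (size-value m ext))) e)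

    weighingMoment : Word n → Word n → ℕ → ℤ
    weighingMoment T T′ = moment (λ c → + zeros c) (weighing g T T′)

    weighing-low : ∀ T T′ j → ∣ T ∣ ≡ ∣ T′ ∣ → ∣ T ∣ ℕ.+ j ℕ.< d₀ → weighingMoment T T′ j ≡ 0ℤ
    weighing-low T T′ j e p = trans (moment-weighing g T T′ j)
      (trans (cong (+ (j !) *_) (K*-cancel (coverSum C T j - coverSum C T′ j) 0ℤ (trans (coverSum-low g T T′ j e p) (sym (*-zeroʳ (+ K)))))) (*-zeroʳ (+ (j !))))

    pow-split : ∀ {k} a b → k ≡ a ℕ.+ b → + (2 ^ k) ≡ + (2 ^ a) * + (2 ^ b)
    pow-split a b e = trans (cong (λ k → + (2 ^ k)) e) (trans (cong +_ (ℕₚ.^-distribˡ-+-* 2 a b)) (pos-* (2 ^ a) (2 ^ b)))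

    n∸d : n ∸ d₀ ≡ 20 ℕ.* m ℕ.+ 12
    n∸d = trans (cong (_∸ d₀) (ring m)) (ℕₚ.m+n∸m≡n d₀ (20 ℕ.* m ℕ.+ 12))
      where
      ring : ∀ m → 24 ℕ.* m ℕ.+ 16 ≡ 4 ℕ.* m ℕ.+ 4 ℕ.+ (20 ℕ.* m ℕ.+ 12)
      ring = NS.solve-∀

    -- A minimum weight word containing `T` has transform (-1)^t 2^(n - d); dividing 2^(20m + 12) by
    -- the code size 2^(12m + 8) leaves 2^(8m + 4).
    weighing-top : ∀ T T′ j t → ∣ T ∣ ≡ t → ∣ T′ ∣ ≡ t → j ℕ.+ t ≡ d₀ →
      weighingMoment T T′ j ≡ + (j !) * (sgnPow t * + (2 ^ (8 ℕ.* m ℕ.+ 4)) * imbalance minBlock T T′)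
    weighing-top T T′ j t T-size T′-size e = trans (moment-weighing g T T′ j) (cong (+ (j !) *_) (K*-cancel _ _ (begin
      size C * (coverSum C T j - coverSum C T′ j)
        ≡⟨ coverSum-high g T T′ j t 0 T-size T′-size (trans e (sym (ℕₚ.+-identityʳ d₀))) (s≤s z≤n) ⟩
      profileSum g t 0 T - profileSum g t 0 T′
        ≡⟨ cong₂ _-_ (profileSum-0 g t T T-size) (profileSum-0 g t T′ T′-size) ⟩
      sgnPow t * + (2 ^ (n ∸ d₀)) * covering minBlock T - sgnPow t * + (2 ^ (n ∸ d₀)) * covering minBlock T′
        ≡⟨ cong (λ x → sgnPow t * x * covering minBlock T - sgnPow t * x * covering minBlock T′)
             (pow-split (12 ℕ.* m ℕ.+ 8) (8 ℕ.* m ℕ.+ 4) (trans n∸d (ring m))) ⟩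
      sgnPow t * (+ K * X) * covering minBlock T - sgnPow t * (+ K * X) * covering minBlock T′
        ≡⟨ factor (sgnPow t) (+ K) X (covering minBlock T) (covering minBlock T′) ⟩
      + K * (sgnPow t * X * imbalance minBlock T T′) ∎)))
      where
      X = + (2 ^ (8 ℕ.* m ℕ.+ 4))
      ring : ∀ m → 20 ℕ.* m ℕ.+ 12 ≡ 12 ℕ.* m ℕ.+ 8 ℕ.+ (8 ℕ.* m ℕ.+ 4)
      ring = NS.solve-∀
      factor : ∀ s k x a b → s * (k * x) * a - s * (k * x) * b ≡ k * (s * x * (a - b))
      factor = solve-∀

    BalancedBelow : ℕ → Set
    BalancedBelow t = ∀ s → s ℕ.< t → Balanced minBlock s

    imb : ℕ → Word n → Word n → ℤ
    imb i = imbalance (nb i)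

    imb-P : ∀ T T′ → imb P T T′ ≡ imbalance minBlock T T′
    imb-P T T′ = cong (λ w → imbalance (block C w) T T′) (nodeWeight-P m ext)

    -- The words at node 0 are the complements of the minimum weight words.
    imb-0 : ∀ t → suc t ℕ.≤ 6 → BalancedBelow (suc t) → ∀ T T′ → ∣ T ∣ ≡ suc t → ∣ T′ ∣ ≡ suc t →
      imb 0 T T′ ≡ sgnPow (suc t) * imbalance minBlock T T′
    imb-0 t t<6 bal = complement-imbalance {X = minBlock} {X′ = nb 0} t (block-comp (isSelfDual m ext) (isDoublyEven m ext) sum) t<n (λ s s≤t → bal s (s≤s s≤t))
      where
      t<n : t ℕ.< n
      t<n = ℕₚ.≤-trans t<6 (ℕₚ.≤-trans (ℕₚ.m≤m+n 6 10) (ℕₚ.m≤n+m 16 (24 ℕ.* m)))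
      sum : d₀ ℕ.+ nodeWeight m ext 0 ≡ n
      sum = trans (cong (λ k → d₀ ℕ.+ (n ∸ k)) (ℕₚ.+-identityʳ d₀))
        (ℕₚ.m+[n∸m]≡n (subst (ℕ._≤ n) (ℕₚ.+-identityʳ d₀) (node≤n m ext {0} z≤n)))

    node-low : ∀ T T′ {t} → ∣ T ∣ ≡ suc t → ∣ T′ ∣ ≡ suc t → ∀ R E → Unique E → All (ℕ._≤ P) E →
      (∀ i → i ℕ.≤ P → i ∉ E → rootPoly R (+ nd i) ≡ 0ℤ) → suc t ℕ.+ length R ℕ.< d₀ →
      sumOver E (λ i → rootPoly R (+ nd i) * imb i T T′) ≡ 0ℤ
    node-low T T′ {t} T-size T′-size R E u b v p = begin
      sumOver E (λ i → rootPoly R (+ nd i) * imb i T T′)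
        ≡⟨ node-sum m ext T T′ T-size T′-size (rootPoly R) E u b v ⟨
      Σw (λ c → weighing g T T′ c * rootPoly R (+ zeros c))
        ≡⟨ Σ-rootPoly (λ c → + zeros c) R (weighing g T T′) ⟩
      apply R (weighingMoment T T′) 0
        ≡⟨ apply-zero R (suc (length R)) (λ j j≤ → weighing-low T T′ j (trans T-size (sym T′-size))
             (subst (λ k → k ℕ.+ j ℕ.< d₀) (sym T-size) (ℕₚ.≤-<-trans (ℕₚ.+-monoʳ-≤ (suc t) (ℕ.s≤s⁻¹ j≤)) p))) 0 (ℕₚ.n<1+n _) ⟩
      0ℤ ∎

    -- One root more than `node-low` permits: the sum is no longer 0 but a known multiple of the
    -- same imbalance that appears at the end nodes.
    node-top : ∀ T T′ {t} → ∣ T ∣ ≡ suc t → ∣ T′ ∣ ≡ suc t → ∀ R E → Unique E → All (ℕ._≤ P) E →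
      (∀ i → i ℕ.≤ P → i ∉ E → rootPoly R (+ nd i) ≡ 0ℤ) → length R ℕ.+ suc t ≡ d₀ →
      sumOver E (λ i → rootPoly R (+ nd i) * imb i T T′)
        ≡ + (length R !) * (sgnPow (suc t) * + (2 ^ (8 ℕ.* m ℕ.+ 4)) * imbalance minBlock T T′)
    node-top T T′ {t} T-size T′-size R E u b v e = begin
      sumOver E (λ i → rootPoly R (+ nd i) * imb i T T′)
        ≡⟨ node-sum m ext T T′ T-size T′-size (rootPoly R) E u b v ⟨
      Σw (λ c → weighing g T T′ c * rootPoly R (+ zeros c))
        ≡⟨ Σ-rootPoly (λ c → + zeros c) R (weighing g T T′) ⟩
      apply R (weighingMoment T T′) 0
        ≡⟨ apply-top R (λ j j< → weighing-low T T′ j (trans T-size (sym T′-size))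
             (subst₂ (λ k l → k ℕ.+ j ℕ.< l) (sym T-size) (trans (ℕₚ.+-comm (suc t) (length R)) e) (ℕₚ.+-monoʳ-< (suc t) j<))) ⟩
      weighingMoment T T′ (length R)
        ≡⟨ weighing-top T T′ (length R) (suc t) T-size T′-size e ⟩
      + (length R !) * (sgnPow (suc t) * + (2 ^ (8 ℕ.* m ℕ.+ 4)) * imbalance minBlock T T′) ∎

    balanced-from : ∀ (X : Word n → ℤ) t → (∀ T T′ → ∣ T ∣ ≡ t → ∣ T′ ∣ ≡ t → imbalance X T T′ ≡ 0ℤ) → Balanced X t
    balanced-from X t h T T′ e e′ = i-j≡0⇒i≡j (covering X T) (covering X T′) (h T T′ e e′)

    imbalance-0 : ∀ (X : Word n → ℤ) {t} → Balanced X t → ∀ T T′ → ∣ T ∣ ≡ t → ∣ T′ ∣ ≡ t → imbalance X T T′ ≡ 0ℤ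
    imbalance-0 X bal T T′ e e′ = trans (cong (λ x → x - covering X T′) (bal T T′ e e′)) (+-inverseʳ (covering X T′))

    -- All nodes but the last serve as roots, and the degree 4m + 2 is still below d - 1.
    step₁ : Balanced minBlock 1
    step₁ = balanced-from minBlock 1 λ T T′ e e′ → positive-multiple (imbalance minBlock T T′) (proj₂ (above d₀ P (nd P) ℕₚ.≤-refl))
      (trans (trans (cong (rootPoly R (+ nd P) *_) (sym (imb-P T T′))) (sym (+-identityʳ _)))
        (node-low T T′ e e′ R (P ∷ []) ([] ∷ []) (ℕₚ.≤-refl ∷ []) vanish len))
      where
      R = progression d₀ P
      vanish : ∀ i → i ℕ.≤ P → i ∉ P ∷ [] → rootPoly R (+ nd i) ≡ 0ℤ
      vanish i i≤P i∉ = progression-root d₀ P i (ℕₚ.≤∧≢⇒< i≤P (λ e → i∉ (here e)))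
      ring : ∀ m → suc (1 ℕ.+ (4 ℕ.* m ℕ.+ 2)) ≡ 4 ℕ.* m ℕ.+ 4
      ring = NS.solve-∀
      len : 1 ℕ.+ length R ℕ.< d₀
      len = ℕₚ.≤-reflexive (trans (cong (λ k → suc (1 ℕ.+ k)) (length-progression d₀ P)) (ring m))

    -- For strength two one root has to be given up; the node released is that of the given design,
    -- whose imbalance is 0.
    step₂ : ∀ p q → p ℕ.+ suc q ≡ P → Balanced (nb p) 2 → Balanced minBlock 2
    step₂ p q p+q bal = balanced-from minBlock 2 λ T T′ e e′ → cancel T T′ (trans
        (cong₂ _+_ (cong (rootPoly R (+ nd P) *_) (sym (imb-P T T′)))
          (trans (sym (trans (cong (rootPoly R (+ nd p) *_) (imbalance-0 (nb p) bal T T′ e e′)) (*-zeroʳ (rootPoly R (+ nd p))))) (sym (+-identityʳ _))))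
        (node-low T T′ e e′ R (P ∷ p ∷ []) ((P≢p ∷ []) ∷ [] ∷ []) (ℕₚ.≤-refl ∷ p≤P ∷ []) vanish len))
      where
      R = punctured d₀ p q
      p<P : p ℕ.< P
      p<P = subst (p ℕ.<_) p+q (ℕₚ.m<m+n p (s≤s z≤n))
      p≤P = ℕₚ.<⇒≤ p<P
      P≢p : P ≢ p
      P≢p e = ℕₚ.<⇒≢ p<P (sym e)
      vanish : ∀ i → i ℕ.≤ P → i ∉ P ∷ p ∷ [] → rootPoly R (+ nd i) ≡ 0ℤ
      vanish i i≤P i∉ = punctured-root d₀ p q i (ℕ.s≤s⁻¹ (subst (i ℕ.<_) (trans (sym p+q) (ℕₚ.+-suc p q)) (ℕₚ.≤∧≢⇒< i≤P (λ e → i∉ (here e)))))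
        (λ e → i∉ (there (here e)))
      ring : ∀ m → suc (suc (4 ℕ.* m ℕ.+ 2)) ≡ 4 ℕ.* m ℕ.+ 4
      ring = NS.solve-∀
      len : 2 ℕ.+ length R ℕ.< d₀
      len = ℕₚ.≤-reflexive (trans (cong (λ k → suc (suc (suc k))) (length-punctured d₀ p q))
        (trans (cong (λ k → suc (suc k)) (trans (sym (ℕₚ.+-suc p q)) p+q)) (ring m)))
      cancel : ∀ T T′ → rootPoly R (+ nd P) * imbalance minBlock T T′ + 0ℤ ≡ 0ℤ → imbalance minBlock T T′ ≡ 0ℤ
      cancel T T′ h with i*j≡0⇒i≡0∨j≡0 (rootPoly R (+ nd P)) (trans (sym (+-identityʳ _)) h)
      ... | inj₂ δ≡0 = δ≡0
      ... | inj₁ q≡0 with x , e ← above d₀ P (nd P) ℕₚ.≤-refl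
        with () ← trans (sym e) (trans (cong (λ k → rootPoly (progression d₀ k) (+ nd P)) (sym p+q)) (trans (sym (punctured-full d₀ p q (+ nd P)))
          (trans (cong (_* (+ nd P - + (d₀ ℕ.+ 4 ℕ.* p))) q≡0) (*-zeroˡ (+ nd P - + (d₀ ℕ.+ 4 ℕ.* p))))))

    interior-vanish : ∀ i → i ℕ.≤ P → i ∉ 0 ∷ P ∷ [] → rootPoly (progression (4 ℕ.+ d₀) (4 ℕ.* m ℕ.+ 1)) (+ nd i) ≡ 0ℤ
    interior-vanish zero    _   i∉ = ⊥-elim (i∉ (here refl))
    interior-vanish (suc i) i≤P i∉ = trans (cong (λ z → rootPoly (progression (4 ℕ.+ d₀) (4 ℕ.* m ℕ.+ 1)) (+ z)) (shift-index d₀ i))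
      (progression-root (4 ℕ.+ d₀) (4 ℕ.* m ℕ.+ 1) i (ℕ.s≤s⁻¹ (subst (suc i ℕ.<_) (ℕₚ.+-suc (4 ℕ.* m) 1) (ℕₚ.≤∧≢⇒< i≤P (λ e → i∉ (there (here e)))))))

    0≢P : 0 ≢ P
    0≢P e with () ← trans e (ℕₚ.+-comm (4 ℕ.* m) 2)

    -- With opposite signs at the two end nodes, the two sides of node-top have opposite signs.
    opposite-ends : ∀ t R → suc t ℕ.≤ 6 → BalancedBelow (suc t) → sgnPow (suc t) ≡ -1ℤ → Positive R (nd P) →
      (∃ λ y → rootPoly R (+ nd 0) ≡ -1ℤ * + suc y) → ∀ T T′ → ∣ T ∣ ≡ suc t → ∣ T′ ∣ ≡ suc t →
      rootPoly R (+ nd 0) * imb 0 T T′ + rootPoly R (+ nd P) * imb P T T′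
        ≡ + (length R !) * (sgnPow (suc t) * + (2 ^ (8 ℕ.* m ℕ.+ 4)) * imbalance minBlock T T′) →
      imbalance minBlock T T′ ≡ 0ℤ
    opposite-ends t R t<6 bal odd (x , u) (y , v) T T′ e e′ eq = positive-multiple {y ℕ.+ suc x ℕ.+ Z} δ refl (begin
      (+ suc y + + suc x + + Z) * δ
        ≡⟨ ring (+ suc y) (+ suc x) (+ Z) δ ⟩
      (-1ℤ * + suc y * (-1ℤ * δ) + + suc x * δ) - -1ℤ * + Z * δ
        ≡⟨ cong (λ k → k - -1ℤ * + Z * δ) (cong₂ _+_ (cong₂ _*_ (sym v) (sym (trans (imb-0 t t<6 bal T T′ e e′) (cong (_* δ) odd)))) (cong₂ _*_ (sym u) (sym (imb-P T T′)))) ⟩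
      (rootPoly R (+ nd 0) * imb 0 T T′ + rootPoly R (+ nd P) * imb P T T′) - -1ℤ * + Z * δ
        ≡⟨ cong₂ _-_ eq (cong (λ k → -1ℤ * k * δ) (pos-* (length R !) W)) ⟩
      + (length R !) * (sgnPow (suc t) * + W * δ) - -1ℤ * (+ (length R !) * + W) * δ
        ≡⟨ cong (λ s → + (length R !) * (s * + W * δ) - -1ℤ * (+ (length R !) * + W) * δ) odd ⟩
      + (length R !) * (-1ℤ * + W * δ) - -1ℤ * (+ (length R !) * + W) * δ
        ≡⟨ cancel (+ (length R !)) (+ W) δ ⟩
      0ℤ ∎)
      where
      δ = imbalance minBlock T T′
      W = 2 ^ (8 ℕ.* m ℕ.+ 4)
      Z = length R ! ℕ.* W
      ring : ∀ y x z δ → (y + x + z) * δ ≡ (-1ℤ * y * (-1ℤ * δ) + x * δ) - -1ℤ * z * δ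
      ring = solve-∀
      cancel : ∀ l w δ → l * (-1ℤ * w * δ) - -1ℤ * (l * w) * δ ≡ 0ℤ
      cancel = solve-∀

    -- The roots are the interior nodes, and their number 4m + 1 is exactly d - 3. It is odd, so the
    -- polynomial has opposite signs at the two ends, which is what `opposite-ends` requires. No
    -- further design is consumed.
    step₃ : BalancedBelow 3 → Balanced minBlock 3
    step₃ bal = balanced-from minBlock 3 λ T T′ e e′ → opposite-ends 2 R (ℕₚ.m≤m+n 3 3) bal refl
      (above (4 ℕ.+ d₀) k (nd P) (ℕₚ.≤-reflexive (ring₁ m)))
      (proj₁ end₀ , trans (proj₂ end₀) (cong (_* + suc (proj₁ end₀)) (trans (cong sgnPow (length-progression (4 ℕ.+ d₀) k)) (sgnPow-odd m)))) T T′ e e′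
      (trans (sym (cong (λ x → rootPoly R (+ nd 0) * imb 0 T T′ + x) (+-identityʳ _)))
        (node-top T T′ e e′ R (0 ∷ P ∷ []) ((0≢P ∷ []) ∷ [] ∷ []) (z≤n ∷ ℕₚ.≤-refl ∷ []) interior-vanish
          (trans (cong (ℕ._+ 3) (length-progression (4 ℕ.+ d₀) k)) (ring₂ m))))
      where
      k = 4 ℕ.* m ℕ.+ 1
      R = progression (4 ℕ.+ d₀) k
      end₀ : Alternating R (nd 0)
      end₀ = progression-alternating (4 ℕ.+ d₀) k (nd 0) (subst (ℕ._< 4 ℕ.+ d₀) (sym (ℕₚ.+-identityʳ d₀)) (ℕₚ.m<n+m d₀ {4} (s≤s z≤n)))
      ring₁ : ∀ m → 4 ℕ.+ (4 ℕ.* m ℕ.+ 4) ℕ.+ 4 ℕ.* (4 ℕ.* m ℕ.+ 1) ≡ 4 ℕ.* m ℕ.+ 4 ℕ.+ 4 ℕ.* (4 ℕ.* m ℕ.+ 2)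
      ring₁ = NS.solve-∀
      ring₂ : ∀ m → 4 ℕ.* m ℕ.+ 1 ℕ.+ 3 ≡ 4 ℕ.* m ℕ.+ 4
      ring₂ = NS.solve-∀

-- Strength four from a single interior weight.

module StrengthFour where
  open WordSums
  open Incidence
  open Designs
  open Complements
  open RootPolynomials
  open Moments
  open Progressions
  open ExtremalCodes
  open Profiles
  open NodeSums
  open StrengthThree
  open import Data.Bool using (Bool; true; T)
  open import Data.Nat as ℕ using (ℕ; zero; suc; z≤n; s≤s; _!; _^_)
  import Data.Nat.Properties as ℕₚ
  import Data.Nat.Tactic.RingSolver as NS
  open import Data.Integer using (ℤ; +_; 0ℤ; 1ℤ; -1ℤ; _+_; _*_; _-_; -_)
  open import Data.Integer.Properties
  open import Data.Integer.Tactic.RingSolver using (solve-∀)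
  open import Data.List using (List; []; _∷_; length)
  open import Data.List.Membership.Propositional using (_∉_)
  open import Data.List.Relation.Unary.Any using (here; there)
  open import Data.List.Relation.Unary.All as All using (All; []; _∷_)
  open import Data.List.Relation.Unary.AllPairs using ([]; _∷_)
  open import Data.List.Relation.Unary.Unique.Propositional using (Unique)
  open import Data.Fin.Subset using (∣_∣)
  open import Data.Vec using ([]; _∷_)
  open import Data.Sum using (inj₁; inj₂)
  open import Data.Empty using (⊥-elim)
  open import Relation.Binary.PropositionalEquality
  open ≡-Reasoning

  4^k≡2^2k : ∀ k → 4 ^ k ≡ 2 ^ (2 ℕ.* k)
  4^k≡2^2k k = ℕₚ.^-*-assoc 2 2 k

  -- Cancelling 2^(8m + 2) (4m)! and a factor 8 turns the equation into (4m + 1)(2m + 1) = 8 (p +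
  -- 1)(q + 1), odd against even.
  fourth-nonvanishing : ∀ m p q → p ℕ.+ q ≡ 4 ℕ.* m →
    4 ^ (p ℕ.+ suc q) ℕ.* (p ℕ.+ suc q) ! ℕ.* (4 ℕ.* suc q ℕ.+ 4 ℕ.* suc p)
      ≢ (p ℕ.+ q) ! ℕ.* 2 ^ (8 ℕ.* m ℕ.+ 4) ℕ.* (4 ℕ.* suc q ℕ.* (4 ℕ.* suc p))
  fourth-nonvanishing m p q e eq = odd≢even (ℕₚ.*-cancelˡ-≡ (1 ℕ.+ 2 ℕ.* y) (4 ℕ.* (2 ℕ.* x)) 8 (begin
    8 ℕ.* (1 ℕ.+ 2 ℕ.* y)                        ≡⟨ ring₁ m ⟩
    (suc (4 ℕ.* m)) ℕ.* (4 ℕ.* (4 ℕ.* m ℕ.+ 2))   ≡⟨ ℕₚ.*-cancelˡ-≡ _ _ (A ℕ.* (4 ℕ.* m) !) {{ℕₚ.m*n≢0 A ((4 ℕ.* m) !) {{ℕₚ.m^n≢0 2 (8 ℕ.* m ℕ.+ 2)}} {{ℕₚ._!≢0 (4 ℕ.* m)}}}} (begin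
      A ℕ.* (4 ℕ.* m) ! ℕ.* (suc (4 ℕ.* m) ℕ.* (4 ℕ.* (4 ℕ.* m ℕ.+ 2)))
        ≡⟨ ring₂ A ((4 ℕ.* m) !) (suc (4 ℕ.* m)) (4 ℕ.* (4 ℕ.* m ℕ.+ 2)) ⟩
      A ℕ.* (suc (4 ℕ.* m) !) ℕ.* (4 ℕ.* (4 ℕ.* m ℕ.+ 2))
        ≡⟨ cong₂ (λ a b → a ℕ.* (suc (4 ℕ.* m) !) ℕ.* b) (sym 4^k) (trans (cong (λ k → 4 ℕ.* (k ℕ.+ 2)) (sym e)) (ring₃ p q)) ⟩
      4 ^ (suc (4 ℕ.* m)) ℕ.* (suc (4 ℕ.* m) !) ℕ.* (4 ℕ.* suc q ℕ.+ 4 ℕ.* suc p)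
        ≡⟨ cong (λ k → 4 ^ k ℕ.* k ! ℕ.* (4 ℕ.* suc q ℕ.+ 4 ℕ.* suc p)) (trans (cong suc (sym e)) (sym (ℕₚ.+-suc p q))) ⟩
      4 ^ (p ℕ.+ suc q) ℕ.* (p ℕ.+ suc q) ! ℕ.* (4 ℕ.* suc q ℕ.+ 4 ℕ.* suc p)
        ≡⟨ eq ⟩
      (p ℕ.+ q) ! ℕ.* 2 ^ (8 ℕ.* m ℕ.+ 4) ℕ.* (4 ℕ.* suc q ℕ.* (4 ℕ.* suc p))
        ≡⟨ cong₂ (λ a b → a ! ℕ.* b ℕ.* (4 ℕ.* suc q ℕ.* (4 ℕ.* suc p))) e 2^ ⟩
      (4 ℕ.* m) ! ℕ.* (A ℕ.* 4) ℕ.* (4 ℕ.* suc q ℕ.* (4 ℕ.* suc p))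
        ≡⟨ ring₄ ((4 ℕ.* m) !) A (suc q) (suc p) ⟩
      A ℕ.* (4 ℕ.* m) ! ℕ.* (8 ℕ.* (4 ℕ.* (2 ℕ.* x))) ∎) ⟩
    8 ℕ.* (4 ℕ.* (2 ℕ.* x)) ∎))
    where
    x = suc q ℕ.* suc p
    y = 4 ℕ.* m ℕ.* m ℕ.+ 3 ℕ.* m
    A = 2 ^ (8 ℕ.* m ℕ.+ 2)
    4^k : 4 ^ suc (4 ℕ.* m) ≡ A
    4^k = trans (4^k≡2^2k (suc (4 ℕ.* m))) (cong (2 ^_) (ring m))
      where
      ring : ∀ m → 2 ℕ.* suc (4 ℕ.* m) ≡ 8 ℕ.* m ℕ.+ 2
      ring = NS.solve-∀
    2^ : 2 ^ (8 ℕ.* m ℕ.+ 4) ≡ A ℕ.* 4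
    2^ = trans (cong (2 ^_) (sym (ℕₚ.+-assoc (8 ℕ.* m) 2 2))) (ℕₚ.^-distribˡ-+-* 2 (8 ℕ.* m ℕ.+ 2) 2)
    odd : ∀ y → parity (1 ℕ.+ 2 ℕ.* y) ≡ true
    odd zero    = refl
    odd (suc y) = trans (cong parity (ring y)) (trans (not-involutive _) (odd y))
      where
      open import Data.Bool.Properties using (not-involutive)
      ring : ∀ y → 1 ℕ.+ 2 ℕ.* suc y ≡ suc (suc (1 ℕ.+ 2 ℕ.* y))
      ring = NS.solve-∀
    odd≢even : 1 ℕ.+ 2 ℕ.* y ≢ 4 ℕ.* (2 ℕ.* x)
    odd≢even h with () ← trans (sym (odd y)) (trans (cong parity h) (parity-4* (2 ℕ.* x)))
    ring₁ : ∀ m → 8 ℕ.* (1 ℕ.+ 2 ℕ.* (4 ℕ.* m ℕ.* m ℕ.+ 3 ℕ.* m)) ≡ suc (4 ℕ.* m) ℕ.* (4 ℕ.* (4 ℕ.* m ℕ.+ 2))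
    ring₁ = NS.solve-∀
    ring₂ : ∀ a f s b → a ℕ.* f ℕ.* (s ℕ.* b) ≡ a ℕ.* (s ℕ.* f) ℕ.* b
    ring₂ = NS.solve-∀
    ring₃ : ∀ p q → 4 ℕ.* (p ℕ.+ q ℕ.+ 2) ≡ 4 ℕ.* suc q ℕ.+ 4 ℕ.* suc p
    ring₃ = NS.solve-∀
    ring₄ : ∀ f a q p → f ℕ.* (a ℕ.* 4) ℕ.* (4 ℕ.* q ℕ.* (4 ℕ.* p)) ≡ a ℕ.* f ℕ.* (8 ℕ.* (4 ℕ.* (2 ℕ.* (q ℕ.* p))))
    ring₄ = NS.solve-∀

  -- The end values `r` and `s` stand for Q / B and Q / A; multiplying the relation by `A * B`
  -- avoids fractions.
  balance-ends : ∀ r s A B Q Y δ → r * B ≡ Q → s * A ≡ Q → r * δ + s * δ ≡ Y * δ → Q * (A + B) ≢ Y * (A * B) → δ ≡ 0ℤ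
  balance-ends r s A B Q Y δ rB sA eq ≢ with i*j≡0⇒i≡0∨j≡0 (Q * (A + B) - Y * (A * B)) {δ} (begin
    (Q * (A + B) - Y * (A * B)) * δ
      ≡⟨ ring₁ Q A B Y δ ⟩
    (Q * δ * A + Q * δ * B) - Y * δ * (A * B)
      ≡⟨ cong₂ (λ x y → (x * δ * A + y * δ * B) - Y * δ * (A * B)) (sym rB) (sym sA) ⟩
    (r * B * δ * A + s * A * δ * B) - Y * δ * (A * B)
      ≡⟨ ring₂ r s A B Y δ ⟩
    (r * δ + s * δ - Y * δ) * (A * B)
      ≡⟨ cong (_* (A * B)) (trans (cong (_- Y * δ) eq) (+-inverseʳ (Y * δ))) ⟩
    0ℤ * (A * B)
      ≡⟨ *-zeroˡ (A * B) ⟩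
    0ℤ ∎)
    where
    ring₁ : ∀ Q A B Y δ → (Q * (A + B) - Y * (A * B)) * δ ≡ (Q * δ * A + Q * δ * B) - Y * δ * (A * B)
    ring₁ = solve-∀
    ring₂ : ∀ r s A B Y δ → (r * B * δ * A + s * A * δ * B) - Y * δ * (A * B) ≡ (r * δ + s * δ - Y * δ) * (A * B)
    ring₂ = solve-∀
  ... | inj₁ e = ⊥-elim (≢ (i-j≡0⇒i≡j (Q * (A + B)) (Y * (A * B)) e))
  ... | inj₂ e = e

  module _ (m : ℕ) {C : Code (24 ℕ.* m ℕ.+ 16)} (ext : ExtremalDoublyEvenSelfDual C) where
    private
      n = 24 ℕ.* m ℕ.+ 16
      d₀ = 4 ℕ.* m ℕ.+ 4
      P = 4 ℕ.* m ℕ.+ 2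
      g = gapped m ext
      K = 2 ^ (12 ℕ.* m ℕ.+ 8)
      nd = node m ext
      nb = nodeBlock m ext
      X₀ = minBlock m ext

    module OnePuncture (p q : ℕ) (p+q : p ℕ.+ q ≡ 4 ℕ.* m) where
      -- Off by one: the progression begins at node 1, so its missing member number `p` is node
      -- `suc p`.
      R : List ℕ
      R = punctured (4 ℕ.+ d₀) p q

      len-R : length R ≡ 4 ℕ.* m
      len-R = trans (length-punctured (4 ℕ.+ d₀) p q) p+q

      -- `A` and `B` are the distances of the missing node from the top and the bottom node, and `Q`
      -- is the absolute value at either end of the product over all interior nodes.
      A B Q : ℤ
      A = + (4 ℕ.* suc q)
      B = + (4 ℕ.* suc p)
      Q = + (4 ^ (p ℕ.+ suc q) ℕ.* (p ℕ.+ suc q) !)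

      P≡ : P ≡ suc (p ℕ.+ suc q)
      P≡ = trans (cong (ℕ._+ 2) (sym p+q)) (ring p q)
        where
        ring : ∀ p q → p ℕ.+ q ℕ.+ 2 ≡ suc (p ℕ.+ suc q)
        ring = NS.solve-∀

      top-end : rootPoly R (+ nd P) * A ≡ Q
      top-end = begin
        rootPoly R (+ nd P) * A
          ≡⟨ cong (rootPoly R (+ nd P) *_) (sym diff) ⟩
        rootPoly R (+ nd P) * (+ nd P - + (4 ℕ.+ d₀ ℕ.+ 4 ℕ.* p))
          ≡⟨ punctured-full (4 ℕ.+ d₀) p q (+ nd P) ⟩
        rootPoly (progression (4 ℕ.+ d₀) (p ℕ.+ suc q)) (+ nd P)
          ≡⟨ cong (λ z → rootPoly (progression (4 ℕ.+ d₀) (p ℕ.+ suc q)) (+ z)) nd-P ⟩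
        rootPoly (progression (4 ℕ.+ d₀) (p ℕ.+ suc q)) (+ (4 ℕ.+ d₀ ℕ.+ 4 ℕ.* (p ℕ.+ suc q)))
          ≡⟨ top-value (4 ℕ.+ d₀) (p ℕ.+ suc q) ⟩
        Q ∎
        where
        nd-P : nd P ≡ 4 ℕ.+ d₀ ℕ.+ 4 ℕ.* (p ℕ.+ suc q)
        nd-P = trans (cong (λ k → d₀ ℕ.+ 4 ℕ.* k) P≡) (shift-index d₀ (p ℕ.+ suc q))
        ring : ∀ a p q → a ℕ.+ 4 ℕ.* (p ℕ.+ q) ≡ a ℕ.+ 4 ℕ.* p ℕ.+ 4 ℕ.* q
        ring = NS.solve-∀
        cancel : ∀ a b → a + b - a ≡ b
        cancel = solve-∀
        diff : + nd P - + (4 ℕ.+ d₀ ℕ.+ 4 ℕ.* p) ≡ A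
        diff = trans (cong (λ z → + z - + (4 ℕ.+ d₀ ℕ.+ 4 ℕ.* p)) (trans nd-P (ring (4 ℕ.+ d₀) p (suc q)))) (cancel (+ (4 ℕ.+ d₀ ℕ.+ 4 ℕ.* p)) A)

      bottom-end : rootPoly R (+ nd 0) * B ≡ Q
      bottom-end = neg-injective (begin
        - (rootPoly R (+ nd 0) * B)
          ≡⟨ ring₁ (rootPoly R (+ nd 0)) B ⟩
        rootPoly R (+ nd 0) * (-1ℤ * B)
          ≡⟨ cong (rootPoly R (+ nd 0) *_) (sym diff) ⟩
        rootPoly R (+ nd 0) * (+ nd 0 - + (4 ℕ.+ d₀ ℕ.+ 4 ℕ.* p))
          ≡⟨ punctured-full (4 ℕ.+ d₀) p q (+ nd 0) ⟩
        rootPoly (progression (4 ℕ.+ d₀) (p ℕ.+ suc q)) (+ nd 0)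
          ≡⟨ cong (λ z → rootPoly (progression (4 ℕ.+ d₀) (p ℕ.+ suc q)) (+ z)) (ℕₚ.+-identityʳ d₀) ⟩
        rootPoly (progression (4 ℕ.+ d₀) (p ℕ.+ suc q)) (+ d₀)
          ≡⟨ bottom-value d₀ (p ℕ.+ suc q) ⟩
        sgnPow (p ℕ.+ suc q) * Q
          ≡⟨ cong (_* Q) (trans (cong sgnPow (trans (ring₂ p q) (cong (ℕ._+ 1) p+q))) (sgnPow-odd m)) ⟩
        -1ℤ * Q
          ≡⟨ -1*i≡-i Q ⟩
        - Q ∎)
        where
        ring₁ : ∀ r b → - (r * b) ≡ r * (-1ℤ * b)
        ring₁ = solve-∀
        ring₂ : ∀ p q → p ℕ.+ suc q ≡ p ℕ.+ q ℕ.+ 1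
        ring₂ = NS.solve-∀
        cancel : ∀ a b → a - (a + b) ≡ -1ℤ * b
        cancel = solve-∀
        diff : + nd 0 - + (4 ℕ.+ d₀ ℕ.+ 4 ℕ.* p) ≡ -1ℤ * B
        diff = trans (cong₂ (λ x y → + x - + y) (ℕₚ.+-identityʳ d₀) (sym (shift-index d₀ p))) (cancel (+ d₀) B)

      equal-ends : ∀ δ Y → rootPoly R (+ nd 0) * δ + rootPoly R (+ nd P) * δ ≡ Y * δ → Q * (A + B) ≢ Y * (A * B) → δ ≡ 0ℤ
      equal-ends δ Y = balance-ends (rootPoly R (+ nd 0)) (rootPoly R (+ nd P)) A B Q Y δ bottom-end top-end

      E : List ℕ
      E = 0 ∷ P ∷ suc p ∷ []

      sp<P : suc p ℕ.< P
      sp<P = subst (suc p ℕ.<_) (sym P≡) (s≤s (ℕₚ.m<m+n p (s≤s z≤n)))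

      E-unique : Unique E
      E-unique = ((0≢P m ext) ∷ (λ ()) ∷ []) ∷ ((λ e → ℕₚ.<⇒≢ sp<P (sym e)) ∷ []) ∷ [] ∷ []

      E-bounded : All (ℕ._≤ P) E
      E-bounded = z≤n ∷ ℕₚ.≤-refl ∷ ℕₚ.<⇒≤ sp<P ∷ []

      E-vanish : ∀ i → i ℕ.≤ P → i ∉ E → rootPoly R (+ nd i) ≡ 0ℤ
      E-vanish zero    _   i∉ = ⊥-elim (i∉ (here refl))
      E-vanish (suc i) i≤P i∉ = trans (cong (λ z → rootPoly R (+ z)) (shift-index d₀ i))
        (punctured-root (4 ℕ.+ d₀) p q i
          (ℕ.s≤s⁻¹ (subst (i ℕ.<_) (ℕₚ.+-suc p q) (ℕ.s<s⁻¹ (subst (suc i ℕ.<_) P≡ (ℕₚ.≤∧≢⇒< i≤P (λ e → i∉ (there (here e))))))))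
          (λ e → i∉ (there (there (here (cong suc e))))))

      sum-E : ∀ t → suc t ℕ.≤ 6 → BalancedBelow m ext (suc t) → sgnPow (suc t) ≡ 1ℤ → Balanced (nb (suc p)) (suc t) →
        ∀ T T′ → ∣ T ∣ ≡ suc t → ∣ T′ ∣ ≡ suc t →
        sumOver E (λ i → rootPoly R (+ nd i) * imb m ext i T T′)
          ≡ rootPoly R (+ nd 0) * imbalance X₀ T T′ + rootPoly R (+ nd P) * imbalance X₀ T T′
      sum-E t t<6 below even bal T T′ e e′ = cong₂ _+_
        (cong (rootPoly R (+ nd 0) *_) (trans (imb-0 m ext t t<6 below T T′ e e′) (trans (cong (_* imbalance X₀ T T′) even) (*-identityˡ _))))
        (trans (cong₂ _+_ (cong (rootPoly R (+ nd P) *_) (imb-P m ext T T′))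
          (trans (+-identityʳ _) (trans (cong (rootPoly R (+ nd (suc p)) *_) (imbalance-0 m ext (nb (suc p)) bal T T′ e e′)) (*-zeroʳ (rootPoly R (+ nd (suc p))))))) (+-identityʳ _))

      -- At even strength both ends carry the same imbalance and the two sides of `node-top` cannot
      -- be separated by sign; their coefficients are shown to differ instead.
      step₄ : BalancedBelow m ext 4 → Balanced (nb (suc p)) 4 → Balanced X₀ 4
      step₄ below bal = balanced-from m ext X₀ 4 λ T T′ e e′ → equal-ends (imbalance X₀ T T′) (+ Y)
        (trans (sym (sum-E 3 (ℕₚ.m≤m+n 4 2) below refl bal T T′ e e′))
          (trans (node-top m ext T T′ e e′ R E E-unique E-bounded E-vanish (cong (ℕ._+ 4) len-R))
            (trans (ring (+ (length R !)) (+ W) (imbalance X₀ T T′)) (cong (_* imbalance X₀ T T′)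
              (trans (sym (pos-* (length R !) W)) (cong (λ l → + (l ! ℕ.* W)) (length-punctured (4 ℕ.+ d₀) p q)))))))
        λ h → fourth-nonvanishing m p q p+q (+-injective (begin
          + (4 ^ (p ℕ.+ suc q) ℕ.* (p ℕ.+ suc q) ! ℕ.* (4 ℕ.* suc q ℕ.+ 4 ℕ.* suc p))   ≡⟨ pos-* (4 ^ (p ℕ.+ suc q) ℕ.* (p ℕ.+ suc q) !) (4 ℕ.* suc q ℕ.+ 4 ℕ.* suc p) ⟩
          Q * (A + B)                                       ≡⟨ h ⟩
          + Y * (A * B)                                     ≡⟨ cong (+ Y *_) (sym (pos-* (4 ℕ.* suc q) (4 ℕ.* suc p))) ⟩
          + Y * + (4 ℕ.* suc q ℕ.* (4 ℕ.* suc p))           ≡⟨ pos-* Y (4 ℕ.* suc q ℕ.* (4 ℕ.* suc p)) ⟨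
          + (Y ℕ.* (4 ℕ.* suc q ℕ.* (4 ℕ.* suc p))) ∎))
        where
        W = 2 ^ (8 ℕ.* m ℕ.+ 4)
        Y = (p ℕ.+ q) ! ℕ.* W
        ring : ∀ l w δ → l * (1ℤ * w * δ) ≡ l * w * δ
        ring = solve-∀

-- Strength five from a mirror pair of weights.

module StrengthFive where
  open WordSums
  open Incidence
  open Designs
  open Complements
  open RootPolynomials
  open Moments
  open Progressions
  open ExtremalCodes
  open Profiles
  open NodeSums
  open StrengthThree
  open StrengthFour
  open import Data.Bool using (T)
  open import Data.Nat as ℕ using (ℕ; zero; suc; z≤n; s≤s; _∸_)
  import Data.Nat.Properties as ℕₚ
  import Data.Nat.Tactic.RingSolver as NS
  open import Data.Integer using (+_; 0ℤ; 1ℤ; -1ℤ; _+_; _*_; _-_; -_)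
  open import Data.Integer.Properties
  open import Data.Integer.Tactic.RingSolver using (solve-∀)
  open import Data.List using (List; []; _∷_; _++_; length)
  import Data.List.Properties as Listₚ
  open import Data.List.Membership.Propositional using (_∉_)
  open import Data.List.Relation.Unary.Any using (here; there)
  open import Data.List.Relation.Unary.All as All using (All; []; _∷_)
  open import Data.List.Relation.Unary.AllPairs using ([]; _∷_)
  open import Data.List.Relation.Unary.Unique.Propositional using (Unique)
  open import Data.Fin.Subset using (∣_∣)
  open import Data.Vec using ([]; _∷_)
  open import Data.Product using (∃; _,_; proj₁; proj₂)
  open import Data.Empty using (⊥-elim)
  open import Relation.Nullary using (yes; no)
  open import Relation.Binary.PropositionalEquality

  -- Removing an index lo = p + 1 and its mirror image hi = P - lo from the interior leaves an odd number of roots.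
  twicePunctured : ℕ → ℕ → ℕ → List ℕ
  twicePunctured a p k = punctured a p k ++ progression (a ℕ.+ 4 ℕ.* (p ℕ.+ k ℕ.+ 2)) p

  module _ (m : ℕ) {C : Code (24 ℕ.* m ℕ.+ 16)} (ext : ExtremalDoublyEvenSelfDual C) where
    private
      d₀ = 4 ℕ.* m ℕ.+ 4
      P = 4 ℕ.* m ℕ.+ 2
      g = gapped m ext
      nd = node m ext
      nb = nodeBlock m ext
      X₀ = minBlock m ext

    -- Degree d - 5 leaves four nodes: the two ends and a mirror pair on which the imbalance
    -- vanishes. The degree is odd, so the sign argument of strength three applies. `k` counts the
    -- nodes strictly between the pair; the middle node is its own mirror image and does not fit
    -- this form.
    step₅ : ∀ p k → p ℕ.+ k ℕ.+ p ℕ.+ 3 ≡ P → BalancedBelow m ext 5 →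
      Balanced (nb (suc p)) 5 → Balanced (nb (p ℕ.+ k ℕ.+ 2)) 5 → Balanced X₀ 5
    step₅ p k sum≡P below bal-lo bal-hi = balanced-from m ext X₀ 5 λ T T′ e e′ →
      opposite-ends m ext 4 R (ℕₚ.n≤1+n 5) below refl positive end₀ T T′ e e′
        (trans (sym (sum-E T T′ e e′)) (node-top m ext T T′ e e′ R E E-unique E-bounded E-vanish len))
      where
      a = 4 ℕ.+ d₀
      R = twicePunctured a p k
      E = 0 ∷ P ∷ suc p ∷ p ℕ.+ k ℕ.+ 2 ∷ []
      P≡ : P ≡ suc (p ℕ.+ k ℕ.+ 2 ℕ.+ p)
      P≡ = trans (sym sum≡P) (ring p k)
        where
        ring : ∀ p k → p ℕ.+ k ℕ.+ p ℕ.+ 3 ≡ suc (p ℕ.+ k ℕ.+ 2 ℕ.+ p)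
        ring = NS.solve-∀
      nd-P : nd P ≡ a ℕ.+ 4 ℕ.* (p ℕ.+ k ℕ.+ 2 ℕ.+ p)
      nd-P = trans (cong (λ i → d₀ ℕ.+ 4 ℕ.* i) P≡) (shift-index d₀ (p ℕ.+ k ℕ.+ 2 ℕ.+ p))
      below-P : ∀ {i} → i ℕ.≤ p ℕ.+ k ℕ.+ 2 ℕ.+ p → a ℕ.+ 4 ℕ.* i ℕ.≤ nd P
      below-P {i} i≤ = subst (a ℕ.+ 4 ℕ.* i ℕ.≤_) (sym nd-P) (ℕₚ.+-monoʳ-≤ a (ℕₚ.*-monoʳ-≤ 4 i≤))
      len-R : length R ≡ p ℕ.+ k ℕ.+ p
      len-R = trans (Listₚ.length-++ (punctured a p k)) (cong₂ ℕ._+_ (length-punctured a p k) (length-progression _ p))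
      len : length R ℕ.+ 5 ≡ d₀
      len = trans (cong (ℕ._+ 5) len-R) (trans (ring₁ (p ℕ.+ k ℕ.+ p)) (trans (cong (ℕ._+ 2) sum≡P) (ring₂ m)))
        where
        ring₁ : ∀ x → x ℕ.+ 5 ≡ x ℕ.+ 3 ℕ.+ 2
        ring₁ = NS.solve-∀
        ring₂ : ∀ m → 4 ℕ.* m ℕ.+ 2 ℕ.+ 2 ≡ 4 ℕ.* m ℕ.+ 4
        ring₂ = NS.solve-∀
      positive : Positive R (nd P)
      positive = positive-++ {punctured a p k} {progression (a ℕ.+ 4 ℕ.* (p ℕ.+ k ℕ.+ 2)) p} {nd P}
        (positive-++ {progression a p} {progression (a ℕ.+ 4 ℕ.* suc p) k} {nd P}
          (above a p (nd P) (below-P (ℕₚ.≤-trans (ℕₚ.m≤n+m p (p ℕ.+ k ℕ.+ 2)) ℕₚ.≤-refl)))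
          (above _ k (nd P) (subst (ℕ._≤ nd P) (ring₁ a p k) (below-P {suc p ℕ.+ k} (subst (suc p ℕ.+ k ℕ.≤_) (ring₂ p k) (ℕₚ.m≤m+n (suc p ℕ.+ k) (suc p)))))))
        (above _ p (nd P) (subst (ℕ._≤ nd P) (ring₃ a (p ℕ.+ k ℕ.+ 2) p) (below-P {p ℕ.+ k ℕ.+ 2 ℕ.+ p} ℕₚ.≤-refl)))
        where
        ring₁ : ∀ a p k → a ℕ.+ 4 ℕ.* (suc p ℕ.+ k) ≡ a ℕ.+ 4 ℕ.* suc p ℕ.+ 4 ℕ.* k
        ring₁ = NS.solve-∀
        ring₂ : ∀ p k → suc p ℕ.+ k ℕ.+ suc p ≡ p ℕ.+ k ℕ.+ 2 ℕ.+ p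
        ring₂ = NS.solve-∀
        ring₃ : ∀ a x p → a ℕ.+ 4 ℕ.* (x ℕ.+ p) ≡ a ℕ.+ 4 ℕ.* x ℕ.+ 4 ℕ.* p
        ring₃ = NS.solve-∀
      end₀ : ∃ λ y → rootPoly R (+ nd 0) ≡ -1ℤ * + suc y
      end₀ = proj₁ alt , trans (proj₂ alt) (cong (_* + suc (proj₁ alt)) odd)
        where
        nd-0<a : ∀ {i} → nd 0 ℕ.< a ℕ.+ i
        nd-0<a {i} = ℕₚ.≤-trans (ℕₚ.≤-reflexive (cong suc (ℕₚ.+-identityʳ d₀))) (ℕₚ.≤-trans (ℕₚ.m≤n+m (suc d₀) 3) (ℕₚ.m≤m+n a i))
        alt : Alternating R (nd 0)
        alt = alternating-++ {punctured a p k} {progression (a ℕ.+ 4 ℕ.* (p ℕ.+ k ℕ.+ 2)) p} {nd 0}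
          (alternating-++ {progression a p} {progression (a ℕ.+ 4 ℕ.* suc p) k} {nd 0}
            (progression-alternating a p (nd 0) (subst (nd 0 ℕ.<_) (ℕₚ.+-identityʳ a) (nd-0<a {0})))
            (progression-alternating (a ℕ.+ 4 ℕ.* suc p) k (nd 0) nd-0<a))
          (progression-alternating (a ℕ.+ 4 ℕ.* (p ℕ.+ k ℕ.+ 2)) p (nd 0) nd-0<a)
        flip : ∀ x → -1ℤ * (-1ℤ * (-1ℤ * (-1ℤ * (-1ℤ * x)))) ≡ 1ℤ → x ≡ -1ℤ
        flip x h = trans (ring x) (cong (-1ℤ *_) h)
          where
          ring : ∀ x → x ≡ -1ℤ * (-1ℤ * (-1ℤ * (-1ℤ * (-1ℤ * (-1ℤ * x)))))
          ring = solve-∀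
        -- The parity is read off from `length R + 5 = 4 * suc m`, independently of `p` and `k`.
        odd : sgnPow (length R) ≡ -1ℤ
        odd = flip (sgnPow (length R)) (trans (cong sgnPow (trans (ℕₚ.+-comm 5 (length R)) (trans len (ring m)))) (sgnPow-4* (suc m)))
          where
          ring : ∀ m → 4 ℕ.* m ℕ.+ 4 ≡ 4 ℕ.* suc m
          ring = NS.solve-∀
      lo<hi : suc p ℕ.< p ℕ.+ k ℕ.+ 2
      lo<hi = subst (suc p ℕ.<_) (ring p k) (s≤s (ℕₚ.m≤m+n (suc p) k))
        where
        ring : ∀ p k → suc (suc p ℕ.+ k) ≡ p ℕ.+ k ℕ.+ 2
        ring = NS.solve-∀
      hi<P : p ℕ.+ k ℕ.+ 2 ℕ.< P
      hi<P = subst (p ℕ.+ k ℕ.+ 2 ℕ.<_) (sym P≡) (s≤s (ℕₚ.m≤m+n _ p))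
      lo<P = ℕₚ.<-trans lo<hi hi<P
      E-unique : Unique E
      E-unique = (0≢P m ext ∷ (λ ()) ∷ (λ e → ℕₚ.<⇒≢ (ℕₚ.≤-<-trans z≤n lo<hi) e) ∷ [])
               ∷ ((λ e → ℕₚ.<⇒≢ lo<P (sym e)) ∷ (λ e → ℕₚ.<⇒≢ hi<P (sym e)) ∷ [])
               ∷ ((λ e → ℕₚ.<⇒≢ lo<hi e) ∷ []) ∷ [] ∷ []
      E-bounded : All (ℕ._≤ P) E
      E-bounded = z≤n ∷ ℕₚ.≤-refl ∷ ℕₚ.<⇒≤ lo<P ∷ ℕₚ.<⇒≤ hi<P ∷ []
      E-vanish : ∀ i → i ℕ.≤ P → i ∉ E → rootPoly R (+ nd i) ≡ 0ℤ
      E-vanish zero    _   i∉ = ⊥-elim (i∉ (here refl))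
      E-vanish (suc i) i≤P i∉ = trans (cong (λ z → rootPoly R (+ z)) (shift-index d₀ i))
        (trans (rootPoly-++ (punctured a p k) (progression (a ℕ.+ 4 ℕ.* (p ℕ.+ k ℕ.+ 2)) p) z) vanish)
        where
        z = + (a ℕ.+ 4 ℕ.* i)
        third = rootPoly (progression (a ℕ.+ 4 ℕ.* (p ℕ.+ k ℕ.+ 2)) p) z
        i≢p : i ≢ p
        i≢p e = i∉ (there (there (here (cong suc e))))
        i≢hi : i ≢ suc (p ℕ.+ k)
        i≢hi e = i∉ (there (there (there (here (trans (cong suc e) (ℕₚ.+-comm 2 (p ℕ.+ k)))))))
        i< : i ℕ.< p ℕ.+ k ℕ.+ 2 ℕ.+ p
        i< = ℕ.s<s⁻¹ (subst (suc i ℕ.<_) P≡ (ℕₚ.≤∧≢⇒< i≤P (λ e → i∉ (there (here e)))))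
        vanish : rootPoly (punctured a p k) z * third ≡ 0ℤ
        vanish with i ℕ.≤? p ℕ.+ k
        ... | yes i≤ = trans (cong (_* third) (punctured-root a p k i i≤ i≢p)) (*-zeroˡ third)
        ... | no i≰  = trans (cong (rootPoly (punctured a p k) z *_) (trans (cong (λ w → rootPoly (progression (a ℕ.+ 4 ℕ.* (p ℕ.+ k ℕ.+ 2)) p) (+ w)) shift)
                (progression-root (a ℕ.+ 4 ℕ.* (p ℕ.+ k ℕ.+ 2)) p j j<p))) (*-zeroʳ (rootPoly (punctured a p k) z))
          where
          hi≤i : p ℕ.+ k ℕ.+ 2 ℕ.≤ i
          hi≤i = subst (ℕ._≤ i) (ℕₚ.+-comm 2 (p ℕ.+ k)) (ℕₚ.≤∧≢⇒< (ℕₚ.≰⇒> i≰) (λ e → i≢hi (sym e)))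
          j = i ∸ (p ℕ.+ k ℕ.+ 2)
          i≡ : p ℕ.+ k ℕ.+ 2 ℕ.+ j ≡ i
          i≡ = ℕₚ.m+[n∸m]≡n hi≤i
          j<p : j ℕ.< p
          j<p = ℕₚ.+-cancelˡ-< (p ℕ.+ k ℕ.+ 2) j p (subst (ℕ._< p ℕ.+ k ℕ.+ 2 ℕ.+ p) (sym i≡) i<)
          ring : ∀ a x j → a ℕ.+ 4 ℕ.* (x ℕ.+ j) ≡ a ℕ.+ 4 ℕ.* x ℕ.+ 4 ℕ.* j
          ring = NS.solve-∀
          shift : a ℕ.+ 4 ℕ.* i ≡ a ℕ.+ 4 ℕ.* (p ℕ.+ k ℕ.+ 2) ℕ.+ 4 ℕ.* j
          shift = trans (cong (λ w → a ℕ.+ 4 ℕ.* w) (sym i≡)) (ring a (p ℕ.+ k ℕ.+ 2) j)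
      sum-E : ∀ T T′ → ∣ T ∣ ≡ 5 → ∣ T′ ∣ ≡ 5 → sumOver E (λ i → rootPoly R (+ nd i) * imb m ext i T T′)
        ≡ rootPoly R (+ nd 0) * imb m ext 0 T T′ + rootPoly R (+ nd P) * imb m ext P T T′
      sum-E T T′ e e′ = cong (λ x → rootPoly R (+ nd 0) * imb m ext 0 T T′ + x)
        (trans (cong (λ x → rootPoly R (+ nd P) * imb m ext P T T′ + x)
          (cong₂ _+_ (trans (cong (rootPoly R (+ nd (suc p)) *_) (imbalance-0 m ext (nb (suc p)) bal-lo T T′ e e′)) (*-zeroʳ (rootPoly R (+ nd (suc p)))))
            (trans (+-identityʳ _) (trans (cong (rootPoly R (+ nd (p ℕ.+ k ℕ.+ 2)) *_) (imbalance-0 m ext (nb (p ℕ.+ k ℕ.+ 2)) bal-hi T T′ e e′)) (*-zeroʳ (rootPoly R (+ nd (p ℕ.+ k ℕ.+ 2))))))))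
          (+-identityʳ _))

-- Strength six through three consecutive moments.

module StrengthSix where
  open WordSums
  open Incidence
  open Designs
  open Complements
  open RootPolynomials
  open Moments
  open Progressions
  open ExtremalCodes
  open Profiles
  open NodeSums
  open StrengthThree
  open StrengthFour
  open StrengthFive
  open import Data.Bool using (T)
  open import Data.Nat as ℕ using (ℕ; zero; suc; z≤n; s≤s; _∸_; _!; _^_)
  import Data.Nat.Properties as ℕₚ
  import Data.Nat.Tactic.RingSolver as NS
  open import Data.Nat.Combinatorics using () renaming (_C_ to _choose_)
  open import Data.Integer using (ℤ; +_; _+_; _*_; _-_; -_)
  open import Data.Integer.Properties
  open import Data.Integer.Tactic.RingSolver using (solve-∀)
  open import Data.Fin.Subset using (∣_∣)
  open import Data.Product using (_,_)
  open import Relation.Binary.PropositionalEquality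
  open ≡-Reasoning

  sixthMoment : ℕ → ℕ → ℤ
  sixthMoment m zero          = + 4
  sixthMoment m (suc zero)    = + 2 * + (8 ℕ.+ (20 ℕ.* m ℕ.+ 10))
  sixthMoment m (suc (suc _)) = + ((2 ℕ.+ (20 ℕ.* m ℕ.+ 10)) choose 2 ℕ.+ 6 ℕ.* (2 ℕ.+ (20 ℕ.* m ℕ.+ 10)) ℕ.+ 9)

  sixth-factor : ∀ m s → sixth s (20 ℕ.* m ℕ.+ 10) ≡ + (2 ^ (20 ℕ.* m ℕ.+ 10)) * sixthMoment m s
  sixth-factor m zero          = refl
  sixth-factor m (suc zero)    = refl
  sixth-factor m (suc (suc s)) = refl

  -- The moments J, J + 1 and J + 2 with the common factor J! 2^(8m + 2) and the imbalance removed;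
  -- the factors J + 1 and (J + 2)(J + 1) come from the factorials in `moment-weighing`.
  sixthWindow : (m J p q : ℕ) → ℤ
  sixthWindow m J p q = window (punctured (4 ℕ.+ (4 ℕ.* m ℕ.+ 4)) p q) J
    (+ 4) (+ suc J * sixthMoment m 1) (+ (suc (suc J) ℕ.* suc J) * sixthMoment m 2)

  -- The inequality that `equal-ends` asks for, with J! 2^(8m + 2) cancelled. For J = 4m - 2 the
  -- number of interior nodes is J + 3, so `Q` leaves the product of three factors.
  SixthNonvanishing : (m J p q : ℕ) → Set
  SixthNonvanishing m J p q =
    + ((3 ℕ.+ J) ℕ.* (2 ℕ.+ J) ℕ.* (1 ℕ.+ J)) * + (4 ℕ.* suc q ℕ.+ 4 ℕ.* suc p) ≢ sixthWindow m J p q * + (4 ℕ.* suc q ℕ.* (4 ℕ.* suc p))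

  -- In the Newton expansion the terms of degree five and four depend on `T` only through its size,
  -- by balance, and cancel; the term of degree six is containment.
  newton-difference : ∀ {n} (X : Word n → ℤ) b s N → N ≡ 2 ℕ.+ b → s ℕ.≤ 2 → 6 ℕ.≤ n → (∀ k → k ℕ.< 6 → Balanced X k) →
    ∀ T T′ → ∣ T ∣ ≡ 6 → ∣ T′ ∣ ≡ 6 →
    Σw (λ y → X y * profile 6 N s (inside T y)) - Σw (λ y → X y * profile 6 N s (inside T′ y)) ≡ sixth s b * imbalance X T T′
  newton-difference {n} X b s N refl s≤2 6≤n below T T′ T-size T′-size = begin
    Σw (λ y → X y * profile 6 N s (inside T y)) - Σw (λ y → X y * profile 6 N s (inside T′ y))
      ≡⟨ cong₂ _-_ (expand T T-size) (expand T′ T′-size) ⟩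
    (c₆ * covering X T + (c₅ * L 5 T + c₄ * L 4 T)) - (c₆ * covering X T′ + (c₅ * L 5 T′ + c₄ * L 4 T′))
      ≡⟨ cong₂ (λ x y → (c₆ * covering X T + (c₅ * x + c₄ * y)) - (c₆ * covering X T′ + (c₅ * L 5 T′ + c₄ * L 4 T′)))
           (same 5 (ℕₚ.m≤m+n 6 0)) (same 4 (ℕₚ.m≤m+n 5 1)) ⟩
    (c₆ * covering X T + (c₅ * L 5 T′ + c₄ * L 4 T′)) - (c₆ * covering X T′ + (c₅ * L 5 T′ + c₄ * L 4 T′))
      ≡⟨ cancel c₆ (covering X T) (covering X T′) (c₅ * L 5 T′ + c₄ * L 4 T′) ⟩
    c₆ * imbalance X T T′ ∎
    where
    c₆ = sixth s b
    c₅ = fifth s b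
    c₄ = fourth s b
    L : ℕ → Word n → ℤ
    L k T = Σw (λ y → X y * + (inside T y choose k))
    cancel : ∀ s x y r → (s * x + r) - (s * y + r) ≡ s * (x - y)
    cancel = solve-∀
    same : ∀ k → k ℕ.< 6 → L k T ≡ L k T′
    same k k<6 with S , S-size ← ofSize-inhabited {n} {k} (ℕₚ.≤-trans (ℕₚ.<⇒≤ k<6) 6≤n) =
      trans (Σ-inside-choose X T k S (below k k<6) S-size)
        (trans (cong (λ l → + (l choose k) * covering X S) (trans T-size (sym T′-size))) (sym (Σ-inside-choose X T′ k S (below k k<6) S-size)))
    distribute : ∀ x s a f b′ r c → x * (s * a + (f * b′ + r * c)) ≡ s * (x * a) + (f * (x * b′) + r * (x * c))
    distribute = solve-∀
    expand : ∀ T → ∣ T ∣ ≡ 6 → Σw (λ y → X y * profile 6 N s (inside T y)) ≡ c₆ * covering X T + (c₅ * L 5 T + c₄ * L 4 T)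
    expand T T-size = begin
      Σw (λ y → X y * profile 6 N s (inside T y))
        ≡⟨ Σw-cong (λ y → trans (cong (X y *_) (profile-newton b s (inside T y) s≤2 (subst (inside T y ℕ.≤_) T-size (inside≤size T y))))
             (trans (distribute (X y) c₆ (+ (inside T y choose 6)) c₅ (+ (inside T y choose 5)) c₄ (+ (inside T y choose 4)))
             (cong (λ x → c₆ * (X y * x) + (c₅ * (X y * + (inside T y choose 5)) + c₄ * (X y * + (inside T y choose 4))))
               (trans (cong (λ k → + (inside T y choose k)) (sym T-size)) (inside-choose-size T y))))) ⟩
      Σw (λ y → c₆ * (X y * ⟦ T ⊑ y ⟧) + (c₅ * (X y * + (inside T y choose 5)) + c₄ * (X y * + (inside T y choose 4))))
        ≡⟨ trans (Σw-+ (λ y → c₆ * (X y * ⟦ T ⊑ y ⟧)) (λ y → c₅ * (X y * + (inside T y choose 5)) + c₄ * (X y * + (inside T y choose 4))))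
             (cong₂ _+_ (Σw-* c₆ (λ y → X y * ⟦ T ⊑ y ⟧))
               (trans (Σw-+ (λ y → c₅ * (X y * + (inside T y choose 5))) (λ y → c₄ * (X y * + (inside T y choose 4))))
                 (cong₂ _+_ (Σw-* c₅ (λ y → X y * + (inside T y choose 5))) (Σw-* c₄ (λ y → X y * + (inside T y choose 4)))))) ⟩
      c₆ * covering X T + (c₅ * L 5 T + c₄ * L 4 T) ∎

  scaled-factorial : ∀ k J w → k ≡ 3 ℕ.+ J → 4 ^ k ≡ w → + (4 ^ k ℕ.* k !) ≡ + (J !) * + w * + ((3 ℕ.+ J) ℕ.* (2 ℕ.+ J) ℕ.* (1 ℕ.+ J))
  scaled-factorial k J w k≡ 4^k = begin
    + (4 ^ k ℕ.* k !)                   ≡⟨ cong₂ (λ x y → + (x ℕ.* y)) 4^k (trans (cong _! k≡) (unfold (3 ℕ.+ J) (2 ℕ.+ J) (1 ℕ.+ J) (J !))) ⟩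
    + (w ℕ.* (F ℕ.* J !))               ≡⟨ trans (pos-* w (F ℕ.* J !)) (cong (+ w *_) (pos-* F (J !))) ⟩
    + w * (+ F * + (J !))               ≡⟨ reorder (+ w) (+ F) (+ (J !)) ⟩
    + (J !) * + w * + F ∎
    where
    F = (3 ℕ.+ J) ℕ.* (2 ℕ.+ J) ℕ.* (1 ℕ.+ J)
    unfold : ∀ a b c j → a ℕ.* (b ℕ.* (c ℕ.* j)) ≡ a ℕ.* b ℕ.* c ℕ.* j
    unfold = NS.solve-∀
    reorder : ∀ w f j → w * (f * j) ≡ j * w * f
    reorder = solve-∀

  cancel-scale : ∀ Y F S v AB {Q} .{{_ : Data.Integer.NonZero Y}} → Q ≡ Y * F → F * S ≢ v * AB → Q * S ≢ Y * v * AB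
  cancel-scale Y F S v AB refl ≢ e = ≢ (*-cancelˡ-≡ Y (F * S) (v * AB) (trans (sym (*-assoc Y F S)) (trans e (*-assoc Y v AB))))

  module _ (m : ℕ) {C : Code (24 ℕ.* m ℕ.+ 16)} (ext : ExtremalDoublyEvenSelfDual C) where
    private
      n = 24 ℕ.* m ℕ.+ 16
      d₀ = 4 ℕ.* m ℕ.+ 4
      P = 4 ℕ.* m ℕ.+ 2
      g = gapped m ext
      K = 2 ^ (12 ℕ.* m ℕ.+ 8)
      nd = node m ext
      nb = nodeBlock m ext
      X₀ = minBlock m ext

    profileSum-newton : BalancedBelow m ext 6 → ∀ s → s ℕ.≤ 2 → ∀ T T′ → ∣ T ∣ ≡ 6 → ∣ T′ ∣ ≡ 6 →
      profileSum g 6 s T - profileSum g 6 s T′ ≡ sixth s (20 ℕ.* m ℕ.+ 10) * imbalance X₀ T T′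
    profileSum-newton below s s≤2 = newton-difference X₀ (20 ℕ.* m ℕ.+ 10) s (n ∸ d₀) (trans (n∸d m ext) (ring m)) s≤2
      (ℕₚ.≤-trans (ℕₚ.m≤m+n 6 10) (ℕₚ.m≤n+m 16 (24 ℕ.* m))) below
      where
      ring : ∀ m → 20 ℕ.* m ℕ.+ 12 ≡ 2 ℕ.+ (20 ℕ.* m ℕ.+ 10)
      ring = NS.solve-∀

    weighing-sixth : BalancedBelow m ext 6 → ∀ J s → J ℕ.+ 2 ≡ 4 ℕ.* m → s ℕ.≤ 2 → ∀ T T′ → ∣ T ∣ ≡ 6 → ∣ T′ ∣ ≡ 6 →
      weighingMoment m ext T T′ (s ℕ.+ J) ≡ + ((s ℕ.+ J) !) * (+ (2 ^ (8 ℕ.* m ℕ.+ 2)) * imbalance X₀ T T′ * sixthMoment m s)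
    weighing-sixth below J s J≡ s≤2 T T′ T-size T′-size = trans (moment-weighing g T T′ (s ℕ.+ J)) (cong (+ ((s ℕ.+ J) !) *_)
      (K*-cancel m ext (coverSum C T (s ℕ.+ J) - coverSum C T′ (s ℕ.+ J)) (+ (2 ^ (8 ℕ.* m ℕ.+ 2)) * imbalance X₀ T T′ * sixthMoment m s) (begin
      size C * (coverSum C T (s ℕ.+ J) - coverSum C T′ (s ℕ.+ J))
        ≡⟨ coverSum-high g T T′ (s ℕ.+ J) 6 s T-size T′-size index (s≤s (ℕₚ.≤-trans s≤2 (ℕₚ.n≤1+n 2))) ⟩
      profileSum g 6 s T - profileSum g 6 s T′
        ≡⟨ profileSum-newton below s s≤2 T T′ T-size T′-size ⟩
      sixth s b * imbalance X₀ T T′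
        ≡⟨ cong (_* imbalance X₀ T T′) (trans (sixth-factor m s) (cong (_* sixthMoment m s) (pow-split m ext (12 ℕ.* m ℕ.+ 8) (8 ℕ.* m ℕ.+ 2) (ring m)))) ⟩
      + K * + (2 ^ (8 ℕ.* m ℕ.+ 2)) * sixthMoment m s * imbalance X₀ T T′
        ≡⟨ regroup (+ K) (+ (2 ^ (8 ℕ.* m ℕ.+ 2))) (sixthMoment m s) (imbalance X₀ T T′) ⟩
      + K * (+ (2 ^ (8 ℕ.* m ℕ.+ 2)) * imbalance X₀ T T′ * sixthMoment m s) ∎)))
      where
      b = 20 ℕ.* m ℕ.+ 10
      ring : ∀ m → 20 ℕ.* m ℕ.+ 10 ≡ 12 ℕ.* m ℕ.+ 8 ℕ.+ (8 ℕ.* m ℕ.+ 2)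
      ring = NS.solve-∀
      regroup : ∀ k w c δ → k * w * c * δ ≡ k * (w * δ * c)
      regroup = solve-∀
      index : s ℕ.+ J ℕ.+ 6 ≡ d₀ ℕ.+ s
      index = trans (ring₁ s J) (cong (λ x → x ℕ.+ 4 ℕ.+ s) J≡)
        where
        ring₁ : ∀ s J → s ℕ.+ J ℕ.+ 6 ≡ J ℕ.+ 2 ℕ.+ 4 ℕ.+ s
        ring₁ = NS.solve-∀

    -- The polynomial is that of strength four, of degree d - 4. So three moments enter, d - 6, d -
    -- 5 and d - 4; all three see only minimum weight words, thanks to the gap of four.
    step₆ : ∀ p q (p+q : p ℕ.+ q ≡ 4 ℕ.* m) J → J ℕ.+ 2 ≡ 4 ℕ.* m → SixthNonvanishing m J p q →
      BalancedBelow m ext 6 → Balanced (nb (suc p)) 6 → Balanced X₀ 6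
    step₆ p q p+q J J≡ nonvanishing below bal = balanced-from m ext X₀ 6 λ T T′ e e′ →
      equal-ends (imbalance X₀ T T′) (Y * win) (ends T T′ e e′) distinct
      where
      open OnePuncture m ext p q p+q
      win = sixthWindow m J p q
      W = + (2 ^ (8 ℕ.* m ℕ.+ 2))
      Y = + (J !) * W
      ends : ∀ T T′ → ∣ T ∣ ≡ 6 → ∣ T′ ∣ ≡ 6 →
        rootPoly R (+ nd 0) * imbalance X₀ T T′ + rootPoly R (+ nd P) * imbalance X₀ T T′ ≡ Y * win * imbalance X₀ T T′
      ends T T′ e e′ = begin
        rootPoly R (+ nd 0) * δ + rootPoly R (+ nd P) * δ
          ≡⟨ sum-E 5 ℕₚ.≤-refl below refl bal T T′ e e′ ⟨
        sumOver E (λ i → rootPoly R (+ nd i) * imb m ext i T T′)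
          ≡⟨ node-sum m ext T T′ e e′ (rootPoly R) E E-unique E-bounded E-vanish ⟨
        Σw (λ c → weighing g T T′ c * rootPoly R (+ zeros c))
          ≡⟨ Σ-rootPoly (λ c → + zeros c) R (weighing g T T′) ⟩
        apply R (weighingMoment m ext T T′) 0
          ≡⟨ apply-window R J (+ (J !) * (W * δ)) (trans len-R (trans (sym J≡) (ℕₚ.+-comm J 2)))
               (λ j j<J → weighing-low m ext T T′ j (trans e (sym e′)) (subst₂ (λ k l → k ℕ.+ j ℕ.< l) (sym e) six (ℕₚ.+-monoʳ-< 6 j<J)))
               (trans (weighing-sixth below J 0 J≡ z≤n T T′ e e′) (sym (*-assoc (+ (J !)) (W * δ) (+ 4))))
               (trans (weighing-sixth below J 1 J≡ (s≤s z≤n) T T′ e e′) (trans (cong (_* (W * δ * sixthMoment m 1)) (pos-* (suc J) (J !)))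
                 (ring₁ (+ suc J) (+ (J !)) (W * δ) (sixthMoment m 1))))
               (trans (weighing-sixth below J 2 J≡ ℕₚ.≤-refl T T′ e e′) (trans (cong (_* (W * δ * sixthMoment m 2)) fact₂)
                 (ring₁ (+ (suc (suc J) ℕ.* suc J)) (+ (J !)) (W * δ) (sixthMoment m 2)))) ⟩
        + (J !) * (W * δ) * win
          ≡⟨ ring₂ (+ (J !)) W δ win ⟩
        Y * win * δ ∎
        where
        δ = imbalance X₀ T T′
        ring₁ : ∀ s j w c → s * j * (w * c) ≡ j * w * (s * c)
        ring₁ = solve-∀
        ring₂ : ∀ j w δ v → j * (w * δ) * v ≡ j * w * v * δ
        ring₂ = solve-∀
        fact₂ : + (suc (suc J) ℕ.* (suc J ℕ.* J !)) ≡ + (suc (suc J) ℕ.* suc J) * + (J !)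
        fact₂ = trans (cong +_ (sym (ℕₚ.*-assoc (suc (suc J)) (suc J) (J !)))) (pos-* (suc (suc J) ℕ.* suc J) (J !))
        six : 6 ℕ.+ J ≡ d₀
        six = trans (ring J) (cong (ℕ._+ 4) J≡)
          where
          ring : ∀ J → 6 ℕ.+ J ≡ J ℕ.+ 2 ℕ.+ 4
          ring = NS.solve-∀
      exponent : 4 ^ (p ℕ.+ suc q) ≡ 2 ^ (8 ℕ.* m ℕ.+ 2)
      exponent = trans (4^k≡2^2k (p ℕ.+ suc q)) (cong (2 ^_) (trans (ring₁ p q) (trans (cong (λ x → 2 ℕ.* x ℕ.+ 2) p+q) (ring₂ m))))
        where
        ring₁ : ∀ p q → 2 ℕ.* (p ℕ.+ suc q) ≡ 2 ℕ.* (p ℕ.+ q) ℕ.+ 2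
        ring₁ = NS.solve-∀
        ring₂ : ∀ m → 2 ℕ.* (4 ℕ.* m) ℕ.+ 2 ≡ 8 ℕ.* m ℕ.+ 2
        ring₂ = NS.solve-∀
      k≡ : p ℕ.+ suc q ≡ 3 ℕ.+ J
      k≡ = trans (ℕₚ.+-suc p q) (cong suc (trans p+q (trans (sym J≡) (ℕₚ.+-comm J 2))))
      nz : Data.Integer.NonZero Y
      nz = subst Data.Integer.NonZero (pos-* (J !) (2 ^ (8 ℕ.* m ℕ.+ 2)))
        (ℕₚ.m*n≢0 (J !) (2 ^ (8 ℕ.* m ℕ.+ 2)) {{ℕₚ._!≢0 J}} {{ℕₚ.m^n≢0 2 (8 ℕ.* m ℕ.+ 2)}})
      distinct : Q * (A + B) ≢ Y * win * (A * B)
      distinct = cancel-scale Y (+ ((3 ℕ.+ J) ℕ.* (2 ℕ.+ J) ℕ.* (1 ℕ.+ J))) (A + B) win (A * B) {{nz}}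
        (scaled-factorial (p ℕ.+ suc q) J (2 ^ (8 ℕ.* m ℕ.+ 2)) k≡ exponent)
        (subst (λ x → + ((3 ℕ.+ J) ℕ.* (2 ℕ.+ J) ℕ.* (1 ℕ.+ J)) * + (4 ℕ.* suc q ℕ.+ 4 ℕ.* suc p) ≢ win * x) (pos-* (4 ℕ.* suc q) (4 ℕ.* suc p)) nonvanishing)

-- Exact evaluation of long binomial sums by term ratios.

module ExactSums where
  open WordSums
  open Incidence
  open RootPolynomials
  open Progressions
  open import Data.Bool using (Bool; true)
  open import Data.Nat as ℕ using (ℕ; zero; suc; s≤s; _≡ᵇ_)
  import Data.Nat.Properties as ℕₚ
  import Data.Nat.DivMod as ℕᵈ
  open import Data.Nat.Combinatorics using () renaming (_C_ to _choose_)
  open import Data.Integer as ℤ using (ℤ; +_; 0ℤ; 1ℤ; -[1+_]; +[1+_]; _+_; _*_; _-_; -_; ∣_∣)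
  open import Data.Integer.Properties
  open import Data.Integer.DivMod using (_/_; _%_; a≡a%n+[a/n]*n; n%d<d)
  open import Data.Integer.Tactic.RingSolver using (solve-∀)
  open import Data.List using (List; _∷_)
  open import Data.Empty using (⊥-elim)
  open import Function using (_∘_)
  open import Relation.Binary.PropositionalEquality
  open ≡-Reasoning

  consecutive : ℕ → ℕ → (ℕ → ℤ) → ℤ
  consecutive zero    i f = 0ℤ
  consecutive (suc L) i f = f i + consecutive L (suc i) f

  consecutive-shift : ∀ L i f → consecutive L (suc i) f ≡ consecutive L i (f ∘ suc)
  consecutive-shift zero    i f = refl
  consecutive-shift (suc L) i f = cong (λ x → f (suc i) + x) (consecutive-shift L (suc i) f)

  consecutive-0 : ∀ L i {f} → (∀ j → i ℕ.≤ j → f j ≡ 0ℤ) → consecutive L i f ≡ 0ℤ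
  consecutive-0 zero    i h = refl
  consecutive-0 (suc L) i h = cong₂ _+_ (h i ℕₚ.≤-refl) (consecutive-0 L (suc i) (λ j i<j → h j (ℕₚ.<⇒≤ i<j)))

  consecutive-+ : ∀ L i f g → consecutive L i (λ j → f j + g j) ≡ consecutive L i f + consecutive L i g
  consecutive-+ zero    i f g = refl
  consecutive-+ (suc L) i f g = trans (cong (λ x → f i + g i + x) (consecutive-+ L (suc i) f g)) (interchange (f i) (g i) _ _)

  consecutive-cong : ∀ L i {f g} → (∀ j → f j ≡ g j) → consecutive L i f ≡ consecutive L i g
  consecutive-cong zero    i h = refl
  consecutive-cong (suc L) i h = cong₂ _+_ (h i) (consecutive-cong L (suc i) h)

  -- Any `L` beyond `n` will do because further binomials vanish; this allows the range to be
  -- rounded up to a multiple of four.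
  Σw-zeros : ∀ n (h : ℕ → ℤ) L → n ℕ.< L → Σw {n} (λ x → h (zeros x)) ≡ consecutive L 0 (λ i → + (n choose i) * h i)
  Σw-zeros zero    h (suc L) _ = sym (trans (cong₂ _+_ (*-identityˡ (h 0))
    (trans (consecutive-shift L 0 (λ i → + (0 choose i) * h i)) (consecutive-0 L 0 (λ j _ → refl)))) (+-identityʳ (h 0)))
  Σw-zeros (suc n) h (suc L) (s≤s n<L) = begin
    Σw {n} (λ x → h (suc (zeros x))) + Σw {n} (λ x → h (zeros x))
      ≡⟨ cong₂ _+_ (Σw-zeros n (h ∘ suc) L n<L) (Σw-zeros n h (suc L) (ℕₚ.m<n⇒m<1+n n<L)) ⟩
    consecutive L 0 (λ i → + (n choose i) * h (suc i)) + (1ℤ * h 0 + consecutive L 1 (λ i → + (n choose i) * h i))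
      ≡⟨ cong (λ x → consecutive L 0 (λ i → + (n choose i) * h (suc i)) + (1ℤ * h 0 + x)) (consecutive-shift L 0 (λ i → + (n choose i) * h i)) ⟩
    consecutive L 0 (λ i → + (n choose i) * h (suc i)) + (1ℤ * h 0 + consecutive L 0 (λ i → + (n choose suc i) * h (suc i)))
      ≡⟨ rotate (consecutive L 0 (λ i → + (n choose i) * h (suc i))) (1ℤ * h 0) _ ⟩
    1ℤ * h 0 + (consecutive L 0 (λ i → + (n choose i) * h (suc i)) + consecutive L 0 (λ i → + (n choose suc i) * h (suc i)))
      ≡⟨ cong (λ x → 1ℤ * h 0 + x) (sym (consecutive-+ L 0 (λ i → + (n choose i) * h (suc i)) (λ i → + (n choose suc i) * h (suc i)))) ⟩
    1ℤ * h 0 + consecutive L 0 (λ i → + (n choose i) * h (suc i) + + (n choose suc i) * h (suc i))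
      ≡⟨ cong (λ x → 1ℤ * h 0 + x) (trans (consecutive-cong L 0 (λ i → trans (sym (*-distribʳ-+ (h (suc i)) (+ (n choose i)) (+ (n choose suc i))))
           (cong (_* h (suc i)) (sym (pascal n i))))) (sym (consecutive-shift L 0 (λ i → + (suc n choose i) * h i)))) ⟩
    1ℤ * h 0 + consecutive L 1 (λ i → + (suc n choose i) * h i) ∎
    where
    rotate : ∀ a b c → a + (b + c) ≡ b + (a + c)
    rotate = solve-∀

  -- The roots have spacing four, so successive terms of one residue class modulo 4 have a ratio
  -- with few factors.
  everyFourth : ℕ → ℕ → (ℕ → ℤ) → ℤ
  everyFourth zero    i f = 0ℤ
  everyFourth (suc N) i f = f i + everyFourth N (4 ℕ.+ i) f

  consecutive-everyFourth : ∀ N i f → consecutive (N ℕ.* 4) i f ≡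
    everyFourth N i f + everyFourth N (1 ℕ.+ i) f + everyFourth N (2 ℕ.+ i) f + everyFourth N (3 ℕ.+ i) f
  consecutive-everyFourth zero    i f = refl
  consecutive-everyFourth (suc N) i f = trans
    (cong (λ x → f i + (f (1 ℕ.+ i) + (f (2 ℕ.+ i) + (f (3 ℕ.+ i) + x)))) (consecutive-everyFourth N (4 ℕ.+ i) f))
    (regroup (f i) (f (1 ℕ.+ i)) (f (2 ℕ.+ i)) (f (3 ℕ.+ i)) (everyFourth N (4 ℕ.+ i) f) (everyFourth N (5 ℕ.+ i) f) (everyFourth N (6 ℕ.+ i) f) (everyFourth N (7 ℕ.+ i) f))
    where
    regroup : ∀ a b c d p q r s → a + (b + (c + (d + (p + q + r + s)))) ≡ a + p + (b + q) + (c + r) + (d + s)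
    regroup = solve-∀

  -- A division that falls back on the first argument at divisor 0, so that a recurrence can be run
  -- without first proving that its denominators are nonzero.
  divideOr : ℤ → ℤ → ℤ → ℤ
  divideOr y x (+ zero)       = y
  divideOr y x d@(+[1+ _ ])   = x / d
  divideOr y x d@(-[1+ _ ])   = x / d

  exact-quotient : ∀ y d .{{_ : ℤ.NonZero d}} → (y * d) / d ≡ y
  exact-quotient y d = sym (i-j≡0⇒i≡j y ((y * d) / d) (∣i∣≡0⇒i≡0 (small ∣ y - (y * d) / d ∣ ∣ d ∣ (begin
    ∣ y - (y * d) / d ∣ ℕ.* ∣ d ∣     ≡⟨ abs-* (y - (y * d) / d) d ⟨
    ∣ (y - (y * d) / d) * d ∣         ≡⟨ cong ∣_∣ difference ⟩
    (y * d) % d ∎) (n%d<d (y * d) d))))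
    where
    ring : ∀ y q d → (y - q) * d ≡ y * d - q * d
    ring = solve-∀
    cancel : ∀ r x → r + x - x ≡ r
    cancel = solve-∀
    difference : (y - (y * d) / d) * d ≡ + ((y * d) % d)
    difference = trans (ring y ((y * d) / d) d) (trans (cong (λ x → x - (y * d) / d * d) (a≡a%n+[a/n]*n (y * d) d)) (cancel (+ ((y * d) % d)) ((y * d) / d * d)))
    small : ∀ a b {r} → a ℕ.* b ≡ r → r ℕ.< b → a ≡ 0
    small zero    b e r<b = refl
    small (suc a) b e r<b = ⊥-elim (ℕₚ.<⇒≱ r<b (subst (b ℕ.≤_) e (ℕₚ.m≤m+n b (a ℕ.* b))))

  divideOr-exact : ∀ y {x d} → y * d ≡ x → divideOr y x d ≡ y
  divideOr-exact y {d = + zero}     e = refl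
  divideOr-exact y {d = +[1+ k ]}   e = trans (cong (_/ +[1+ k ]) (sym e)) (exact-quotient y +[1+ k ])
  divideOr-exact y {d = -[1+ k ]}   e = trans (cong (_/ -[1+ k ]) (sym e)) (exact-quotient y -[1+ k ])

  progression-shift : ∀ a k z → rootPoly (progression (4 ℕ.+ a) k) (+ 4 + z) ≡ rootPoly (progression a k) z
  progression-shift a zero    z = refl
  progression-shift a (suc k) z = cong₂ _*_ (cancel (+ a) z) (progression-shift (4 ℕ.+ a) k z)
    where
    cancel : ∀ a z → + 4 + z - (+ 4 + a) ≡ z - a
    cancel = solve-∀

  -- Moving the argument by 4 shifts the factors by one place: one factor enters at one end of the
  -- progression and one leaves at the other.
  progression-ratio : ∀ a k z →
    rootPoly (progression a k) (+ 4 + z) * (+ 4 + z - + (a ℕ.+ 4 ℕ.* k)) ≡ rootPoly (progression a k) z * (+ 4 + z - + a)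
  progression-ratio a k z = begin
    rootPoly (progression a k) (+ 4 + z) * (+ 4 + z - + (a ℕ.+ 4 ℕ.* k))
      ≡⟨ progression-snoc a k (+ 4 + z) ⟨
    (+ 4 + z - + a) * rootPoly (progression (4 ℕ.+ a) k) (+ 4 + z)
      ≡⟨ cong ((+ 4 + z - + a) *_) (progression-shift a k z) ⟩
    (+ 4 + z - + a) * rootPoly (progression a k) z
      ≡⟨ *-comm (+ 4 + z - + a) _ ⟩
    rootPoly (progression a k) z * (+ 4 + z - + a) ∎

  binomial-ratio : ∀ n i → + (n choose (4 ℕ.+ i)) * (+ suc i * + (2 ℕ.+ i) * + (3 ℕ.+ i) * + (4 ℕ.+ i))
    ≡ + (n choose i) * ((+ n - + i) * (+ n - + suc i) * (+ n - + (2 ℕ.+ i)) * (+ n - + (3 ℕ.+ i)))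
  binomial-ratio n i = begin
    c₄ * (s₁ * s₂ * s₃ * s₄)       ≡⟨ r₁ c₄ s₁ s₂ s₃ s₄ ⟩
    c₄ * s₄ * (s₁ * s₂ * s₃)       ≡⟨ cong (_* (s₁ * s₂ * s₃)) (absorption n (3 ℕ.+ i)) ⟩
    c₃ * t₃ * (s₁ * s₂ * s₃)       ≡⟨ r₂ c₃ t₃ s₁ s₂ s₃ ⟩
    c₃ * s₃ * (t₃ * s₁ * s₂)       ≡⟨ cong (_* (t₃ * s₁ * s₂)) (absorption n (2 ℕ.+ i)) ⟩
    c₂ * t₂ * (t₃ * s₁ * s₂)       ≡⟨ r₂′ c₂ t₂ t₃ s₁ s₂ ⟩
    c₂ * s₂ * (t₂ * t₃ * s₁)       ≡⟨ cong (_* (t₂ * t₃ * s₁)) (absorption n (1 ℕ.+ i)) ⟩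
    c₁ * t₁ * (t₂ * t₃ * s₁)       ≡⟨ r₂′′ c₁ t₁ t₂ t₃ s₁ ⟩
    c₁ * s₁ * (t₁ * t₂ * t₃)       ≡⟨ cong (_* (t₁ * t₂ * t₃)) (absorption n i) ⟩
    c₀ * t₀ * (t₁ * t₂ * t₃)       ≡⟨ r₃ c₀ t₀ t₁ t₂ t₃ ⟩
    c₀ * (t₀ * t₁ * t₂ * t₃) ∎
    where
    c₀ = + (n choose i)
    c₁ = + (n choose suc i)
    c₂ = + (n choose (2 ℕ.+ i))
    c₃ = + (n choose (3 ℕ.+ i))
    c₄ = + (n choose (4 ℕ.+ i))
    s₁ = + suc i
    s₂ = + (2 ℕ.+ i)
    s₃ = + (3 ℕ.+ i)
    s₄ = + (4 ℕ.+ i)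
    t₀ = + n - + i
    t₁ = + n - + suc i
    t₂ = + n - + (2 ℕ.+ i)
    t₃ = + n - + (3 ℕ.+ i)
    r₁ : ∀ c a b d e → c * (a * b * d * e) ≡ c * e * (a * b * d)
    r₁ = solve-∀
    r₂ : ∀ c t a b d → c * t * (a * b * d) ≡ c * d * (t * a * b)
    r₂ = solve-∀
    r₂′ : ∀ c t u a b → c * t * (u * a * b) ≡ c * b * (t * u * a)
    r₂′ = solve-∀
    r₂′′ : ∀ c t u v a → c * t * (u * v * a) ≡ c * a * (t * u * v)
    r₂′′ = solve-∀
    r₃ : ∀ c t u v w → c * t * (u * v * w) ≡ c * (t * u * v * w)
    r₃ = solve-∀

  module _ (n a p q : ℕ) where
    -- The root 0 removes the all-one word, and the punctured progression every node but one. Of the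
    -- codewords there remain the zero word and those at the missing node.
    weightRoots : List ℕ
    weightRoots = 0 ∷ punctured a p q

    term : ℕ → ℤ
    term i = + (n choose i) * rootPoly weightRoots (+ i)

    a′ = a ℕ.+ 4 ℕ.* suc p

    -- The ratio of terms four places apart: four factors of the binomial, the factor of the root 0,
    -- and one entering and one leaving factor for each half of the punctured progression.
    numerator denominator : ℕ → ℤ
    numerator i = (+ n - + i) * (+ n - + suc i) * (+ n - + (2 ℕ.+ i)) * (+ n - + (3 ℕ.+ i))
      * (+ (4 ℕ.+ i) * ((+ (4 ℕ.+ i) - + a) * (+ (4 ℕ.+ i) - + a′)))
    denominator i = + suc i * + (2 ℕ.+ i) * + (3 ℕ.+ i) * + (4 ℕ.+ i)
      * (+ i * ((+ (4 ℕ.+ i) - + (a ℕ.+ 4 ℕ.* p)) * (+ (4 ℕ.+ i) - + (a′ ℕ.+ 4 ℕ.* q))))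

    term-ratio : ∀ i → term (4 ℕ.+ i) * denominator i ≡ term i * numerator i
    term-ratio i = begin
      c₄ * ((z₄ - 0ℤ) * rootPoly (punctured a p q) z₄) * (S * (z * (u * v)))
        ≡⟨ cong (λ x → c₄ * ((z₄ - 0ℤ) * x) * (S * (z * (u * v)))) (rootPoly-++ (progression a p) (progression a′ q) z₄) ⟩
      c₄ * ((z₄ - 0ℤ) * (A₄ * B₄)) * (S * (z * (u * v)))
        ≡⟨ r₁ c₄ z₄ A₄ B₄ S z u v ⟩
      c₄ * S * (z * z₄ * (A₄ * u * (B₄ * v)))
        ≡⟨ cong₂ (λ x y → x * (z * z₄ * y)) (binomial-ratio n i) (cong₂ _*_ (progression-ratio a p z) (progression-ratio a′ q z)) ⟩
      c₀ * N * (z * z₄ * (A * (z₄ - + a) * (B * (z₄ - + a′))))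
        ≡⟨ r₂ c₀ z A B N z₄ (z₄ - + a) (z₄ - + a′) ⟩
      c₀ * ((z - 0ℤ) * (A * B)) * (N * (z₄ * ((z₄ - + a) * (z₄ - + a′))))
        ≡⟨ cong (λ x → c₀ * ((z - 0ℤ) * x) * (N * (z₄ * ((z₄ - + a) * (z₄ - + a′))))) (rootPoly-++ (progression a p) (progression a′ q) z) ⟨
      c₀ * ((z - 0ℤ) * rootPoly (punctured a p q) z) * (N * (z₄ * ((z₄ - + a) * (z₄ - + a′)))) ∎
      where
      z = + i
      z₄ = + (4 ℕ.+ i)
      c₀ = + (n choose i)
      c₄ = + (n choose (4 ℕ.+ i))
      S = + suc i * + (2 ℕ.+ i) * + (3 ℕ.+ i) * + (4 ℕ.+ i)
      N = (+ n - + i) * (+ n - + suc i) * (+ n - + (2 ℕ.+ i)) * (+ n - + (3 ℕ.+ i))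
      u = z₄ - + (a ℕ.+ 4 ℕ.* p)
      v = z₄ - + (a′ ℕ.+ 4 ℕ.* q)
      A = rootPoly (progression a p) z
      B = rootPoly (progression a′ q) z
      A₄ = rootPoly (progression a p) z₄
      B₄ = rootPoly (progression a′ q) z₄
      r₁ : ∀ c w A B S z u v → c * ((w - 0ℤ) * (A * B)) * (S * (z * (u * v))) ≡ c * S * (z * w * (A * u * (B * v)))
      r₁ = solve-∀
      r₂ : ∀ c z A B N w x y → c * N * (z * w * (A * x * (B * y))) ≡ c * ((z - 0ℤ) * (A * B)) * (N * (w * (x * y)))
      r₂ = solve-∀

    -- When the denominator vanishes the ratio is of no use and the term is recomputed from its definition.
    run : ℕ → ℕ → ℤ → ℤ
    run zero    i s = 0ℤ
    run (suc N) i s = s + run N (4 ℕ.+ i) (divideOr (term (4 ℕ.+ i)) (s * numerator i) (denominator i))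

    run-correct : ∀ N i s → s ≡ term i → run N i s ≡ everyFourth N i term
    run-correct zero    i s e    = refl
    run-correct (suc N) i s refl = cong (λ x → term i + x) (run-correct N (4 ℕ.+ i) _ (divideOr-exact (term (4 ℕ.+ i)) (term-ratio i)))

    fastSum : ℕ → ℤ
    fastSum N = run N 0 (term 0) + run N 1 (term 1) + run N 2 (term 2) + run N 3 (term 3)

    fastSum-correct : ∀ N → n ℕ.< N ℕ.* 4 → Σw {n} (λ x → rootPoly weightRoots (+ zeros x)) ≡ fastSum N
    fastSum-correct N n<4N = begin
      Σw {n} (λ x → rootPoly weightRoots (+ zeros x))
        ≡⟨ Σw-zeros n (λ i → rootPoly weightRoots (+ i)) (N ℕ.* 4) n<4N ⟩
      consecutive (N ℕ.* 4) 0 term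
        ≡⟨ consecutive-everyFourth N 0 term ⟩
      everyFourth N 0 term + everyFourth N 1 term + everyFourth N 2 term + everyFourth N 3 term
        ≡⟨ cong₂ _+_ (cong₂ _+_ (cong₂ _+_ (run-correct N 0 _ refl) (run-correct N 1 _ refl)) (run-correct N 2 _ refl)) (run-correct N 3 _ refl) ⟨
      fastSum N ∎

  -- Completeness is what matters: the answer `false` refutes divisibility. The answer for divisor 0
  -- is chosen accordingly.
  _divides?_ : ℕ → ℕ → Bool
  zero  divides? b = true
  suc a divides? b = b ℕ.% suc a ≡ᵇ 0

  divides?-complete : ∀ a b k → a * k ≡ b → (∣ a ∣ divides? ∣ b ∣) ≡ true
  divides?-complete a b k refl rewrite abs-* a k with ∣ a ∣
  ... | zero  = refl
  ... | suc c = cong (_≡ᵇ 0) (trans (cong (ℕ._% suc c) (ℕₚ.*-comm (suc c) ∣ k ∣)) (ℕᵈ.m*n%n≡0 ∣ k ∣ (suc c)))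

-- The number of codewords of each weight and the integrality of covering numbers.

module BlockCounts where
  open WordSums
  open Incidence
  open Designs
  open Complements
  open RootPolynomials
  open Moments
  open Progressions
  open ExtremalCodes
  open NodeSums
  open ExactSums
  open import Data.Bool using (Bool; true; false; _∧_)
  open import Data.Nat as ℕ using (ℕ; suc; z≤n; s≤s; _∸_; _≡ᵇ_; _^_)
  import Data.Nat.Properties as ℕₚ
  import Data.Nat.Tactic.RingSolver as NS
  open import Data.Nat.Combinatorics using () renaming (_C_ to _choose_)
  open import Data.Integer using (ℤ; +_; 0ℤ; 1ℤ; _+_; _*_; _-_; -_; ∣_∣)
  open import Data.Integer.Properties
  open import Data.Integer.Tactic.RingSolver using (solve-∀)
  import Data.Fin.Subset as Subset
  open import Data.List using (length)
  open import Data.Product using (_,_)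
  open import Data.Sum using (inj₁; inj₂)
  open import Relation.Nullary using (yes; no)
  open import Relation.Binary.PropositionalEquality
  open ≡-Reasoning

  halfSize : ℕ → ℕ
  halfSize m = 2 ^ (12 ℕ.* m ℕ.+ 8)

  wroots : (m p q : ℕ) → Data.List.List ℕ
  wroots m p q = weightRoots (24 ℕ.* m ℕ.+ 16) (4 ℕ.* m ℕ.+ 4) p q

  -- excess m p q divided by scale m p q is the number of codewords with exactly 4m + 4 + 4p zeros, when p + q = 4m + 2.
  scale excess : (m p q : ℕ) → ℤ
  scale m p q  = + halfSize m * rootPoly (wroots m p q) (+ (4 ℕ.* m ℕ.+ 4 ℕ.+ 4 ℕ.* p))
  excess m p q = fastSum (24 ℕ.* m ℕ.+ 16) (4 ℕ.* m ℕ.+ 4) p q (6 ℕ.* m ℕ.+ 5) - + halfSize m * rootPoly (wroots m p q) (+ (24 ℕ.* m ℕ.+ 16))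

  -- With A_w = excess / scale blocks, λ_t = A_w (w choose t) / (n choose t) has to be an integer;
  -- cross-multiplication makes this one divisibility.
  integral : (m p q t : ℕ) → Bool
  integral m p q t = ∣ + (n choose t) * scale m p q ∣ divides? ∣ + ((n ∸ (4 ℕ.* m ℕ.+ 4 ℕ.+ 4 ℕ.* p)) choose t) * excess m p q ∣
    where n = 24 ℕ.* m ℕ.+ 16

  module _ (m : ℕ) {C : Code (24 ℕ.* m ℕ.+ 16)} (ext : ExtremalDoublyEvenSelfDual C) where
    private
      n = 24 ℕ.* m ℕ.+ 16
      d₀ = 4 ℕ.* m ℕ.+ 4
      P = 4 ℕ.* m ℕ.+ 2
      g = gapped m ext
      nd = node m ext
      nb = nodeBlock m ext

    module _ (p q : ℕ) (p+q : p ℕ.+ q ≡ P) where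
      private
        q₀ : ℤ → ℤ
        q₀ = rootPoly (wroots m p q)

        p≤P : p ℕ.≤ P
        p≤P = subst (p ℕ.≤_) p+q (ℕₚ.m≤m+n p q)

        length<d : length (wroots m p q) ℕ.< d₀
        length<d = ℕₚ.≤-reflexive (trans (cong (λ k → suc (suc k)) (trans (length-punctured d₀ p q) p+q)) (ring m))
          where
          ring : ∀ m → suc (suc (4 ℕ.* m ℕ.+ 2)) ≡ 4 ℕ.* m ℕ.+ 4
          ring = NS.solve-∀

      nodeWeight≥d : d₀ ℕ.≤ nodeWeight m ext p
      nodeWeight≥d = ℕₚ.≤-trans (ℕₚ.≤-reflexive (sym (nodeWeight-P m ext))) (ℕₚ.∸-monoʳ-≤ n (ℕₚ.+-monoʳ-≤ d₀ (ℕₚ.*-monoʳ-≤ 4 p≤P)))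

      nodeWeight+node : nodeWeight m ext p ℕ.+ nd p ≡ n
      nodeWeight+node = ℕₚ.m∸n+n≡m (node≤n m ext p≤P)

      codewords-split : ∀ c → ⟦ C c ⟧ * q₀ (+ zeros c) ≡ block C 0 c * q₀ (+ n) + nb p c * q₀ (+ nd p)
      codewords-split c = go (C c) refl
        where
        W = Subset.∣ c ∣
        Split : Set
        Split = ⟦ C c ⟧ * q₀ (+ zeros c) ≡ block C 0 c * q₀ (+ n) + nb p c * q₀ (+ nd p)
        split : ∀ {a b x y z} → ⟦ C c ⟧ ≡ a → q₀ (+ zeros c) ≡ b → block C 0 c ≡ x → nb p c ≡ y → a * b ≡ z → x * q₀ (+ n) + y * q₀ (+ nd p) ≡ z → Split
        split refl refl refl refl e e′ = trans e (sym e′)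
        none : ∀ x y → 0ℤ * x + 0ℤ * y ≡ 0ℤ
        none = solve-∀
        first : ∀ x y → 1ℤ * x + 0ℤ * y ≡ 1ℤ * x
        first = solve-∀
        second : ∀ x y → 0ℤ * x + 1ℤ * y ≡ 1ℤ * y
        second = solve-∀
        zeros≡ : ∀ {w} → W ≡ w → zeros c ≡ n ∸ w
        zeros≡ refl = trans (sym (ℕₚ.m+n∸n≡m (zeros c) W)) (cong (_∸ W) (zeros+weight c))
        0<d : 0 ℕ.< d₀
        0<d = Gapped.d>0 g
        nd-p<n : nd p ℕ.< n
        nd-p<n = subst (nd p ℕ.<_) nodeWeight+node (ℕₚ.m<n+m (nd p) (ℕₚ.<-≤-trans 0<d nodeWeight≥d))
        0<nd : ∀ i → 0 ℕ.< nd i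
        0<nd i = ℕₚ.<-≤-trans 0<d (ℕₚ.m≤m+n d₀ (4 ℕ.* i))
        on : ∀ {w} → C c ≡ true → W ≡ w → block C w c ≡ 1ℤ
        on c∈ e = cong₂ (λ a b → ⟦ a ∧ b ⟧) c∈ (≡ᵇ-⇔ {0} {0} (λ _ → e) (λ _ → refl))
        off : ∀ {w} → W ≢ w → block C w c ≡ 0ℤ
        off {w} = block-ofWeight C w c
        go : ∀ b → C c ≡ b → Split
        go false c∉ = split (cong ⟦_⟧ c∉) refl (cong (λ b → ⟦ b ∧ (W ≡ᵇ 0) ⟧) c∉) (cong (λ b → ⟦ b ∧ (W ≡ᵇ nodeWeight m ext p) ⟧) c∉)
          (*-zeroˡ (q₀ (+ zeros c))) (none (q₀ (+ n)) (q₀ (+ nd p)))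
        go true c∈ with node-form m ext c c∈
        ... | inj₁ W≡0 = split (cong ⟦_⟧ c∈) (cong (λ z → q₀ (+ z)) (zeros≡ W≡0)) (on c∈ W≡0)
                (off (λ e → ℕₚ.<⇒≢ (ℕₚ.<-≤-trans 0<d nodeWeight≥d) (trans (sym W≡0) e))) refl (first (q₀ (+ n)) (q₀ (+ nd p)))
        ... | inj₂ (inj₁ W≡n) = split (cong ⟦_⟧ c∈) (trans (cong (λ z → q₀ (+ z)) (trans (zeros≡ W≡n) (ℕₚ.n∸n≡0 n))) (*-zeroˡ (rootPoly (punctured d₀ p q) 0ℤ)))
                (off (λ e → ℕₚ.<⇒≢ (ℕₚ.<-trans (0<nd p) nd-p<n) (trans (sym e) W≡n)))
                (off (λ e → ℕₚ.<⇒≢ (subst (nodeWeight m ext p ℕ.<_) nodeWeight+node (ℕₚ.m<m+n (nodeWeight m ext p) (0<nd p))) (trans (sym e) W≡n)))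
                refl (none (q₀ (+ n)) (q₀ (+ nd p)))
        ... | inj₂ (inj₂ (i , i≤P , z≡)) with i ℕ.≟ p
        ...   | yes refl = split (cong ⟦_⟧ c∈) (cong (λ z → q₀ (+ z)) z≡)
                (off (λ e → ℕₚ.<⇒≢ nd-p<n (trans (sym z≡) (zeros≡ e))))
                (on c∈ (trans (sym (ℕₚ.m+n∸m≡n (zeros c) W)) (cong₂ _∸_ (zeros+weight c) z≡))) refl (second (q₀ (+ n)) (q₀ (+ nd p)))
        ...   | no i≢p = split (cong ⟦_⟧ c∈) (trans (cong (λ z → q₀ (+ z)) z≡) (trans (cong ((+ nd i - 0ℤ) *_)
                  (punctured-root d₀ p q i (subst (i ℕ.≤_) (sym p+q) i≤P) i≢p)) (*-zeroʳ (+ nd i - 0ℤ))))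
                (off (λ e → i≢n i≤P (trans (sym z≡) (zeros≡ e))))
                (off (λ e → i≢p (node-injective d₀ (trans (sym z≡) (trans (zeros≡ e) (ℕₚ.m∸[m∸n]≡n (node≤n m ext p≤P)))))))
                refl (none (q₀ (+ n)) (q₀ (+ nd p)))
          where
          i≢n : ∀ {i} → i ℕ.≤ P → nd i ≢ n
          i≢n {i} i≤P e = ℕₚ.<⇒≢ (ℕₚ.≤-<-trans (ℕₚ.+-monoʳ-≤ d₀ (ℕₚ.*-monoʳ-≤ 4 i≤P)) nd-P<n) e
            where
            nd-P<n : nd P ℕ.< n
            nd-P<n = subst (nd P ℕ.<_) (trans (cong (λ k → nd P ℕ.+ k) (sym (nodeWeight-P m ext))) (ℕₚ.m+[n∸m]≡n (node≤n m ext {P} ℕₚ.≤-refl))) (ℕₚ.m<m+n (nd P) 0<d)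

      block-zero : Σw (block C 0) ≡ 1ℤ
      block-zero = trans (Σw-single (λ c ≢0 → block-ofWeight C 0 c ≢0))
        (cong₂ (λ a k → ⟦ a ∧ (k ≡ᵇ 0) ⟧) (empty∈C {n} {C} (isSelfDual m ext)) (size-empty n))

      -- `quadrature` applies because the degree 4m + 3 is d - 1; the contribution of the zero word
      -- is moved to the other side.
      block-count : scale m p q * Σw (nb p) ≡ excess m p q
      block-count = begin
        + halfSize m * q₀ (+ nd p) * Σw (nb p)
          ≡⟨ ring (+ halfSize m) (q₀ (+ nd p)) (Σw (nb p)) (q₀ (+ n)) ⟩
        + halfSize m * (q₀ (+ n) * 1ℤ + q₀ (+ nd p) * Σw (nb p)) - + halfSize m * q₀ (+ n)
          ≡⟨ cong (_- + halfSize m * q₀ (+ n)) (begin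
            + halfSize m * (q₀ (+ n) * 1ℤ + q₀ (+ nd p) * Σw (nb p))
              ≡⟨ cong₂ _*_ (sym (size-value m ext)) (sym total) ⟩
            size C * Σw (λ c → ⟦ C c ⟧ * q₀ (+ zeros c))
              ≡⟨ quadrature g (wroots m p q) length<d ⟩
            Σw {n} (λ x → q₀ (+ zeros x))
              ≡⟨ fastSum-correct n d₀ p q (6 ℕ.* m ℕ.+ 5) (subst (n ℕ.<_) (sym (ring₂ m)) (ℕₚ.m<m+n n {4} (s≤s z≤n))) ⟩
            fastSum n d₀ p q (6 ℕ.* m ℕ.+ 5) ∎) ⟩
        excess m p q ∎
        where
        ring : ∀ k v s u → k * v * s ≡ k * (u * 1ℤ + v * s) - k * u
        ring = solve-∀
        ring₂ : ∀ m → (6 ℕ.* m ℕ.+ 5) ℕ.* 4 ≡ 24 ℕ.* m ℕ.+ 16 ℕ.+ 4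
        ring₂ = NS.solve-∀
        total : Σw (λ c → ⟦ C c ⟧ * q₀ (+ zeros c)) ≡ q₀ (+ n) * 1ℤ + q₀ (+ nd p) * Σw (nb p)
        total = begin
          Σw (λ c → ⟦ C c ⟧ * q₀ (+ zeros c))
            ≡⟨ Σw-cong (λ c → trans (codewords-split c) (cong₂ _+_ (*-comm (block C 0 c) (q₀ (+ n))) (*-comm (nb p c) (q₀ (+ nd p))))) ⟩
          Σw (λ c → q₀ (+ n) * block C 0 c + q₀ (+ nd p) * nb p c)
            ≡⟨ trans (Σw-+ (λ c → q₀ (+ n) * block C 0 c) (λ c → q₀ (+ nd p) * nb p c))
                 (cong₂ _+_ (trans (Σw-* (q₀ (+ n)) (block C 0)) (cong (q₀ (+ n) *_) block-zero)) (Σw-* (q₀ (+ nd p)) (nb p))) ⟩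
          q₀ (+ n) * 1ℤ + q₀ (+ nd p) * Σw (nb p) ∎

      balanced⇒integral : ∀ t → t ℕ.≤ n → Balanced (nb p) t → integral m p q t ≡ true
      balanced⇒integral t t≤n bal with S , S-size ← ofSize-inhabited {n} {t} t≤n =
        divides?-complete (+ (n choose t) * scale m p q) (+ (nodeWeight m ext p choose t) * excess m p q) (covering (nb p) S) (begin
          + (n choose t) * scale m p q * covering (nb p) S
            ≡⟨ ring (+ (n choose t)) (scale m p q) (covering (nb p) S) ⟩
          scale m p q * (+ (n choose t) * covering (nb p) S)
            ≡⟨ cong (scale m p q *_) (divisibility t (block-ofWeight C (nodeWeight m ext p)) bal S S-size) ⟨
          scale m p q * (Σw (nb p) * + (nodeWeight m ext p choose t))
            ≡⟨ ring₂ (scale m p q) (Σw (nb p)) (+ (nodeWeight m ext p choose t)) ⟩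
          + (nodeWeight m ext p choose t) * (scale m p q * Σw (nb p))
            ≡⟨ cong (+ (nodeWeight m ext p choose t) *_) block-count ⟩
          + (nodeWeight m ext p choose t) * excess m p q ∎)
        where
        ring : ∀ a b c → a * b * c ≡ b * (a * c)
        ring = solve-∀
        ring₂ : ∀ a b c → a * (b * c) ≡ c * (a * b)
        ring₂ = solve-∀

-- Divisibility and nonvanishing checks by evaluation.

module Computations where
  open ExactSums
  open BlockCounts
  open StrengthSix
  open import Data.Bool using (Bool; true; false; _∧_; _∨_; not)
  open import Data.Nat as ℕ using (ℕ; zero; suc; _+_; _*_; _∸_; _≤_; _<_; s≤s)
  import Data.Nat.Properties as ℕₚ
  import Data.Integer as ℤ
  open import Data.List using (List; []; _∷_)
  open import Data.List.Membership.Propositional using (_∈_)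
  open import Data.List.Membership.DecPropositional ℕ._≟_ using (_∈?_)
  open import Data.List.Relation.Unary.All as All using (All; []; _∷_)
  open import Data.Empty using (⊥-elim)
  open import Relation.Nullary using (Dec; yes; no; does)
  open import Relation.Binary.PropositionalEquality hiding (J)

  exceptional : List ℕ
  exceptional = 10 ∷ 23 ∷ 79 ∷ 93 ∷ 118 ∷ 120 ∷ 123 ∷ 125 ∷ 142 ∷ []

  allFrom : (ℕ → Bool) → ℕ → ℕ → Bool
  allFrom f a zero    = true
  allFrom f a (suc k) = f a ∧ allFrom f (suc a) k

  allFrom-sound : ∀ f a k → allFrom f a k ≡ true → ∀ m → a ≤ m → m < a + k → f m ≡ true
  allFrom-sound f a zero    e m a≤m m<a = ⊥-elim (ℕₚ.<⇒≱ (subst (m <_) (ℕₚ.+-identityʳ a) m<a) a≤m)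
  allFrom-sound f a (suc k) e m a≤m m<a with f a in fa | a ℕ.≟ m
  ... | true | yes refl = fa
  ... | true | no a≢m   = allFrom-sound f (suc a) k e m (ℕₚ.≤∧≢⇒< a≤m a≢m) (subst (m <_) (ℕₚ.+-suc a k) m<a)

  -- For m = 20 the minimum weight design passes the divisibility test for 4-designs.
  fourthCheck : ℕ → Bool
  fourthCheck m = does (m ∈? 20 ∷ exceptional) ∨ not (integral m (4 * m + 2) 0 4)

  fourth-1 : allFrom fourthCheck 1 79 ≡ true
  fourth-1 = refl

  fourth-2 : allFrom fourthCheck 80 40 ≡ true
  fourth-2 = refl

  fourth-3 : allFrom fourthCheck 120 22 ≡ true
  fourth-3 = refl

  fourth-4 : allFrom fourthCheck 142 22 ≡ true
  fourth-4 = refl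

  fourth-all : ∀ m → 1 ≤ m → m ≤ 163 → fourthCheck m ≡ true
  fourth-all m 1≤m m≤163 with m ℕ.<? 80 | m ℕ.<? 120 | m ℕ.<? 142
  ... | yes m<80 | _         | _         = allFrom-sound fourthCheck 1 79 fourth-1 m 1≤m m<80
  ... | no m≮80  | yes m<120 | _         = allFrom-sound fourthCheck 80 40 fourth-2 m (ℕₚ.≮⇒≥ m≮80) m<120
  ... | no _     | no m≮120  | yes m<142 = allFrom-sound fourthCheck 120 22 fourth-3 m (ℕₚ.≮⇒≥ m≮120) m<142
  ... | no _     | no _      | no m≮142  = allFrom-sound fourthCheck 142 22 fourth-4 m (ℕₚ.≮⇒≥ m≮142) (s≤s m≤163)

  ∨-not-elim : ∀ {A : Set} (d : Dec A) {b} → does d ∨ not b ≡ true → b ≡ true → A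
  ∨-not-elim (yes a) _  _    = a
  ∨-not-elim (no _)  () refl

  fourth-exceptional : ∀ m → 1 ≤ m → m ≤ 163 → integral m (4 * m + 2) 0 4 ≡ true → m ∈ 20 ∷ exceptional
  fourth-exceptional m 1≤m m≤163 = ∨-not-elim (m ∈? 20 ∷ exceptional) {integral m (4 * m + 2) 0 4} (fourth-all m 1≤m m≤163)

  -- Accounts for the absence of 10 from the list for 5-designs; 42 = 4 * 10 + 2 is the index of the
  -- minimum weight.
  fifth-10 : integral 10 42 0 5 ≡ false
  fifth-10 = refl

  nonvanishingCheck : ℕ → ℕ → Bool
  nonvanishingCheck m p = not (does (ℤ.+ ((3 + J) * (2 + J) * (1 + J)) ℤ.* ℤ.+ (4 * suc q + 4 * suc p)
      ℤ.≟ sixthWindow m J p q ℤ.* ℤ.+ (4 * suc q * (4 * suc p))))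
    where
    J q : ℕ
    J = 4 * m ∸ 2
    q = 4 * m ∸ p

  nonvanishingCheck-sound : ∀ m p q → p + q ≡ 4 * m → nonvanishingCheck m p ≡ true → SixthNonvanishing m (4 * m ∸ 2) p q
  nonvanishingCheck-sound m p q p+q h = subst (SixthNonvanishing m (4 * m ∸ 2) p)
    (trans (cong (_∸ p) (sym p+q)) (ℕₚ.m+n∸m≡n p q)) (undecide h)
    where
    undecide : ∀ {x y : ℤ.ℤ} → not (does (x ℤ.≟ y)) ≡ true → x ≢ y
    undecide {x} {y} h e with x ℤ.≟ y
    undecide {x} {y} () e | yes _
    undecide {x} {y} h  e | no x≢y = x≢y e

  sixth-minimal : All (λ m → integral m (4 * m + 2) 0 6 ≡ false) exceptional
  sixth-minimal = refl ∷ refl ∷ refl ∷ refl ∷ refl ∷ refl ∷ refl ∷ refl ∷ refl ∷ []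

  -- The middle weight does not reduce to the minimum weight at strength six, so its own covering
  -- numbers are tested.
  sixth-middle : All (λ m → integral m (2 * m + 1) (2 * m + 1) 6 ≡ false) exceptional
  sixth-middle = refl ∷ refl ∷ refl ∷ refl ∷ refl ∷ refl ∷ refl ∷ refl ∷ refl ∷ []

  -- The 4m + 1 values of `p` run through all interior nodes; strength six is settled by evaluation
  -- in place of the parity argument of strength four.
  nonvanishing-all : All (λ m → allFrom (nonvanishingCheck m) 0 (4 * m + 1) ≡ true) exceptional
  nonvanishing-all = refl ∷ refl ∷ refl ∷ refl ∷ refl ∷ refl ∷ refl ∷ refl ∷ refl ∷ []

-- Excluding m = 20 by the intersections of minimum weight words.

module Intersections where
  open WordSums
  open Incidence
  open Designs
  open Complements
  open Moments
  open ExtremalCodes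
  open NodeSums
  open StrengthThree
  open ExactSums
  open BlockCounts
  open import Data.Bool using (true; false; not)
  open import Data.Bool.Properties using (not-involutive)
  open import Data.Nat as ℕ using (ℕ; zero; suc; z≤n; s≤s; ⌊_/2⌋)
  import Data.Nat.Properties as ℕₚ
  open import Data.Nat.Combinatorics using (nCk+nC[k+1]≡[n+1]C[k+1]) renaming (_C_ to _choose_)
  open import Data.Integer using (ℤ; +_; 0ℤ; 1ℤ; _+_; _*_; _-_; -_; ∣_∣)
  open import Data.Integer.Properties
  open import Data.Integer.Tactic.RingSolver using (solve-∀)
  import Data.Fin.Subset as Subset
  open import Data.Vec using ([]; _∷_)
  open import Data.Product using (_,_; _×_; proj₁; proj₂)
  open import Data.Empty using (⊥; ⊥-elim)
  open import Relation.Nullary using (¬_; yes; no)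
  open import Relation.Binary.PropositionalEquality
  open ≡-Reasoning

  dot-parity : ∀ {n} (c d : Word n) → dot c d ≡ parity (inside c d)
  dot-parity []          []          = refl
  dot-parity (true ∷ c)  (true ∷ d)  = cong not (dot-parity c d)
  dot-parity (true ∷ c)  (false ∷ d) = dot-parity c d
  dot-parity (false ∷ c) (b ∷ d)     = dot-parity c d

  even-double : ∀ i → parity i ≡ false → i ≡ ⌊ i /2⌋ ℕ.+ ⌊ i /2⌋
  even-double zero          _ = refl
  even-double (suc (suc i)) e = trans (cong (λ j → suc (suc j)) (even-double i (trans (sym (not-involutive (parity i))) e)))
    (cong suc (sym (ℕₚ.+-suc ⌊ i /2⌋ ⌊ i /2⌋)))

  -- Binomials of x in terms of binomials of 2x. The last identity is the one applied to even
  -- intersections; the first three carry its induction, in which Pascal's rule refers each degree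
  -- to the one below.
  halving : ∀ x → let C k = + ((x ℕ.+ x) choose k) in
      (+ 2 * + (x choose 1) ≡ C 1)
    × (+ 8 * + (x choose 2) ≡ + 2 * C 2 - C 1)
    × (+ 16 * + (x choose 3) ≡ C 1 - + 2 * C 2 + + 2 * C 3)
    × (+ 128 * + (x choose 4) ≡ + 10 * C 2 + + 8 * C 4 - + 5 * C 1 - + 12 * C 3)
  halving zero    = refl , refl , refl , refl
  halving (suc x) with halving x
  ... | h₁ , h₂ , h₃ , h₄ =
      trans (trans (cong (+ 2 *_) (pascal x 0)) (trans (*-distribˡ-+ (+ 2) 1ℤ (+ (x choose 1))) (cong (λ y → + 2 + y) h₁))) (trans (e₁ (c 1)) (sym (double 0)))
    , trans (trans (cong (+ 8 *_) (pascal x 1)) (trans (r₂ (+ (x choose 1)) (+ (x choose 2))) (cong₂ (λ u v → + 4 * u + v) h₁ h₂)))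
        (trans (e₂ (c 1) (c 2)) (sym (cong₂ (λ u v → + 2 * u - v) (double 1) (double 0))))
    , trans (trans (cong (+ 16 *_) (pascal x 2)) (trans (r₃ (+ (x choose 2)) (+ (x choose 3))) (cong₂ (λ u v → + 2 * u + v) h₂ h₃)))
        (trans (e₃ (c 1) (c 2) (c 3)) (sym (trans (cong₂ (λ u v → u - + 2 * v + + 2 * C′ 3) (double 0) (double 1)) (cong (λ w → (c 1 + + 2 * 1ℤ + 0ℤ) - + 2 * (c 2 + + 2 * c 1 + 1ℤ) + + 2 * w) (double 2)))))
    , trans (trans (cong (+ 128 *_) (pascal x 3)) (trans (r₄ (+ (x choose 3)) (+ (x choose 4))) (cong₂ (λ u v → + 8 * u + v) h₃ h₄)))
        (trans (e₄ (c 1) (c 2) (c 3) (c 4)) (sym (trans (cong₂ (λ u v → + 10 * u + + 8 * v - + 5 * C′ 1 - + 12 * C′ 3) (double 1) (double 3))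
          (cong₂ (λ u v → + 10 * (c 2 + + 2 * c 1 + 1ℤ) + + 8 * (c 4 + + 2 * c 3 + c 2) - + 5 * u - + 12 * v) (double 0) (double 2)))))
    where
    c : ℕ → ℤ
    c k = + ((x ℕ.+ x) choose k)
    C′ : ℕ → ℤ
    C′ k = + ((suc x ℕ.+ suc x) choose k)
    -- Pascal's rule applied twice to 2x + 2 reaches back two degrees; `low` is the binomial of
    -- degree k - 1, with 0 in degree -1.
    low : ℕ → ℤ
    low zero    = 0ℤ
    low (suc k) = c k
    double : ∀ k → C′ (suc k) ≡ c (suc k) + + 2 * c k + low k
    double k = trans (cong (λ n → + (suc n choose suc k)) (ℕₚ.+-suc x x)) (trans (pascal (suc (x ℕ.+ x)) k) (by k))
      where
      ring₀ : ∀ a → 1ℤ + (1ℤ + a) ≡ a + + 2 * 1ℤ + 0ℤ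
      ring₀ = solve-∀
      ring : ∀ a b d → (d + b) + (b + a) ≡ a + + 2 * b + d
      ring = solve-∀
      by : ∀ k → + (suc (x ℕ.+ x) choose k) + + (suc (x ℕ.+ x) choose suc k) ≡ c (suc k) + + 2 * c k + low k
      by zero    = trans (cong (λ y → 1ℤ + y) (pascal (x ℕ.+ x) 0)) (ring₀ (c 1))
      by (suc k) = trans (cong₂ _+_ (pascal (x ℕ.+ x) k) (pascal (x ℕ.+ x) (suc k))) (ring (c (suc (suc k))) (c (suc k)) (c k))
    r₂ : ∀ a b → + 8 * (a + b) ≡ + 4 * (+ 2 * a) + + 8 * b
    r₂ = solve-∀
    r₃ : ∀ a b → + 16 * (a + b) ≡ + 2 * (+ 8 * a) + + 16 * b
    r₃ = solve-∀
    r₄ : ∀ a b → + 128 * (a + b) ≡ + 8 * (+ 16 * a) + + 128 * b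
    r₄ = solve-∀
    e₁ : ∀ a → + 2 + a ≡ a + + 2 * 1ℤ + 0ℤ
    e₁ = solve-∀
    e₂ : ∀ a b → + 4 * a + (+ 2 * b - a) ≡ + 2 * (b + + 2 * a + 1ℤ) - (a + + 2 * 1ℤ + 0ℤ)
    e₂ = solve-∀
    e₃ : ∀ a b d → + 2 * (+ 2 * b - a) + (a - + 2 * b + + 2 * d) ≡ (a + + 2 * 1ℤ + 0ℤ) - + 2 * (b + + 2 * a + 1ℤ) + + 2 * (d + + 2 * b + a)
    e₃ = solve-∀
    e₄ : ∀ a b d f → + 8 * (a - + 2 * b + + 2 * d) + (+ 10 * b + + 8 * f - + 5 * a - + 12 * d)
       ≡ + 10 * (b + + 2 * a + 1ℤ) + + 8 * (f + + 2 * d + b) - + 5 * (a + + 2 * 1ℤ + 0ℤ) - + 12 * (d + + 2 * b + a)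
    e₄ = solve-∀

  divideOr-unique : ∀ {x d} y z → ∣ d ∣ ≢ 0 → y * d ≡ x → divideOr z x d ≡ y
  divideOr-unique {x} {+ zero}              y z ≢0 e = ⊥-elim (≢0 refl)
  divideOr-unique {x} {d@(Data.Integer.+[1+ _ ])} y z ≢0 e = divideOr-exact y {x} {d} e
  divideOr-unique {x} {d@(Data.Integer.-[1+ _ ])} y z ≢0 e = divideOr-exact y {x} {d} e

  -- For a design on n points with block size k in which a · (number of blocks) = b, the divisions below produce
  -- λ_s and ∑ (∣ B ∩ c ∣ choose s) over the blocks c for a fixed set B of size k, whence 128 ∑ (∣ B ∩ c ∣ / 2 choose 4).
  coverings : (n k : ℕ) (a b : ℤ) → ℕ → ℤ
  coverings n k a b s = divideOr 0ℤ (divideOr 0ℤ b a * + (k choose s)) (+ (n choose s))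

  intersections : (n k : ℕ) (a b : ℤ) → ℤ
  intersections n k a b = + 10 * σ 2 + + 8 * σ 4 - + 5 * σ 1 - + 12 * σ 3
    where
    σ : ℕ → ℤ
    σ s = + (k choose s) * coverings n k a b s

  choose-≢0 : ∀ {n s} → s ℕ.≤ n → n choose s ≢ 0
  choose-≢0 {n}     z≤n ()
  choose-≢0 {suc n} {suc s} (s≤s p) e = choose-≢0 p (ℕₚ.m+n≡0⇒m≡0 (n choose s) (trans (nCk+nC[k+1]≡[n+1]C[k+1] n s) e))

  module _ {n k : ℕ} {X : Word n → ℤ} {a b : ℤ} {B : Word n} (4≤n : 4 ℕ.≤ n) (ofW : OfWeight X k)
           (a≢0 : ∣ a ∣ ≢ 0) (count : a * Σw X ≡ b) (B-size : Subset.∣ B ∣ ≡ k)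
           (even : ∀ c → X c ≢ 0ℤ → parity (inside B c) ≡ false) (bal : ∀ s → s ℕ.< 5 → Balanced X s) where

    private
      I : ℕ → Word n → ℤ
      I s c = + (inside B c choose s)

      half : Word n → ℤ
      half c = + (⌊ inside B c /2⌋ choose 4)

    Σ-intersection : ∀ s → s ℕ.< 5 → Σw (λ c → X c * I s c) ≡ + (k choose s) * coverings n k a b s
    Σ-intersection s s<5 with S , S-size ← ofSize-inhabited {n} {s} (ℕₚ.≤-trans (ℕ.s≤s⁻¹ s<5) 4≤n) = begin
      Σw (λ c → X c * I s c)
        ≡⟨ Σ-inside-choose X B s S (bal s s<5) S-size ⟩
      + (Subset.∣ B ∣ choose s) * covering X S
        ≡⟨ cong₂ (λ k x → + (k choose s) * x) B-size (sym (divideOr-unique (covering X S) 0ℤ (choose-≢0 (ℕₚ.≤-trans (ℕ.s≤s⁻¹ s<5) 4≤n)) (begin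
             covering X S * + (n choose s)          ≡⟨ *-comm (covering X S) (+ (n choose s)) ⟩
             + (n choose s) * covering X S          ≡⟨ divisibility s ofW (bal s s<5) S S-size ⟨
             Σw X * + (k choose s)                  ≡⟨ cong (_* + (k choose s)) (sym (divideOr-unique (Σw X) 0ℤ a≢0 (trans (*-comm (Σw X) a) count))) ⟩
             divideOr 0ℤ b a * + (k choose s) ∎))) ⟩
      + (k choose s) * coverings n k a b s ∎

    -- Each intersection with a block of nonzero weight is some 2x, so `halving` expresses the sum
    -- of (x choose 4) by sums of binomials of the intersections, which balance determines. As the
    -- sum of (x choose 4) is an integer, the result must be a multiple of 128.
    intersections-divisible : + 128 * Σw (λ c → X c * half c) ≡ intersections n k a b
    intersections-divisible = begin
      + 128 * Σw (λ c → X c * half c)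
        ≡⟨ trans (sym (Σw-* (+ 128) (λ c → X c * half c))) (Σw-cong pointwise) ⟩
      Σw (λ c → + 10 * (X c * I 2 c) + + 8 * (X c * I 4 c) - + 5 * (X c * I 1 c) - + 12 * (X c * I 3 c))
        ≡⟨ trans (Σw-- (λ c → + 10 * (X c * I 2 c) + + 8 * (X c * I 4 c) - + 5 * (X c * I 1 c)) (λ c → + 12 * (X c * I 3 c)))
            (cong₂ _-_ (trans (Σw-- (λ c → + 10 * (X c * I 2 c) + + 8 * (X c * I 4 c)) (λ c → + 5 * (X c * I 1 c)))
              (cong₂ _-_ (trans (Σw-+ (λ c → + 10 * (X c * I 2 c)) (λ c → + 8 * (X c * I 4 c)))
                 (cong₂ _+_ (Σw-* (+ 10) (λ c → X c * I 2 c)) (Σw-* (+ 8) (λ c → X c * I 4 c))))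
                (Σw-* (+ 5) (λ c → X c * I 1 c)))) (Σw-* (+ 12) (λ c → X c * I 3 c))) ⟩
      + 10 * Σw (λ c → X c * I 2 c) + + 8 * Σw (λ c → X c * I 4 c) - + 5 * Σw (λ c → X c * I 1 c) - + 12 * Σw (λ c → X c * I 3 c)
        ≡⟨ cong₂ _-_ (cong₂ _-_ (cong₂ (λ u v → + 10 * u + + 8 * v) (Σ-intersection 2 (ℕₚ.m≤m+n 3 2)) (Σ-intersection 4 (ℕₚ.m≤m+n 5 0)))
             (cong (+ 5 *_) (Σ-intersection 1 (ℕₚ.m≤m+n 2 3)))) (cong (+ 12 *_) (Σ-intersection 3 (ℕₚ.m≤m+n 4 1))) ⟩
      intersections n k a b ∎
      where
      zero-sum : ∀ a b d e h → + 128 * (0ℤ * h) ≡ + 10 * (0ℤ * a) + + 8 * (0ℤ * b) - + 5 * (0ℤ * d) - + 12 * (0ℤ * e)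
      zero-sum = solve-∀
      scaled : ∀ x a b d e h → + 128 * h ≡ + 10 * a + + 8 * b - + 5 * d - + 12 * e →
        + 128 * (x * h) ≡ + 10 * (x * a) + + 8 * (x * b) - + 5 * (x * d) - + 12 * (x * e)
      scaled x a b d e h eq = trans (r₁ x h) (trans (cong (x *_) eq) (r₂ x a b d e))
        where
        r₁ : ∀ x h → + 128 * (x * h) ≡ x * (+ 128 * h)
        r₁ = solve-∀
        r₂ : ∀ x a b d e → x * (+ 10 * a + + 8 * b - + 5 * d - + 12 * e) ≡ + 10 * (x * a) + + 8 * (x * b) - + 5 * (x * d) - + 12 * (x * e)
        r₂ = solve-∀
      pointwise : ∀ c → + 128 * (X c * half c) ≡ + 10 * (X c * I 2 c) + + 8 * (X c * I 4 c) - + 5 * (X c * I 1 c) - + 12 * (X c * I 3 c)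
      -- Evenness of the intersection is known only where `X` is nonzero.
      pointwise c with X c ≟ 0ℤ
      ... | yes x≡0 = subst (λ x → + 128 * (x * half c) ≡ + 10 * (x * I 2 c) + + 8 * (x * I 4 c) - + 5 * (x * I 1 c) - + 12 * (x * I 3 c))
            (sym x≡0) (zero-sum (I 2 c) (I 4 c) (I 1 c) (I 3 c) (half c))
      ... | no x≢0  = scaled (X c) (I 2 c) (I 4 c) (I 1 c) (I 3 c) (half c) (subst
            (λ i → + 128 * half c ≡ + 10 * + (i choose 2) + + 8 * + (i choose 4) - + 5 * + (i choose 1) - + 12 * + (i choose 3))
            (sym (even-double (inside B c) (even c x≢0))) (proj₂ (proj₂ (proj₂ (halving ⌊ inside B c /2⌋)))))

  codeIntersections : ℕ → ℤ
  codeIntersections m = intersections (24 ℕ.* m ℕ.+ 16) (4 ℕ.* m ℕ.+ 4) (scale m (4 ℕ.* m ℕ.+ 2) 0) (excess m (4 ℕ.* m ℕ.+ 2) 0)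

  not-divisible : (128 divides? ∣ codeIntersections 20 ∣) ≡ false
  not-divisible = refl

  scale-20 : ∣ scale 20 (4 ℕ.* 20 ℕ.+ 2) 0 ∣ ≢ 0
  scale-20 ()

  not-multiple : ∀ {x y} → + 128 * y ≡ x → (128 divides? ∣ x ∣) ≡ false → ⊥
  not-multiple {x} {y} e h with () ← trans (sym (divides?-complete (+ 128) x y e)) h

  block-support : ∀ {n} (C : Code n) w c → block C w c ≢ 0ℤ → c ∈C C
  block-support C w c ≢0 with C c
  ... | true  = refl
  ... | false = ⊥-elim (≢0 refl)

  -- `m` stays a variable, and only the closed facts `not-divisible` and `scale-20` are evaluated at
  -- 20 and transported along the equation. The intersections are even because codewords are
  -- orthogonal to each other.
  no-4-design-20 : ∀ m {C : Code (24 ℕ.* m ℕ.+ 16)} (ext : ExtremalDoublyEvenSelfDual C) → m ≡ 20 →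
    ¬ (∀ s → s ℕ.< 5 → Balanced (minBlock m ext) s)
  no-4-design-20 m {C} ext m≡20 bal = not-multiple {codeIntersections m} sum
    (subst (λ m → (128 divides? ∣ codeIntersections m ∣) ≡ false) (sym m≡20) not-divisible)
    where
    B = proj₁ (minimalWord m ext)
    B∈ = proj₁ (proj₂ (minimalWord m ext))
    even : ∀ c → minBlock m ext c ≢ 0ℤ → parity (inside B c) ≡ false
    even c x≢0 = trans (sym (dot-parity B c)) (proj₁ (isSelfDual m ext B) B∈ c (block-support C (4 ℕ.* m ℕ.+ 4) c x≢0))
    scaleₘ excessₘ : ℤ
    scaleₘ = scale m (4 ℕ.* m ℕ.+ 2) 0
    excessₘ = excess m (4 ℕ.* m ℕ.+ 2) 0
    count : scaleₘ * Σw (minBlock m ext) ≡ excessₘ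
    count = subst (λ w → scaleₘ * Σw (block C w) ≡ excessₘ) (nodeWeight-P m ext) (block-count m ext (4 ℕ.* m ℕ.+ 2) 0 (ℕₚ.+-identityʳ (4 ℕ.* m ℕ.+ 2)))
    scale≢0 : ∣ scaleₘ ∣ ≢ 0
    scale≢0 = subst (λ m → ∣ scale m (4 ℕ.* m ℕ.+ 2) 0 ∣ ≢ 0) (sym m≡20) scale-20
    sum : + 128 * Σw (λ c → minBlock m ext c * + (⌊ inside B c /2⌋ choose 4)) ≡ codeIntersections m
    sum = intersections-divisible {24 ℕ.* m ℕ.+ 16} {4 ℕ.* m ℕ.+ 4} {minBlock m ext} {scaleₘ} {excessₘ} {B}
      (ℕₚ.≤-trans (ℕₚ.m≤m+n 4 12) (ℕₚ.m≤n+m 16 (24 ℕ.* m))) (block-ofWeight C (4 ℕ.* m ℕ.+ 4))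
      scale≢0 count (proj₂ (proj₂ (minimalWord m ext))) even bal

-- Reducing an arbitrary weight to the minimum weight.

module Conclusion where
  open WordSums
  open Incidence
  open Designs
  open Complements
  open Moments
  open Progressions
  open ExtremalCodes
  open NodeSums
  open StrengthThree
  open StrengthFour
  open StrengthFive
  open StrengthSix
  open ExactSums using (divides?-complete)
  open BlockCounts
  open Computations
  open Intersections
  open import Data.Bool using (true; false)
  open import Data.Nat using (ℕ; zero; suc; _+_; _*_; _∸_; _≤_; _<_; z≤n; s≤s; _≟_; s≤s⁻¹)
  import Data.Nat.Properties as ℕₚ
  import Data.Nat.Tactic.RingSolver as NS
  import Data.Integer as ℤ
  import Data.Integer.Properties as ℤₚ
  open import Data.List using ([]; _∷_)
  open import Data.List.Membership.Propositional using (_∈_)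
  open import Data.List.Relation.Unary.Any using (here; there)
  import Data.List.Relation.Unary.All as All
  open import Data.Fin.Subset using (∣_∣)
  open import Data.Product using (∃; _,_; _×_)
  open import Data.Empty using (⊥; ⊥-elim)
  open import Relation.Nullary using (Dec; ¬_; yes; no)
  open import Relation.Binary.Definitions using (tri<; tri≈; tri>)
  open import Relation.Binary.PropositionalEquality

  true-false : ∀ {b} → b ≡ true → b ≡ false → ⊥
  true-false refl ()

  module _ (m : ℕ) {C : Code (24 * m + 16)} (ext : ExtremalDoublyEvenSelfDual C) (1≤m : 1 ≤ m) where
    private
      n = 24 * m + 16
      P = 4 * m + 2
      nb = nodeBlock m ext
      X₀ = minBlock m ext

    UpTo : (Word n → ℤ.ℤ) → ℕ → Set
    UpTo X t = ∀ s → s ≤ t → Balanced X s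

    -- The bound 8 is the least value of d, at m = 1; `balanced-down` requires the strength not to
    -- exceed the block size.
    upTo : ∀ {i} t → i ≤ P → t ≤ 8 → Balanced (nb i) t → UpTo (nb i) t
    upTo {i} zero    i≤P t≤8 bal zero _ = bal
    upTo {i} (suc t) i≤P t<8 bal s s≤ with s ≟ suc t
    ... | yes refl = bal
    ... | no s≢ = upTo t i≤P (ℕₚ.<⇒≤ t<8)
        (balanced-down {X = nb i} t (block-ofWeight C (nodeWeight m ext i)) (ℕₚ.m∸n≤m n (node m ext i)) t<w bal) s (s≤s⁻¹ (ℕₚ.≤∧≢⇒< s≤ s≢))
      where
      8≤d : 8 ≤ 4 * m + 4
      8≤d = ℕₚ.+-monoˡ-≤ 4 (ℕₚ.*-monoʳ-≤ 4 1≤m)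
      t<w : suc t ≤ nodeWeight m ext i
      t<w = ℕₚ.≤-trans t<8 (ℕₚ.≤-trans 8≤d (nodeWeight≥d m ext i (P ∸ i) (ℕₚ.m+[n∸m]≡n i≤P)))

    mirror-weights : ∀ i j → i + j ≡ P → nodeWeight m ext i + nodeWeight m ext j ≡ n
    mirror-weights i j i+j = ℕₚ.+-cancelʳ-≡ (node m ext i + node m ext j) _ n (trans (shuffle (nodeWeight m ext i) (nodeWeight m ext j) (node m ext i) (node m ext j))
      (trans (cong₂ _+_ (ℕₚ.m∸n+n≡m (node≤n m ext i≤P)) (ℕₚ.m∸n+n≡m (node≤n m ext j≤P)))
        (cong (n +_) (sym (trans (ring₁ (4 * m + 4) i j) (trans (cong (λ k → 2 * (4 * m + 4) + 4 * k) i+j) (ring₂ m)))))))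
      where
      i≤P : i ≤ P
      i≤P = subst (i ≤_) i+j (ℕₚ.m≤m+n i j)
      j≤P : j ≤ P
      j≤P = subst (j ≤_) i+j (ℕₚ.m≤n+m j i)
      shuffle : ∀ a b c d → a + b + (c + d) ≡ a + c + (b + d)
      shuffle = NS.solve-∀
      ring₁ : ∀ a i j → a + 4 * i + (a + 4 * j) ≡ 2 * a + 4 * (i + j)
      ring₁ = NS.solve-∀
      ring₂ : ∀ m → 2 * (4 * m + 4) + 4 * (4 * m + 2) ≡ 24 * m + 16
      ring₂ = NS.solve-∀

    mirror-imbalance : ∀ i j t → i + j ≡ P → suc t ≤ 8 → UpTo (nb i) t → ∀ T T′ → ∣ T ∣ ≡ suc t → ∣ T′ ∣ ≡ suc t →
      imbalance (nb j) T T′ ≡ sgnPow (suc t) ℤ.* imbalance (nb i) T T′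
    mirror-imbalance i j t i+j t<8 = complement-imbalance {X = nb i} {X′ = nb j} t
      (block-comp (isSelfDual m ext) (isDoublyEven m ext) (mirror-weights i j i+j))
      (ℕₚ.≤-trans t<8 (ℕₚ.≤-trans (ℕₚ.m≤m+n 8 8) (ℕₚ.m≤n+m 16 (24 * m))))

    mirror : ∀ i j t → i + j ≡ P → suc t ≤ 8 → Balanced (nb i) (suc t) → Balanced (nb j) (suc t)
    mirror i j t i+j t<8 bal = balanced-from m ext (nb j) (suc t) λ T T′ e e′ →
      trans (mirror-imbalance i j t i+j t<8 (upTo t i≤P (ℕₚ.<⇒≤ t<8) (upTo (suc t) i≤P t<8 bal t (ℕₚ.n≤1+n t))) T T′ e e′)
        (trans (cong (sgnPow (suc t) ℤ.*_) (imbalance-0 m ext (nb i) bal T T′ e e′)) (ℤₚ.*-zeroʳ (sgnPow (suc t))))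
      where
      i≤P : i ≤ P
      i≤P = subst (i ≤_) i+j (ℕₚ.m≤m+n i j)

    at-P : ∀ {t} → Balanced (nb P) t → Balanced X₀ t
    at-P {t} = subst (λ w → Balanced (block C w) t) (nodeWeight-P m ext)

    -- The last node is the minimum weight itself and node 0 its mirror image, so only interior
    -- nodes need an argument.
    from-ends : ∀ {t} i → suc t ≤ 8 → i ≤ P → Balanced (nb i) (suc t) →
      (∀ p q → p + q ≡ 4 * m → Balanced (nb (suc p)) (suc t) → i ≡ suc p → Balanced X₀ (suc t)) → Balanced X₀ (suc t)
    from-ends {t} zero    t<8 _   bal interior = at-P (mirror 0 P t refl t<8 bal)
    from-ends {t} (suc p) t<8 p<P bal interior with suc p ≟ P
    ... | yes e = at-P (subst (λ i → Balanced (nb i) (suc t)) e bal)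
    ... | no p≢P = interior p (4 * m ∸ p) (ℕₚ.m+[n∸m]≡n (s≤s⁻¹ (s≤s⁻¹ (subst (suc (suc p) ≤_) (ℕₚ.+-comm (4 * m) 2) (ℕₚ.≤∧≢⇒< p<P p≢P))))) bal refl

    below-suc : ∀ t → UpTo X₀ t → BalancedBelow m ext (suc t)
    below-suc t up s s<t = up s (s≤s⁻¹ s<t)

    extend : ∀ {t} → UpTo X₀ t → Balanced X₀ (suc t) → UpTo X₀ (suc t)
    extend {t} up bal s s≤ with s ≟ suc t
    ... | yes refl = bal
    ... | no s≢    = up s (s≤s⁻¹ (ℕₚ.≤∧≢⇒< s≤ s≢))

    -- The given design is consumed at strengths two and four; strength one is unconditional and
    -- strength three follows from strength two.
    fourth-design : ∀ i → i ≤ P → Balanced (nb i) 4 → UpTo X₀ 4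
    fourth-design i i≤P bal = extend up₃ (from-ends i (ℕₚ.m≤m+n 4 4) i≤P bal (λ p q p+q b _ → OnePuncture.step₄ m ext p q p+q (below-suc 3 up₃) b))
      where
      up₁ : UpTo X₀ 1
      up₁ = extend (λ { zero _ → balanced-0 X₀ ; (suc s) () }) (step₁ m ext)
      second : Balanced X₀ 2
      second with i ≟ P
      ... | yes refl = at-P (upTo 4 i≤P (ℕₚ.m≤m+n 4 4) bal 2 (s≤s (s≤s z≤n)))
      ... | no i≢P   = step₂ m ext i (P ∸ suc i) (trans (ℕₚ.+-suc i _) (ℕₚ.m+[n∸m]≡n (ℕₚ.≤∧≢⇒< i≤P i≢P)))
                         (upTo 4 i≤P (ℕₚ.m≤m+n 4 4) bal 2 (s≤s (s≤s z≤n)))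
      up₂ : UpTo X₀ 2
      up₂ = extend up₁ second
      up₃ : UpTo X₀ 3
      up₃ = extend up₂ (step₃ m ext (below-suc 2 up₂))

    fifth-design : ∀ i → i ≤ P → i ≢ 2 * m + 1 → Balanced (nb i) 5 → UpTo X₀ 5
    fifth-design i i≤P i≢mid bal = extend up₄ (from-ends i (ℕₚ.m≤m+n 5 3) i≤P bal interior)
      where
      up₄ : UpTo X₀ 4
      up₄ = fourth-design i i≤P (upTo 5 i≤P (ℕₚ.m≤m+n 5 3) bal 4 (ℕₚ.n≤1+n 4))
      ring₁ : ∀ p k → p + k + p + 3 ≡ p + (suc p + k) + 2
      ring₁ = NS.solve-∀
      ring₂ : ∀ p k → p + k + 2 ≡ suc (suc p + k)
      ring₂ = NS.solve-∀
      ring₃ : ∀ p q → suc p + suc q ≡ p + q + 2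
      ring₃ = NS.solve-∀
      interior : ∀ p q → p + q ≡ 4 * m → Balanced (nb (suc p)) 5 → i ≡ suc p → Balanced X₀ 5
      -- The mirror image of node `suc p` is node `suc q`. The smaller of the two takes the lower
      -- place in `step₅`, and equality would mean the middle node.
      interior p q p+q b i≡ with ℕₚ.<-cmp p q
      ... | tri≈ _ refl _ = ⊥-elim (i≢mid (trans i≡ (trans (cong suc (ℕₚ.*-cancelˡ-≡ p (2 * m) 2 (trans (cong (p +_) (ℕₚ.+-identityʳ p)) (trans p+q (ℕₚ.*-assoc 2 2 m))))) (ℕₚ.+-comm 1 (2 * m)))))
      ... | tri< p<q _ _ = step₅ m ext p k (trans (ring₁ p k) (cong (_+ 2) (trans (cong (p +_) k≡) p+q))) (below-suc 4 up₄) b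
            (subst (λ j → Balanced (nb j) 5) (sym (trans (ring₂ p k) (cong suc k≡))) (mirror (suc p) (suc q) 4 (trans (ring₃ p q) (cong (_+ 2) p+q)) (ℕₚ.m≤m+n 5 3) b))
        where
        k = q ∸ suc p
        k≡ : suc p + k ≡ q
        k≡ = ℕₚ.m+[n∸m]≡n p<q
      ... | tri> _ _ q<p = step₅ m ext q k (trans (ring₁ q k) (cong (_+ 2) (trans (cong (q +_) k≡) (trans (ℕₚ.+-comm q p) p+q)))) (below-suc 4 up₄)
            (mirror (suc p) (suc q) 4 (trans (ring₃ p q) (cong (_+ 2) p+q)) (ℕₚ.m≤m+n 5 3) b)
            (subst (λ j → Balanced (nb j) 5) (sym (trans (ring₂ q k) (cong suc k≡))) b)
        where
        k = p ∸ suc q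
        k≡ : suc q + k ≡ p
        k≡ = ℕₚ.m+[n∸m]≡n q<p

    4*m≡2+ : 4 * m ∸ 2 + 2 ≡ 4 * m
    4*m≡2+ = ℕₚ.m∸n+n≡m (ℕₚ.≤-trans (ℕₚ.m≤m+n 2 2) (ℕₚ.*-monoʳ-≤ 4 1≤m))

    sixth-design : ∀ i → i ≤ P → i ≢ 2 * m + 1 → m ∈ exceptional → Balanced (nb i) 6 → Balanced X₀ 6
    sixth-design i i≤P i≢mid m∈ bal = from-ends i (ℕₚ.m≤m+n 6 2) i≤P bal λ p q p+q b _ →
      step₆ m ext p q p+q (4 * m ∸ 2) 4*m≡2+
        (nonvanishingCheck-sound m p q p+q (allFrom-sound (nonvanishingCheck m) 0 (4 * m + 1) (All.lookup nonvanishing-all m∈) p z≤n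
          (subst (p <_) (ℕₚ.+-comm 1 (4 * m)) (s≤s (subst (p ≤_) p+q (ℕₚ.m≤m+n p q))))))
        (below-suc 5 up₅) b
      where
      up₅ : UpTo X₀ 5
      up₅ = fifth-design i i≤P i≢mid (upTo 6 i≤P (ℕₚ.m≤m+n 6 2) bal 5 (ℕₚ.n≤1+n 5))

    small≤n : ∀ {t} → t ≤ 8 → t ≤ n
    small≤n t≤8 = ℕₚ.≤-trans t≤8 (ℕₚ.≤-trans (ℕₚ.m≤m+n 8 8) (ℕₚ.m≤n+m 16 (24 * m)))

    min-integral : ∀ t → t ≤ 8 → Balanced X₀ t → integral m P 0 t ≡ true
    min-integral t t≤8 bal = balanced⇒integral m ext P 0 (ℕₚ.+-identityʳ P) t (small≤n t≤8)
      (subst (λ w → Balanced (block C w) t) (sym (nodeWeight-P m ext)) bal)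

    fourth-conclusion : m ≤ 163 → UpTo X₀ 4 → m ∈ exceptional
    fourth-conclusion m≤163 up = not-20 (fourth-exceptional m 1≤m m≤163 (min-integral 4 (ℕₚ.m≤m+n 4 4) (up 4 ℕₚ.≤-refl)))
      where
      not-20 : m ∈ 20 ∷ exceptional → m ∈ exceptional
      not-20 (here m≡20) = ⊥-elim (no-4-design-20 m ext m≡20 (λ s s<5 → up s (s≤s⁻¹ s<5)))
      not-20 (there m∈)  = m∈

    fifth-conclusion : m ∈ exceptional → Balanced X₀ 5 → m ∈ 23 ∷ 79 ∷ 93 ∷ 118 ∷ 120 ∷ 123 ∷ 125 ∷ 142 ∷ []
    fifth-conclusion (there m∈)  bal = m∈
    fifth-conclusion (here m≡10) bal = ⊥-elim (true-false (min-integral 5 (ℕₚ.m≤m+n 5 3) bal)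
      (subst (λ m → integral m (4 * m + 2) 0 5 ≡ false) (sym m≡10) fifth-10))

    mid+mid : 2 * m + 1 + (2 * m + 1) ≡ P
    mid+mid = ring m
      where
      ring : ∀ m → 2 * m + 1 + (2 * m + 1) ≡ 4 * m + 2
      ring = NS.solve-∀

    no-sixth : ∀ i → i ≤ P → m ∈ exceptional → ¬ Balanced (nb i) 6
    no-sixth i i≤P m∈ bal = generic-or-middle (i ≟ 2 * m + 1)
      where
      generic-or-middle : Dec (i ≡ 2 * m + 1) → ⊥
      generic-or-middle (no i≢mid)  = true-false (min-integral 6 (ℕₚ.m≤m+n 6 2) (sixth-design i i≤P i≢mid m∈ bal)) (All.lookup sixth-minimal m∈)
      generic-or-middle (yes i≡mid) = true-false (balanced⇒integral m ext (2 * m + 1) (2 * m + 1) mid+mid 6 (small≤n (ℕₚ.m≤m+n 6 2))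
        (subst (λ i → Balanced (nb i) 6) i≡mid bal)) (All.lookup sixth-middle m∈)

    node-index : ∀ {w} → Div4 w → 4 * m + 4 ≤ w → w + (4 * m + 4) ≤ n → ∃ λ i → i ≤ P × nodeWeight m ext i ≡ w
    node-index (div4 k) lo hi = i , ℕₚ.m∸n≤m P j , weight≡
      where
      ring₁ : ∀ m → 4 * m + 4 ≡ 4 * suc m
      ring₁ = NS.solve-∀
      j = k ∸ suc m
      k≡ : suc m + j ≡ k
      k≡ = ℕₚ.m+[n∸m]≡n (ℕₚ.*-cancelˡ-≤ {suc m} {k} 4 (subst (_≤ 4 * k) (ring₁ m) lo))
      ring₂ : ∀ m → 24 * m + 16 ≡ 4 * m + 4 + (4 * m + 4) + 4 * (4 * m + 2)
      ring₂ = NS.solve-∀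
      ring₃ : ∀ m j → 4 * (suc m + j) + (4 * m + 4) ≡ 4 * m + 4 + (4 * m + 4) + 4 * j
      ring₃ = NS.solve-∀
      j≤P : j ≤ P
      j≤P = ℕₚ.*-cancelˡ-≤ {j} {P} 4 (ℕₚ.+-cancelˡ-≤ (4 * m + 4 + (4 * m + 4)) _ _
        (subst₂ _≤_ (trans (cong (λ k → 4 * k + (4 * m + 4)) (sym k≡)) (ring₃ m j)) (ring₂ m) hi))
      -- `j` counts steps of four above the minimum weight, while node indices grow with the number
      -- of zeros.
      i = P ∸ j
      sum : 4 * k + node m ext i ≡ n
      sum = trans (cong (λ k → 4 * k + node m ext i) (sym k≡)) (trans (ring₄ m i j) (trans (cong (λ s → 4 * m + 4 + (4 * m + 4) + 4 * s) (ℕₚ.m∸n+n≡m j≤P)) (sym (ring₂ m))))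
        where
        ring₄ : ∀ m i j → 4 * (suc m + j) + (4 * m + 4 + 4 * i) ≡ 4 * m + 4 + (4 * m + 4) + 4 * (i + j)
        ring₄ = NS.solve-∀
      weight≡ : nodeWeight m ext i ≡ 4 * k
      weight≡ = trans (cong (_∸ node m ext i) (sym sum)) (ℕₚ.m+n∸n≡m (4 * k) (node m ext i))

    mid-weight : nodeWeight m ext (2 * m + 1) ≡ 12 * m + 8
    mid-weight = trans (cong (_∸ node m ext (2 * m + 1)) (ring m)) (ℕₚ.m+n∸n≡m (12 * m + 8) (node m ext (2 * m + 1)))
      where
      ring : ∀ m → 24 * m + 16 ≡ 12 * m + 8 + (4 * m + 4 + 4 * (2 * m + 1))
      ring = NS.solve-∀

    mid≤P : 2 * m + 1 ≤ P
    mid≤P = subst (2 * m + 1 ≤_) mid+mid (ℕₚ.m≤m+n (2 * m + 1) (2 * m + 1))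

    -- Complementation maps the middle weight to itself and multiplies its imbalance at strength
    -- five by -1, so the imbalance equals its own negative.
    mid-fifth : Balanced (nb (2 * m + 1)) 4 → Balanced (nb (2 * m + 1)) 5
    mid-fifth bal = balanced-from m ext (nb (2 * m + 1)) 5 λ T T′ e e′ → i≡-i⇒i≡0 (imbalance (nb (2 * m + 1)) T T′)
      (trans (mirror-imbalance (2 * m + 1) (2 * m + 1) 4 mid+mid (ℕₚ.m≤m+n 5 3) (upTo 4 mid≤P (ℕₚ.m≤m+n 4 4) bal) T T′ e e′)
        (ℤₚ.-1*i≡-i (imbalance (nb (2 * m + 1)) T T′)))

-- From weights and support designs to nodes and balance.

open import Data.Nat using (ℕ; _+_; _*_; _≤_)
open import Data.List using (List; []; _∷_)
open import Data.List.Membership.Propositional using (_∈_)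
open import Data.Product using (_×_; _,_; ∃)
open import Relation.Binary.PropositionalEquality using (_≡_; _≢_; trans; sym; cong; subst)
open import Relation.Nullary using (¬_)
import Data.Nat.Properties as ℕₚ
open Complements using (block; design⇒balanced; balanced⇒design)
open Designs using (Balanced)
open NodeSums using (nodeWeight; nodeBlock)
open Computations using (exceptional)
open Conclusion

theorem3p7 : (m : ℕ) → 1 ≤ m → m ≤ 163 →
    (C : Code (24 * m + 16)) → ExtremalDoublyEvenSelfDual C →
    ((w : ℕ) → Div4 w → 4 * m + 4 ≤ w → w + (4 * m + 4) ≤ 24 * m + 16 → w ≢ 12 * m + 8 →
    (IsTDesign 4 (supportDesign C w) →
    m ∈ (10 ∷ 23 ∷ 79 ∷ 93 ∷ 118 ∷ 120 ∷ 123 ∷ 125 ∷ 142 ∷ []))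
    × (IsTDesign 5 (supportDesign C w) →
    m ∈ (23 ∷ 79 ∷ 93 ∷ 118 ∷ 120 ∷ 123 ∷ 125 ∷ 142 ∷ [])))
    × (IsTDesign 4 (supportDesign C (12 * m + 8)) →
    IsTDesign 5 (supportDesign C (12 * m + 8))
    × m ∈ (10 ∷ 23 ∷ 79 ∷ 93 ∷ 118 ∷ 120 ∷ 123 ∷ 125 ∷ 142 ∷ []))
    × ((w : ℕ) → Div4 w → 4 * m + 4 ≤ w → w + (4 * m + 4) ≤ 24 * m + 16 →
    ¬ IsTDesign 6 (supportDesign C w))
theorem3p7 m 1≤m m≤163 C ext = (λ w 4∣w lo hi w≢mid → generic w w≢mid (node-index m ext 1≤m 4∣w lo hi))
                             , middle
                             , (λ w 4∣w lo hi → none w (node-index m ext 1≤m 4∣w lo hi))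
  where
  Node : ℕ → Set
  Node w = ∃ λ i → i ≤ 4 * m + 2 × nodeWeight m ext i ≡ w

  balanced-at : ∀ t w i → nodeWeight m ext i ≡ w → IsTDesign t (supportDesign C w) → Balanced (nodeBlock m ext i) t
  balanced-at t w i e des = subst (λ w → Balanced (block C w) t) (sym e) (design⇒balanced {C = C} {t} {w} des)

  fourth : ∀ i → i ≤ 4 * m + 2 → Balanced (nodeBlock m ext i) 4 → m ∈ exceptional
  fourth i i≤P bal = fourth-conclusion m ext 1≤m m≤163 (fourth-design m ext 1≤m i i≤P bal)

  generic : ∀ w → w ≢ 12 * m + 8 → Node w →
    (IsTDesign 4 (supportDesign C w) → m ∈ exceptional)
    × (IsTDesign 5 (supportDesign C w) → m ∈ 23 ∷ 79 ∷ 93 ∷ 118 ∷ 120 ∷ 123 ∷ 125 ∷ 142 ∷ [])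
  generic w w≢mid (i , i≤P , e) = (λ des → fourth i i≤P (balanced-at 4 w i e des)) , λ des →
    let bal = balanced-at 5 w i e des in
    fifth-conclusion m ext 1≤m (fourth i i≤P (upTo m ext 1≤m {i} 5 i≤P (ℕₚ.m≤m+n 5 3) bal 4 (ℕₚ.n≤1+n 4)))
      (fifth-design m ext 1≤m i i≤P (λ i≡mid → w≢mid (trans (sym e) (trans (cong (nodeWeight m ext) i≡mid) (mid-weight m ext 1≤m)))) bal 5 ℕₚ.≤-refl)

  middle : IsTDesign 4 (supportDesign C (12 * m + 8)) → IsTDesign 5 (supportDesign C (12 * m + 8)) × m ∈ exceptional
  middle des = balanced⇒design {C = C} {5} {12 * m + 8} (subst (λ w → Balanced (block C w) 5) (mid-weight m ext 1≤m) (mid-fifth m ext 1≤m bal))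
             , fourth (2 * m + 1) (mid≤P m ext 1≤m) bal
    where
    bal : Balanced (nodeBlock m ext (2 * m + 1)) 4
    bal = balanced-at 4 (12 * m + 8) (2 * m + 1) (mid-weight m ext 1≤m) des

  none : ∀ w → Node w → ¬ IsTDesign 6 (supportDesign C w)
  none w (i , i≤P , e) des =
    no-sixth m ext 1≤m i i≤P (fourth i i≤P (upTo m ext 1≤m {i} 6 i≤P (ℕₚ.m≤m+n 6 2) bal 4 (ℕₚ.m≤m+n 4 2))) bal
    where
    bal : Balanced (nodeBlock m ext i) 6
    bal = balanced-at 6 w i e des
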